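{- Fix an integer $r\geq3$. There is a constant $C=C(r)>0$ such that the following holds. Let $f$ be a positive integer-valued function on the positive integers satisfying $f(n)=o(n)$. For all sufficiently large $n$ (in terms of $r$ and $f$), if $G$ is an $n$-vertex $K_r$-free graph with minimum degree at least $\frac{2r-5}{2r-3}n-f(n)$ and chromatic number at least $10^{391}+(r-3)$, then $G$ admits a partition $V(G)=I_0\cup I_1\cup\dots\cup I_{r-2}\cup A$ such that $I_0,I_1,\dots,I_{r-2}$ are independent sets, $\bigl||I_0|-\frac{n}{2r-3}\bigr|\leq Cf(n)$, $\bigl||I_i|-\frac{2n}{2r-3}\bigr|\leq Cf(n)$ for every $i\in\{1,\dots,r-2\}$, and the induced subgraph $G[A]$ admits a graph homomorphism to a Kneser graph $KG(p,q)$ for some positive integers $p,q$ with $p\geq\frac{n}{2r-3}-Cf(n)$ and $q\leq Cf(n)$.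
   Context: All graphs are finite and simple. For positive integers $p,q$, the Kneser graph $KG(p,q)$ has as vertex set the collection of all $p$-element subsets of $\{1,\dots,2p+q\}$, two vertices being adjacent if and only if the corresponding subsets are disjoint (often denoted $KG(2p+q,p)$). A graph homomorphism $F\to F'$ is a vertex map sending every edge of $F$ to an edge of $F'$. -}

module Defs where

open import Data.Fin.Base using (Fin)
import Data.Fin.Properties as Fin
open import Data.Fin.Subset using (Subset; _∈_; _∩_; Nonempty; Empty; ∣_∣; ⊥)
open import Data.Fin.Subset.Properties using (nonempty?; Empty-unique; ∣⊥∣≡0; ∩-comm; ∩-idem)
open import Data.Integer.Base using (+_)
open import Data.Nat.Base as ℕ using (ℕ; NonZero)
import Data.Nat.Properties as ℕ
open import Data.Product.Base using (∃; _×_; _,_; proj₁; proj₂; Σ-syntax)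
open import Data.Rational.Base as ℚ using (ℚ; 0ℚ)
open import Data.Vec.Base using (tabulate)
open import Data.Vec.Functional using (Vector)
open import Function.Definitions using (Injective)
open import Level using (0ℓ)
open import Relation.Binary.Core using (Rel)
open import Relation.Binary.Definitions using (Decidable; Symmetric)
open import Relation.Binary.PropositionalEquality
  using (_≡_; _≢_; refl; cong; subst; ≢-sym; module ≡-Reasoning)
open import Relation.Nullary using (¬_; does; ¬?)

record SimpleGraph (V : Set) : Set₁ where
  field
    Adj    : Rel V 0ℓ
    adj?   : Decidable Adj
    sym    : Symmetric Adj
    irrefl : ∀ {v} → ¬ Adj v v

open SimpleGraph public using (Adj; adj?)

record Hom {V W : Set} (F : SimpleGraph V) (F′ : SimpleGraph W) : Set where
  field
    map      : V → W
    map-edge : ∀ {u v} → Adj F u v → Adj F′ (map u) (map v)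

complete : ∀ r → SimpleGraph (Fin r)
complete r = record
  { Adj    = _≢_
  ; adj?   = λ i j → ¬? (i Fin.≟ j)
  ; sym    = ≢-sym
  ; irrefl = λ v≢v → v≢v refl
  }

-- F is isomorphic to a (not necessarily induced) subgraph of G.
Contains : ∀ {V W} → SimpleGraph V → SimpleGraph W → Set
Contains G F = Σ[ h ∈ Hom F G ] Injective _≡_ _≡_ (Hom.map h)

_-free : ∀ {W} → SimpleGraph W → ∀ {V} → SimpleGraph V → Set
(F -free) G = ¬ Contains G F

Colourable : ∀ {V} → SimpleGraph V → ℕ → Set
Colourable {V} G k =
  Σ[ c ∈ (V → Fin k) ] (∀ {u v} → Adj G u v → c u ≢ c v)

IsChromaticNumber : ∀ {V} → SimpleGraph V → ℕ → Set
IsChromaticNumber G χ = Colourable G χ × (∀ k → Colourable G k → χ ℕ.≤ k)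

neighbours : ∀ {n} → SimpleGraph (Fin n) → Fin n → Subset n
neighbours G v = tabulate (λ u → does (adj? G v u))

degree : ∀ {n} → SimpleGraph (Fin n) → Fin n → ℕ
degree G v = ∣ neighbours G v ∣

IsMinimumDegree : ∀ {n} → SimpleGraph (Fin n) → ℕ → Set
IsMinimumDegree G δ = (∃ λ v → degree G v ≡ δ) × (∀ v → δ ℕ.≤ degree G v)

Independent : ∀ {n} → SimpleGraph (Fin n) → Subset n → Set
Independent G S = ∀ {u v} → u ∈ S → v ∈ S → ¬ Adj G u v

induced : ∀ {n} → SimpleGraph (Fin n) → (A : Subset n) → SimpleGraph (∃ (_∈ A))
induced G A = record
  { Adj    = λ u v → Adj G (proj₁ u) (proj₁ v)
  ; adj?   = λ u v → adj? G (proj₁ u) (proj₁ v)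
  ; sym    = SimpleGraph.sym G
  ; irrefl = SimpleGraph.irrefl G
  }

-- Parts are allowed to be empty.
IsPartition : ∀ {n k} → Vector (Subset n) k → Set
IsPartition {n} P =
  (∀ v → ∃ λ i → v ∈ P i) × (∀ i j → i ≢ j → Empty (P i ∩ P j))

KneserVertex : ℕ → ℕ → Set
KneserVertex p q = Σ[ S ∈ Subset (2 ℕ.* p ℕ.+ q) ] ∣ S ∣ ≡ p

-- Positivity of p is what excludes a loop at the empty set.
KG : ∀ p q → .{{NonZero p}} → SimpleGraph (KneserVertex p q)
KG p q = record
  { Adj    = λ S T → Empty (proj₁ S ∩ proj₁ T)
  ; adj?   = λ S T → ¬? (nonempty? (proj₁ S ∩ proj₁ T))
  ; sym    = λ {S} {T} → subst Empty (∩-comm (proj₁ S) (proj₁ T))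
  ; irrefl = λ { {S , ∣S∣≡p} disjoint → ℕ.≢-nonZero⁻¹ p (begin
      p           ≡⟨ ∣S∣≡p ⟨
      ∣ S ∣       ≡⟨ cong ∣_∣ (∩-idem S) ⟨
      ∣ S ∩ S ∣   ≡⟨ cong ∣_∣ (Empty-unique disjoint) ⟩
      ∣ ⊥ {2 ℕ.* p ℕ.+ q} ∣  ≡⟨ ∣⊥∣≡0 (2 ℕ.* p ℕ.+ q) ⟩
      0           ∎) }
  }
  where
  open ≡-Reasoning

fromℕ : ℕ → ℚ
fromℕ m = + m ℚ./ 1

infix 4 _=o_

_=o_ : (ℕ → ℕ) → (ℕ → ℕ) → Set
f =o g = ∀ ε → 0ℚ ℚ.< ε →
  ∃ λ N → ∀ n → N ℕ.≤ n → fromℕ (f n) ℚ.≤ ε ℚ.* fromℕ (g n)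

2r∸3-nonZero : ∀ {r} → 3 ℕ.≤ r → NonZero (2 ℕ.* r ℕ.∸ 3)
2r∸3-nonZero {r} 3≤r = ℕ.>-nonZero (ℕ.m<n⇒0<n∸m
  (ℕ.≤-trans (ℕ.m≤n+m 4 2) (ℕ.*-monoʳ-≤ 2 3≤r)))

{-# OPTIONS --safe #-}
module Submission where

-- Let u be the largest number of non-neighbours of a vertex, so that (2k + 3) u ≤ 2n + e with k = r − 3 and e = O(f).
--
-- A maximal family of k disjoint independent classes covering almost k u vertices contains a transversal clique in the
-- neighbourhood of every vertex outside it. Hence either the vertices outside span a triangle-free graph, or two of them
-- have no common neighbour in some class, and then there is another independent set of almost u vertices outside. Such a
-- family exists because G contains a k-clique joined to a five-cycle: this follows by induction on k from the failure of
-- (k + 2)-colourability, and the classes are formed by vertices that miss exactly one vertex of the clique.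
--
-- If the vertices outside span a triangle-free graph, sample 1280 of them at random. The set of samples adjacent to x
-- determines the codegrees of x up to a small mean-square error. Since 16 · 2 ^ 1280 colours do not suffice, two adjacent
-- vertices have similar codegrees, so few edges run between their neighbourhoods, and deleting a small vertex cover of
-- these edges and cleaning up leaves an independent set of almost u vertices.
--
-- In all cases r − 2 independent classes cover all but about u / 2 vertices. Two adjacent vertices of the remainder R
-- have no common neighbour in exactly one of the classes, and this class is the same for all edges of R at a vertex.
-- Their neighbourhoods in that class, cut down to p ≈ u / 2 elements, are disjoint p-subsets of a set of u = 2p + q
-- points. Each non-isolated vertex of R misses a third of some class, while vertices of the classes miss almost nothing
-- outside their own class, so few vertices of R are not isolated.

-- The degree condition makes 2n almost (2k + 3) u, so k classes of nearly u vertices leave about 3u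
-- / 2 vertices, among which degrees are at least about one third. For triangle-free graphs one
-- third is the chromatic threshold: Hajnal's graphs lie just below it with unbounded chromatic
-- number. So the number of colours cannot be bounded outright; the shape of these graphs has to be
-- forced, with all losses linear in e. Counting non-neighbours instead of neighbours gives every
-- independent set at most u vertices and turns the estimates into nonnegative combinations of
-- inequalities between cardinalities. The extremal choices range over colourings by natural numbers
-- and are made in negated form, with conclusion `⊥`. The negation is removed once, when the family
-- wanted is a decidable property of finitely many colour vectors. The exponent 391 comes from the
-- sampling: 16 · 2 ^ 1280 = 2 ^ 1284 is below 10 ^ 387.

module Development where
  open import Data.Bool.Base as Bool using (Bool; true; false; _∧_; _∨_; not; if_then_else_)
  open import Data.Bool.Properties using () renaming (_≟_ to _≟ᵇ_)
  open import Data.Empty using (⊥; ⊥-elim)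
  open import Data.Fin.Base using (Fin; zero; suc; toℕ; fromℕ<)
  import Data.Fin.Properties as FinP
  open import Data.Fin.Subset as Subset using (Subset)
  import Data.Fin.Subset.Properties as SubsetP
  open import Data.Integer.Base as ℤ using (ℤ; +_; -[1+_])
  import Data.Integer.Properties as ℤP
  import Data.Integer.Tactic.RingSolver as ℤRing
  open import Data.List.Base as List using (List; []; _∷_)
  open import Data.List.Relation.Unary.All using (All; []; _∷_)
  open import Data.Maybe.Base using (Maybe; just; nothing)
  open import Data.Nat.Base
  open import Data.Nat.Properties
  open import Data.Product.Base using (Σ-syntax; _×_; _,_; proj₁; proj₂)
  open import Data.Rational.Base as ℚ using (ℚ)
  import Data.Rational.Properties as ℚP
  open import Data.Rational.Unnormalised.Base as ℚᵘ using (mkℚᵘ; *≡*; *≤*)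
  import Data.Rational.Unnormalised.Properties as ℚᵘP
  open import Data.Sum.Base using (_⊎_; inj₁; inj₂; [_,_]′)
  open import Data.Vec.Base as Vec using (Vec; []; _∷_)
  import Data.Vec.Functional as Vector
  import Data.Vec.Properties as VecP
  open import Function.Base using (_∘_; id; case_of_)
  open import Relation.Binary.PropositionalEquality hiding (J)
  open import Relation.Nullary using (¬_; ¬?; Dec; yes; no; does; contradiction)
  open import Relation.Nullary.Decidable using (_→-dec_; decidable-stable)
  import Algebra.Properties.AbelianGroup as AbelianGroupProperties
  import Algebra.Properties.Group as GroupProperties
  open import Algebra.Properties.CommutativeSemigroup +-commutativeSemigroup using () renaming (x∙yz≈y∙xz to +-swap)
  open import Algebra.Properties.CommutativeSemigroup *-commutativeSemigroup using () renaming (x∙yz≈y∙xz to *-swap; interchange to *-interchange)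
  open import Algebra.Properties.Semiring.Sum +-*-semiring
    using (sum; ∑-distrib-+; ∑-comm; sum-cong-≗; *-distribˡ-sum; *-distribʳ-sum; sum-replicate-zero)
  open import Algebra.Properties.Semiring.Sum ℤP.+-*-semiring using ()
    renaming (sum to sumℤ; ∑-distrib-+ to ∑ℤ-distrib-+; sum-cong-≗ to sumℤ-cong; *-distribˡ-sum to *-distribˡ-sumℤ)
  import Defs
  open Defs using (SimpleGraph; Adj; adj?; Hom; complete; Contains; Colourable; IsChromaticNumber; IsMinimumDegree;
    induced; KG; KneserVertex; IsPartition; fromℕ; _=o_)

  -- Linear arithmetic by certificates

  infixl 6 _:+_
  infixl 7 _:*_
  infix 5 _:≤_

  data Expr : Set where
    var : ℕ → Expr
    κ   : ℕ → Expr
    _:+_ _:*_ : Expr → Expr → Expr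

  record Ineq : Set where
    constructor _:≤_
    field lower upper : Expr
  open Ineq

  Env : Set
  Env = List ℕ

  _‼_ : Env → ℕ → ℕ
  []      ‼ i     = 0
  (a ∷ ρ) ‼ zero  = a
  (a ∷ ρ) ‼ suc i = ρ ‼ i

  ⟪_⟫ : Expr → Env → ℕ
  ⟪ var i ⟫ ρ  = ρ ‼ i
  ⟪ κ c ⟫ ρ    = c
  ⟪ a :+ b ⟫ ρ = ⟪ a ⟫ ρ + ⟪ b ⟫ ρ
  ⟪ a :* b ⟫ ρ = ⟪ a ⟫ ρ * ⟪ b ⟫ ρ

  Holds : Env → Ineq → Set
  Holds ρ (a :≤ b) = ⟪ a ⟫ ρ ≤ ⟪ b ⟫ ρ

  Mono : Set
  Mono = List ℕ

  Poly : Set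
  Poly = List (ℕ × Mono)

  monoVal : Env → Mono → ℕ
  monoVal ρ []      = 1
  monoVal ρ (i ∷ m) = (ρ ‼ i) * monoVal ρ m

  polyVal : Env → Poly → ℕ
  polyVal ρ []            = 0
  polyVal ρ ((c , m) ∷ p) = c * monoVal ρ m + polyVal ρ p

  insertVar : ℕ → Mono → Mono
  insertVar i []      = i ∷ []
  insertVar i (j ∷ m) = if i ≤ᵇ j then i ∷ j ∷ m else j ∷ insertVar i m

  mulMono : Mono → Mono → Mono
  mulMono []      m′ = m′
  mulMono (i ∷ m) m′ = insertVar i (mulMono m m′)

  sameMono : Mono → Mono → Bool
  sameMono []      []       = true
  sameMono []      (_ ∷ _)  = false
  sameMono (_ ∷ _) []       = false
  sameMono (i ∷ m) (j ∷ m′) = (i ≡ᵇ j) ∧ sameMono m m′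

  addTerm : ℕ → Mono → Poly → Poly
  addTerm c m []             = (c , m) ∷ []
  addTerm c m ((d , m′) ∷ p) = if sameMono m m′ then (c + d , m′) ∷ p else (d , m′) ∷ addTerm c m p

  addPoly : Poly → Poly → Poly
  addPoly []            q = q
  addPoly ((c , m) ∷ p) q = addTerm c m (addPoly p q)

  scale : ℕ → Mono → Poly → Poly → Poly
  scale c m []             r = r
  scale c m ((d , m′) ∷ q) r = addTerm (c * d) (mulMono m m′) (scale c m q r)

  mulPoly : Poly → Poly → Poly
  mulPoly []            q = []
  mulPoly ((c , m) ∷ p) q = scale c m q (mulPoly p q)

  norm : Expr → Poly
  norm (var i)  = (1 , i ∷ []) ∷ []
  norm (κ c)    = (c , []) ∷ []
  norm (a :+ b) = addPoly (norm a) (norm b)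
  norm (a :* b) = mulPoly (norm a) (norm b)

  subTerm : ℕ → Mono → Poly → Maybe Poly
  subTerm c m [] = if c ≡ᵇ 0 then just [] else nothing
  subTerm c m ((d , m′) ∷ p) =
    if sameMono m m′ ∧ (c ≤ᵇ d)
    then just ((d ∸ c , m′) ∷ p)
    else (case subTerm c m p of λ { (just q) → just ((d , m′) ∷ q) ; nothing → nothing })

  -- Comparing coefficients monomial by monomial is sound because the variables range over natural
  -- numbers. The test is incomplete, but the certificates below are chosen to pass it.
  dominated : Poly → Poly → Bool
  dominated []            p = true
  dominated ((c , m) ∷ q) p = case subTerm c m p of λ { (just p′) → dominated q p′ ; nothing → false }

  ∧-elim : ∀ {a b} → a ∧ b ≡ true → a ≡ true × b ≡ true
  ∧-elim {true} {true} _ = refl , refl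

  ==-sound : ∀ i j → (i ≡ᵇ j) ≡ true → i ≡ j
  ==-sound i j eq = ≡ᵇ⇒≡ i j (subst Bool.T (sym eq) _)

  ≤ᵇ-true : ∀ i j → (i ≤ᵇ j) ≡ true → i ≤ j
  ≤ᵇ-true i j eq = ≤ᵇ⇒≤ i j (subst Bool.T (sym eq) _)

  insertVar-val : ∀ ρ i m → monoVal ρ (insertVar i m) ≡ (ρ ‼ i) * monoVal ρ m
  insertVar-val ρ i [] = refl
  insertVar-val ρ i (j ∷ m) with i ≤ᵇ j
  ... | true  = refl
  ... | false = trans (cong ((ρ ‼ j) *_) (insertVar-val ρ i m)) (*-swap (ρ ‼ j) (ρ ‼ i) (monoVal ρ m))

  mulMono-val : ∀ ρ m m′ → monoVal ρ (mulMono m m′) ≡ monoVal ρ m * monoVal ρ m′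
  mulMono-val ρ []      m′ = sym (+-identityʳ _)
  mulMono-val ρ (i ∷ m) m′ = trans (insertVar-val ρ i (mulMono m m′))
    (trans (cong ((ρ ‼ i) *_) (mulMono-val ρ m m′)) (sym (*-assoc (ρ ‼ i) (monoVal ρ m) (monoVal ρ m′))))

  sameMono-sound : ∀ m m′ → sameMono m m′ ≡ true → m ≡ m′
  sameMono-sound []      []       _  = refl
  sameMono-sound (i ∷ m) (j ∷ m′) eq with i≡j , rest ← ∧-elim eq =
    cong₂ _∷_ (==-sound i j i≡j) (sameMono-sound m m′ rest)

  addTerm-val : ∀ ρ c m p → polyVal ρ (addTerm c m p) ≡ c * monoVal ρ m + polyVal ρ p
  addTerm-val ρ c m [] = refl
  addTerm-val ρ c m ((d , m′) ∷ p) with sameMono m m′ in eq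
  ... | true  rewrite sameMono-sound m m′ eq =
    trans (cong (_+ polyVal ρ p) (*-distribʳ-+ (monoVal ρ m′) c d)) (+-assoc (c * monoVal ρ m′) _ _)
  ... | false = trans (cong (_+_ (d * monoVal ρ m′)) (addTerm-val ρ c m p)) (+-swap (d * monoVal ρ m′) (c * monoVal ρ m) (polyVal ρ p))

  addPoly-val : ∀ ρ p q → polyVal ρ (addPoly p q) ≡ polyVal ρ p + polyVal ρ q
  addPoly-val ρ []            q = refl
  addPoly-val ρ ((c , m) ∷ p) q = trans (addTerm-val ρ c m (addPoly p q))
    (trans (cong (_+_ (c * monoVal ρ m)) (addPoly-val ρ p q)) (sym (+-assoc (c * monoVal ρ m) _ _)))

  scale-val : ∀ ρ c m q r → polyVal ρ (scale c m q r) ≡ c * monoVal ρ m * polyVal ρ q + polyVal ρ r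
  scale-val ρ c m []             r = cong (_+ polyVal ρ r) (sym (*-zeroʳ (c * monoVal ρ m)))
  scale-val ρ c m ((d , m′) ∷ q) r = begin
    polyVal ρ (addTerm (c * d) (mulMono m m′) (scale c m q r))
      ≡⟨ addTerm-val ρ (c * d) (mulMono m m′) (scale c m q r) ⟩
    c * d * monoVal ρ (mulMono m m′) + polyVal ρ (scale c m q r)
      ≡⟨ cong₂ (λ x y → c * d * x + y) (mulMono-val ρ m m′) (scale-val ρ c m q r) ⟩
    c * d * (monoVal ρ m * monoVal ρ m′) + (c * monoVal ρ m * polyVal ρ q + polyVal ρ r)
      ≡⟨ cong (_+ (c * monoVal ρ m * polyVal ρ q + polyVal ρ r)) (*-interchange c d (monoVal ρ m) (monoVal ρ m′)) ⟩
    c * monoVal ρ m * (d * monoVal ρ m′) + (c * monoVal ρ m * polyVal ρ q + polyVal ρ r)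
      ≡⟨ +-assoc (c * monoVal ρ m * (d * monoVal ρ m′)) _ _ ⟨
    c * monoVal ρ m * (d * monoVal ρ m′) + c * monoVal ρ m * polyVal ρ q + polyVal ρ r
      ≡⟨ cong (_+ polyVal ρ r) (*-distribˡ-+ (c * monoVal ρ m) (d * monoVal ρ m′) (polyVal ρ q)) ⟨
    c * monoVal ρ m * (d * monoVal ρ m′ + polyVal ρ q) + polyVal ρ r ∎
    where open ≡-Reasoning

  mulPoly-val : ∀ ρ p q → polyVal ρ (mulPoly p q) ≡ polyVal ρ p * polyVal ρ q
  mulPoly-val ρ []            q = refl
  mulPoly-val ρ ((c , m) ∷ p) q = trans (scale-val ρ c m q (mulPoly p q))
    (trans (cong (_+_ (c * monoVal ρ m * polyVal ρ q)) (mulPoly-val ρ p q))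
           (sym (*-distribʳ-+ (polyVal ρ q) (c * monoVal ρ m) (polyVal ρ p))))

  norm-val : ∀ ρ a → polyVal ρ (norm a) ≡ ⟪ a ⟫ ρ
  norm-val ρ (var i)  = trans (+-identityʳ _) (trans (+-identityʳ _) (*-identityʳ (ρ ‼ i)))
  norm-val ρ (κ c)    = trans (+-identityʳ _) (*-identityʳ c)
  norm-val ρ (a :+ b) = trans (addPoly-val ρ (norm a) (norm b)) (cong₂ _+_ (norm-val ρ a) (norm-val ρ b))
  norm-val ρ (a :* b) = trans (mulPoly-val ρ (norm a) (norm b)) (cong₂ _*_ (norm-val ρ a) (norm-val ρ b))

  subTerm-val : ∀ ρ c m p q → subTerm c m p ≡ just q → polyVal ρ p ≡ c * monoVal ρ m + polyVal ρ q
  subTerm-val ρ zero    m [] q refl = refl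
  subTerm-val ρ c m ((d , m′) ∷ p) q eq with sameMono m m′ ∧ (c ≤ᵇ d) in test
  subTerm-val ρ c m ((d , m′) ∷ p) .((d ∸ c , m′) ∷ p) refl | true
    with same , c≤d ← ∧-elim test rewrite sameMono-sound m m′ same = begin
      d * M + polyVal ρ p                      ≡⟨ cong (λ x → x * M + polyVal ρ p) (m+[n∸m]≡n (≤ᵇ-true c d c≤d)) ⟨
      (c + (d ∸ c)) * M + polyVal ρ p          ≡⟨ cong (_+ polyVal ρ p) (*-distribʳ-+ M c (d ∸ c)) ⟩
      c * M + (d ∸ c) * M + polyVal ρ p        ≡⟨ +-assoc (c * M) _ _ ⟩
      c * M + ((d ∸ c) * M + polyVal ρ p)      ∎
      where
      open ≡-Reasoning
      M = monoVal ρ m′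
  subTerm-val ρ c m ((d , m′) ∷ p) q eq | false with subTerm c m p in rec
  subTerm-val ρ c m ((d , m′) ∷ p) .((d , m′) ∷ r) refl | false | just r =
    trans (cong (_+_ (d * monoVal ρ m′)) (subTerm-val ρ c m p r rec)) (+-swap (d * monoVal ρ m′) (c * monoVal ρ m) (polyVal ρ r))

  dominated-sound : ∀ ρ q p → dominated q p ≡ true → polyVal ρ q ≤ polyVal ρ p
  dominated-sound ρ []            p _  = z≤n
  dominated-sound ρ ((c , m) ∷ q) p eq with subTerm c m p in sub
  ... | just p′ rewrite subTerm-val ρ c m p p′ sub = +-monoʳ-≤ (c * monoVal ρ m) (dominated-sound ρ q p′ eq)

  combine : (Ineq → Expr) → List (Expr × Ineq) → Expr
  combine side []             = κ 0
  combine side ((c , h) ∷ hs) = c :* side h :+ combine side hs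

  combine-≤ : ∀ ρ hs → All (Holds ρ ∘ proj₂) hs → ⟪ combine lower hs ⟫ ρ ≤ ⟪ combine upper hs ⟫ ρ
  combine-≤ ρ []             []       = z≤n
  combine-≤ ρ ((c , h) ∷ hs) (p ∷ ps) = +-mono-≤ (*-monoʳ-≤ (⟪ c ⟫ ρ) p) (combine-≤ ρ hs ps)

  -- The hypotheses, weighted by the given multipliers, are added crosswise to the goal, so that only natural coefficients are compared.
  certifies : Ineq → List (Expr × Ineq) → Bool
  certifies (a :≤ b) hs = dominated (norm (a :+ combine upper hs)) (norm (b :+ combine lower hs))

  opaque
    -- The check gives a + U ≤ b + L for the combined upper and lower sides U and L of the
    -- hypotheses, the hypotheses give L ≤ U, and U cancels. The multipliers are expressions and not
    -- only numbers, so products of a hypothesis with a variable are available for nonlinear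
    -- estimates.
    farkas : ∀ ρ goal hs → certifies goal hs ≡ true → All (Holds ρ ∘ proj₂) hs → Holds ρ goal
    farkas ρ (a :≤ b) hs cert ps = +-cancelʳ-≤ (⟪ combine upper hs ⟫ ρ) (⟪ a ⟫ ρ) (⟪ b ⟫ ρ) (begin
      ⟪ a :+ combine upper hs ⟫ ρ                ≡⟨ norm-val ρ (a :+ combine upper hs) ⟨
      polyVal ρ (norm (a :+ combine upper hs))   ≤⟨ dominated-sound ρ (norm (a :+ combine upper hs)) (norm (b :+ combine lower hs)) cert ⟩
      polyVal ρ (norm (b :+ combine lower hs))   ≡⟨ norm-val ρ (b :+ combine lower hs) ⟩
      ⟪ b ⟫ ρ + ⟪ combine lower hs ⟫ ρ            ≤⟨ +-monoʳ-≤ (⟪ b ⟫ ρ) (combine-≤ ρ hs ps) ⟩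
      ⟪ b :+ combine upper hs ⟫ ρ                ∎)
      where open ≤-Reasoning

  pattern x₀ = var 0
  pattern x₁ = var 1
  pattern x₂ = var 2
  pattern x₃ = var 3
  pattern x₄ = var 4
  pattern x₅ = var 5
  pattern x₆ = var 6
  pattern x₇ = var 7
  pattern x₈ = var 8
  pattern x₉ = var 9

  -- Counting in finite sets given by Boolean characteristic functions

  infix 4 _∈_ _⊆_
  infixl 7 _∩_
  infixl 6 _∖_

  VSet : ℕ → Set
  VSet n = Fin n → Bool

  _∈_ : ∀ {n} → Fin n → VSet n → Set
  v ∈ A = A v ≡ true

  _⊆_ : ∀ {n} → VSet n → VSet n → Set
  A ⊆ B = ∀ v → v ∈ A → v ∈ B

  _∩_ _∖_ : ∀ {n} → VSet n → VSet n → VSet n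
  (A ∩ B) v = A v ∧ B v
  (A ∖ B) v = A v ∧ not (B v)

  everything : ∀ {n} → VSet n
  everything _ = true

  ⟦_⟧ : Bool → ℕ
  ⟦ true ⟧  = 1
  ⟦ false ⟧ = 0

  count : ∀ {n} → VSet n → ℕ
  count A = sum (λ v → ⟦ A v ⟧)

  ∧-intro : ∀ {a b} → a ≡ true → b ≡ true → a ∧ b ≡ true
  ∧-intro refl refl = refl

  ∧-elimˡ : ∀ {a b} → a ∧ b ≡ true → a ≡ true
  ∧-elimˡ = proj₁ ∘ ∧-elim

  ∧-elimʳ : ∀ {a b} → a ∧ b ≡ true → b ≡ true
  ∧-elimʳ {a} = proj₂ ∘ ∧-elim {a}

  infixr 4 _⇒_

  _⇒_ : Bool → Bool → Bool
  true  ⇒ b = b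
  false ⇒ b = true

  ⇒-intro : ∀ {a b} → (a ≡ true → b ≡ true) → (a ⇒ b) ≡ true
  ⇒-intro {true}  f = f refl
  ⇒-intro {false} f = refl

  ⇒-elim : ∀ {a b} → (a ⇒ b) ≡ true → a ≡ true → b ≡ true
  ⇒-elim p refl = p

  not-intro : ∀ {a} → (a ≡ true → ⊥) → not a ≡ true
  not-intro {true}  f = ⊥-elim (f refl)
  not-intro {false} f = refl

  not-elim : ∀ {a} → not a ≡ true → a ≡ true → ⊥
  not-elim {true} () refl

  bool-em : ∀ a → a ≡ true ⊎ not a ≡ true
  bool-em true  = inj₁ refl
  bool-em false = inj₂ refl

  dec-true : ∀ {P : Set} (d : Dec P) → does d ≡ true → P
  dec-true (yes p) _ = p

  true-dec : ∀ {P : Set} (d : Dec P) → P → does d ≡ true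
  true-dec (yes _) _ = refl
  true-dec (no ¬p) p = contradiction p ¬p

  opaque
    leq : ℕ → ℕ → Bool
    leq i j = does (i ≤? j)

    leq-sound : ∀ {i j} → leq i j ≡ true → i ≤ j
    leq-sound {i} {j} = dec-true (i ≤? j)

    leq-complete : ∀ {i j} → i ≤ j → leq i j ≡ true
    leq-complete {i} {j} = true-dec (i ≤? j)

  -- Propositional reasoning about k Booleans by exhausting the 2 ^ k cases.

  Op : ℕ → Set
  Op zero    = Bool
  Op (suc k) = Bool → Op k

  apply : ∀ {k} → Op k → Vec Bool k → Bool
  apply f []       = f
  apply f (b ∷ bs) = apply (f b) bs

  everywhere : ∀ k → (Vec Bool k → Bool) → Bool
  everywhere zero    f = f []
  everywhere (suc k) f = everywhere k (f ∘ (true ∷_)) ∧ everywhere k (f ∘ (false ∷_))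

  everywhere-sound : ∀ k f → everywhere k f ≡ true → ∀ b → f b ≡ true
  everywhere-sound zero    f p []          = p
  everywhere-sound (suc k) f p (true ∷ b)  = everywhere-sound k (f ∘ (true ∷_)) (∧-elimˡ p) b
  everywhere-sound (suc k) f p (false ∷ b) =
    everywhere-sound k (f ∘ (false ∷_)) (∧-elimʳ {everywhere k (f ∘ (true ∷_))} p) b

  height : ∀ {k} → List (Op k) → Vec Bool k → ℕ
  height []           b = 0
  height (f ∷ [])     b = ⟦ apply f b ⟧
  height (f ∷ g ∷ fs) b = ⟦ apply f b ⟧ + height (g ∷ fs) b

  at : ∀ {n k} → (Fin n → Vec Bool k) → Op k → VSet n
  at env f v = apply f (env v)

  -- One-element lists form a case of their own so that no summand 0 trails: the sums then agree by
  -- definition with those in the statements proved by `tally`.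
  counts : ∀ {n} → List (VSet n) → ℕ
  counts []           = 0
  counts (A ∷ [])     = count A
  counts (A ∷ B ∷ As) = count A + counts (B ∷ As)

  ∑-mono : ∀ {n} {f g : Fin n → ℕ} → (∀ v → f v ≤ g v) → sum f ≤ sum g
  ∑-mono {zero}  le = z≤n
  ∑-mono {suc n} le = +-mono-≤ (le zero) (∑-mono (le ∘ suc))

  counts-heights : ∀ {n k} (env : Fin n → Vec Bool k) fs →
    counts (List.map (at env) fs) ≡ sum (λ v → height fs (env v))
  counts-heights {n} env []           = sym (sum-replicate-zero n)
  counts-heights env (f ∷ [])     = refl
  counts-heights env (f ∷ g ∷ fs) =
    trans (cong (_+_ (count (at env f))) (counts-heights env (g ∷ fs)))
          (sym (∑-distrib-+ (λ v → ⟦ at env f v ⟧) (λ v → height (g ∷ fs) (env v))))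

  opaque
    -- A linear inequality between cardinalities follows from the same inequality between indicators
    -- at every point. So it is enough to check the truth assignments that satisfy `hyp`; a set
    -- occurring several times in a list is counted with that multiplicity.
    tally : ∀ {n} k (env : Fin n → Vec Bool k) (hyp : Op k) (ls rs : List (Op k)) →
      everywhere k (λ b → apply hyp b ⇒ (height ls b ≤ᵇ height rs b)) ≡ true →
      (∀ v → apply hyp (env v) ≡ true) →
      counts (List.map (at env) ls) ≤ counts (List.map (at env) rs)
    tally k env hyp ls rs valid holds = begin
      counts (List.map (at env) ls)      ≡⟨ counts-heights env ls ⟩
      sum (λ v → height ls (env v))      ≤⟨ ∑-mono (λ v → ≤ᵇ-true _ _ (⇒-elim (everywhere-sound k _ valid (env v)) (holds v))) ⟩
      sum (λ v → height rs (env v))      ≡⟨ counts-heights env rs ⟨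
      counts (List.map (at env) rs)      ∎
      where open ≤-Reasoning

  opaque
    search : ∀ {n} (A : VSet n) → (Σ[ v ∈ Fin n ] v ∈ A) ⊎ (∀ v → ¬ v ∈ A)
    search {zero}  A = inj₂ λ ()
    search {suc n} A with A zero in eq
    ... | true  = inj₁ (zero , eq)
    ... | false with search (A ∘ suc)
    ...   | inj₁ (v , p) = inj₁ (suc v , p)
    ...   | inj₂ none    = inj₂ λ { zero p → case trans (sym eq) p of λ () ; (suc v) p → none v p }

  opaque
    count-mono : ∀ {n} {A B : VSet n} → A ⊆ B → count A ≤ count B
    count-mono {A = A} {B} A⊆B = tally 2 (λ v → A v ∷ B v ∷ []) (λ a b → a ⇒ b)
      ((λ a b → a) ∷ []) ((λ a b → b) ∷ []) refl (λ v → ⇒-intro (A⊆B v))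

  count-empty : ∀ {n} {A : VSet n} → (∀ v → ¬ v ∈ A) → count A ≡ 0
  count-empty {n} {A} none = n≤0⇒n≡0 (tally 1 (λ v → A v ∷ []) not ((λ a → a) ∷ []) [] refl (λ v → not-intro (none v)))

  opaque
    inhabited : ∀ {n} (A : VSet n) → 0 < count A → Σ[ v ∈ Fin n ] v ∈ A
    inhabited A pos with search A
    ... | inj₁ found = found
    ... | inj₂ none  = contradiction (subst (0 <_) (count-empty none) pos) λ ()

  count-∩∖ : ∀ {n} (A B : VSet n) → count A ≡ count (A ∩ B) + count (A ∖ B)
  count-∩∖ A B = ≤-antisym
    (tally 2 env (λ _ _ → true) ls rs refl (λ _ → refl))
    (tally 2 env (λ _ _ → true) rs ls refl (λ _ → refl))
    where
    env = λ v → A v ∷ B v ∷ []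
    ls rs : List (Op 2)
    ls = (λ a b → a) ∷ []
    rs = (λ a b → a ∧ b) ∷ (λ a b → a ∧ not b) ∷ []

  count-everything : ∀ n → count {n} everything ≡ n
  count-everything zero    = refl
  count-everything (suc n) = cong suc (count-everything n)

  count≤n : ∀ {n} (A : VSet n) → count A ≤ n
  count≤n {n} A = subst (count A ≤_) (count-everything n) (count-mono {n} {A} {everything} (λ _ _ → refl))

  impossible : ∀ ρ hs → certifies (κ 1 :≤ κ 0) hs ≡ true → All (Holds ρ ∘ proj₂) hs → ⊥
  impossible ρ hs cert ps with () ← farkas ρ (κ 1 :≤ κ 0) hs cert ps

  -- For conclusions that need a division with rounding, such as a ≤ b from 2a ≤ 2b + 1: the negated
  -- goal joins the hypotheses with multiplier `m`, and the combination yields 1 ≤ 0.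
  farkas-refute : ∀ ρ a b m hs → certifies (κ 1 :≤ κ 0) ((m , κ 1 :+ b :≤ a) ∷ hs) ≡ true → All (Holds ρ ∘ proj₂) hs → Holds ρ (a :≤ b)
  farkas-refute ρ a b m hs cert ps with ⟪ a ⟫ ρ ≤? ⟪ b ⟫ ρ
  ... | yes le = le
  ... | no nle = ⊥-elim (impossible ρ ((m , κ 1 :+ b :≤ a) ∷ hs) cert (≰⇒> nle ∷ ps))

  exists : ∀ {n} → VSet n → Bool
  exists A = case search A of λ { (inj₁ _) → true ; (inj₂ _) → false }

  exists-witness : ∀ {n} (A : VSet n) → exists A ≡ true → Σ[ v ∈ Fin n ] v ∈ A
  exists-witness A p with search A
  ... | inj₁ found = found

  exists-none : ∀ {n} (A : VSet n) → ¬ exists A ≡ true → ∀ v → ¬ v ∈ A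
  exists-none A p with search A
  ... | inj₁ _    = ⊥-elim (p refl)
  ... | inj₂ none = none

  -- Since the goal is `⊥`, a larger `y` met while the maximality of `x` is tested may simply take
  -- its place, without any search for it. The gap between `bound` and the current size limits the
  -- number of replacements.
  maximise : ∀ {X : Set} (P : X → Set) (size : X → ℕ) (bound : ℕ) → (∀ x → P x → size x ≤ bound) →
    ∀ x → P x → (∀ x → P x → (∀ y → P y → size y ≤ size x) → ⊥) → ⊥
  maximise {X} P size bound bounded a pa found = climb bound a pa (m≤n+m bound (size a))
    where
    climb : ∀ fuel x → P x → bound ≤ size x + fuel → ⊥
    larger : ∀ fuel x → bound ≤ size x + fuel → ∀ y → P y → size y ≤ size x
    climb fuel x p enough = found x p (larger fuel x enough)
    larger fuel x enough y q with size y ≤? size x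
    ... | yes le = le
    larger zero       x enough y q | no _   = ≤-trans (bounded y q) (subst (bound ≤_) (+-identityʳ (size x)) enough)
    larger (suc fuel) x enough y q | no nle = ⊥-elim (climb fuel y q (begin
      bound                    ≤⟨ enough ⟩
      size x + suc fuel        ≡⟨ +-suc (size x) fuel ⟩
      suc (size x) + fuel      ≤⟨ +-monoˡ-≤ fuel (≰⇒> nle) ⟩
      size y + fuel            ∎))
      where open ≤-Reasoning

  -- Cliques, independent sets and non-neighbours

  record Graph (n : ℕ) : Set where
    field
      adj : Fin n → Fin n → Bool
      adj-sym : ∀ {x y} → y ∈ adj x → x ∈ adj y
      adj-irrefl : ∀ {x} → ¬ x ∈ adj x

  ==-refl : ∀ i → (i ≡ᵇ i) ≡ true
  ==-refl zero    = refl
  ==-refl (suc i) = ==-refl i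

  <ᵇ-true : ∀ i j → (i <ᵇ j) ≡ true → i < j
  <ᵇ-true i j eq = <ᵇ⇒< i j (subst Bool.T (sym eq) _)

  true-<ᵇ : ∀ {i j} → i < j → (i <ᵇ j) ≡ true
  true-<ᵇ {i} {j} lt with i <ᵇ j | <⇒<ᵇ {i} {j} lt
  ... | true | _ = refl

  module Cliques {n : ℕ} (G : Graph n) where
    open Graph G

    -- An ordered clique: the ambient set shrinks to a neighbourhood at every step, so each vertex
    -- is adjacent to all earlier ones. Greedy choices and size bounds are then inductions on it.
    data Clique : VSet n → ℕ → Set where
      nil  : ∀ {A} → Clique A 0
      cons : ∀ {A k} x → x ∈ A → Clique (A ∩ adj x) k → Clique A (suc k)

    common : ∀ {A k} → Clique A k → VSet n
    common nil         = everything
    common (cons x _ K) = adj x ∩ common K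

    Independent : VSet n → Set
    Independent A = ∀ v w → v ∈ A → w ∈ A → w ∈ adj v → ⊥

    -- A vertex is not adjacent to itself, so it counts among the vertices that it misses.
    MissesAtMost : ℕ → VSet n → Set
    MissesAtMost u W = ∀ x → x ∈ W → count (W ∖ adj x) ≤ u

    ∩-monoˡ : ∀ {A B} (C : VSet n) → A ⊆ B → A ∩ C ⊆ B ∩ C
    ∩-monoˡ {A} C A⊆B v p with a , c ← ∧-elim {A v} p = ∧-intro (A⊆B v a) c

    clique-mono : ∀ {A B k} → A ⊆ B → Clique A k → Clique B k
    clique-mono A⊆B nil          = nil
    clique-mono A⊆B (cons x a K) = cons x (A⊆B x a) (clique-mono (∩-monoˡ (adj x) A⊆B) K)

    common-mono : ∀ {A B k} (A⊆B : A ⊆ B) (K : Clique A k) → common (clique-mono A⊆B K) ≡ common K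
    common-mono A⊆B nil          = refl
    common-mono A⊆B (cons x a K) = cong (adj x ∩_) (common-mono _ K)

    append : ∀ {A W k l} → A ⊆ W → (K : Clique A k) → Clique (W ∩ common K) l → Clique W (k + l)
    append A⊆W nil          L = clique-mono (λ v p → ∧-elimˡ p) L
    append {W = W} A⊆W (cons x a K) L = cons x (A⊆W x a) (append (∩-monoˡ (adj x) A⊆W) K
      (clique-mono (λ v p → let w , c = ∧-elim {W v} p ; xv , r = ∧-elim {adj x v} c in ∧-intro (∧-intro w xv) r) L))

    common-of : ∀ {A k y} (K : Clique A k) → (∀ x → x ∈ A → y ∈ adj x) → y ∈ common K
    common-of nil          all = refl
    common-of {A} (cons x a K) all = ∧-intro (all x a) (common-of K (λ v p → all v (∧-elimˡ {A v} p)))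

    member-common : ∀ {A k y} (K : Clique A k) → A ⊆ adj y → y ∈ common K
    member-common K A⊆ = common-of K (λ x a → adj-sym (A⊆ x a))

    opaque
      -- Each chosen vertex removes at most `u` candidates, so a k-th vertex still exists if (k - 1)
      -- u < |A|; adding `u` on both sides avoids the subtraction.
      greedy : ∀ {u W} → MissesAtMost u W → ∀ k {A} → A ⊆ W → k * u < count A + u → Clique A k
      greedy misses zero    A⊆W lt = nil
      greedy {u} {W} misses (suc k) {A} A⊆W lt with x , a ← inhabited A (≤-trans (s≤s z≤n)
        (+-cancelˡ-< u (k * u) (count A) (subst (u + k * u <_) (+-comm (count A) u) lt))) =
        cons x a (greedy misses k (λ v p → A⊆W v (∧-elimˡ {A v} p))
          (farkas (k * u ∷ u ∷ count A ∷ count (A ∩ adj x) ∷ count (W ∖ adj x) ∷ [])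
            (κ 1 :+ x₀ :≤ x₃ :+ x₁)
            ((κ 1 , κ 1 :+ (x₁ :+ x₀) :≤ x₂ :+ x₁) ∷ (κ 1 , x₂ :≤ x₃ :+ x₄) ∷ (κ 1 , x₄ :≤ x₁) ∷ []) refl
            (lt ∷ split ∷ misses x (A⊆W x a) ∷ [])))
        where
        split : count A ≤ count (A ∩ adj x) + count (W ∖ adj x)
        split = tally 3 (λ v → A v ∷ W v ∷ adj x v ∷ []) (λ a w x → a ⇒ w)
          ((λ a w x → a) ∷ []) ((λ a w x → a ∧ x) ∷ (λ a w x → w ∧ not x) ∷ []) refl (λ v → ⇒-intro (A⊆W v))

    opaque
      common-misses : ∀ (S : VSet n) s {A k} → (∀ x → x ∈ A → count (S ∖ adj x) ≤ s) →
        (K : Clique A k) → count (S ∖ common K) ≤ k * s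
      common-misses S s bound nil = ≤-reflexive (count-empty {A = S ∖ everything} (λ v p → case ∧-elimʳ {S v} p of λ ()))
      common-misses S s {A} bound (cons x a K) = ≤-trans
        (tally 3 (λ v → S v ∷ adj x v ∷ common K v ∷ []) (λ _ _ _ → true)
          ((λ s x k → s ∧ not (x ∧ k)) ∷ []) ((λ s x k → s ∧ not x) ∷ (λ s x k → s ∧ not k) ∷ []) refl (λ _ → refl))
        (+-mono-≤ (bound x a) (common-misses S s (λ y p → bound y (∧-elimˡ {A y} p)) K))

    opaque
      -- All of `I` lies among the vertices missed by any one of its elements.
      independent-size : ∀ {u W I} → MissesAtMost u W → I ⊆ W → Independent I → count I ≤ u
      independent-size {u} {W} {I} misses I⊆W indep with search I
      ... | inj₂ none = subst (_≤ u) (sym (count-empty none)) z≤n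
      ... | inj₁ (x , x∈I) = ≤-trans (count-mono (λ v v∈I → ∧-intro (I⊆W v v∈I) (not-intro (indep x v x∈I v∈I)))) (misses x (I⊆W x x∈I))

    opaque
      misses-mono : ∀ {u W A} → A ⊆ W → MissesAtMost u W → MissesAtMost u A
      misses-mono {A = A} A⊆W misses x a = ≤-trans (count-mono (λ v p → let m , r = ∧-elim {A v} p in ∧-intro (A⊆W v m) r)) (misses x (A⊆W x a))

    -- The colour of the first vertex of the clique is not used again, so the top colour can take its place.
    opaque
      pigeonhole : ∀ k (col : Fin n → ℕ) {A} → (∀ v → v ∈ A → col v < k) →
        (∀ v w → v ∈ A → w ∈ A → w ∈ adj v → col v ≢ col w) → ¬ Clique A (suc k)
      pigeonhole zero    col bound proper (cons x a K) with () ← bound x a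
      pigeonhole (suc k) col {A} bound proper (cons x a K) = pigeonhole k col′ bound′ proper′ K
        where
        col′ : Fin n → ℕ
        col′ v = if col v ≡ᵇ k then col x else col v

        A′⊆A : A ∩ adj x ⊆ A
        A′⊆A v p = ∧-elimˡ {A v} p

        avoids : ∀ v → v ∈ A ∩ adj x → col x ≢ col v
        avoids v p = proper x v a (A′⊆A v p) (∧-elimʳ {A v} p)

        bound′ : ∀ v → v ∈ A ∩ adj x → col′ v < k
        bound′ v p with col v ≡ᵇ k in eq
        ... | true  = ≤∧≢⇒< (s≤s⁻¹ (bound x a)) (λ cx≡k → avoids v p (trans cx≡k (sym (==-sound (col v) k eq))))
        ... | false = ≤∧≢⇒< (s≤s⁻¹ (bound v (A′⊆A v p))) (λ cv≡k → case trans (sym eq) (subst (λ c → (c ≡ᵇ k) ≡ true) (sym cv≡k) (==-refl k)) of λ ())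

        proper′ : ∀ v w → v ∈ A ∩ adj x → w ∈ A ∩ adj x → w ∈ adj v → col′ v ≢ col′ w
        proper′ v w p q vw with col v ≡ᵇ k in eqv | col w ≡ᵇ k in eqw
        ... | true  | true  = λ _ → proper v w (A′⊆A v p) (A′⊆A w q) vw (trans (==-sound (col v) k eqv) (sym (==-sound (col w) k eqw)))
        ... | true  | false = avoids w q
        ... | false | true  = avoids v p ∘ sym
        ... | false | false = proper v w (A′⊆A v p) (A′⊆A w q) vw

    restrict : ∀ {A k y} (K : Clique A k) → y ∈ common K → Clique (A ∩ adj y) k
    restrict nil y∈ = nil
    restrict {A} {y = y} (cons x a K) y∈ = cons x (∧-intro a (adj-sym (∧-elimˡ {adj x y} y∈)))
      (clique-mono (λ v p → let ax , vy = ∧-elim {(A ∩ adj x) v} p ; av , vx = ∧-elim {A v} ax in ∧-intro (∧-intro av vy) vx)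
        (restrict K (∧-elimʳ {adj x y} y∈)))

  <ᵇ-suc : ∀ c k → (c <ᵇ suc k) ≡ (c <ᵇ k) ∨ (c ≡ᵇ k)
  <ᵇ-suc zero    zero    = refl
  <ᵇ-suc zero    (suc k) = refl
  <ᵇ-suc (suc c) zero    = refl
  <ᵇ-suc (suc c) (suc k) = <ᵇ-suc c k

  <ᵇ-≡ᵇ-disjoint : ∀ c k → (c <ᵇ k) ∧ (c ≡ᵇ k) ≡ false
  <ᵇ-≡ᵇ-disjoint zero    zero    = refl
  <ᵇ-≡ᵇ-disjoint zero    (suc k) = refl
  <ᵇ-≡ᵇ-disjoint (suc c) zero    = refl
  <ᵇ-≡ᵇ-disjoint (suc c) (suc k) = <ᵇ-≡ᵇ-disjoint c k

  -- A colouring col and a number k encode the family of the colour classes j < k; vertices with other colours are left out.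

  module Families {n : ℕ} (G : Graph n) (W : VSet n) where
    open Graph G
    open Cliques G

    cls below outside : (Fin n → ℕ) → ℕ → VSet n
    cls col j v     = W v ∧ (col v ≡ᵇ j)
    below col k v   = W v ∧ (col v <ᵇ k)
    outside col k v = W v ∧ not (col v <ᵇ k)

    Proper : (Fin n → ℕ) → ℕ → Set
    Proper col k = ∀ v w → v ∈ W → w ∈ W → w ∈ adj v → col v ≡ col w → col v < k → ⊥

    Proper-pred : ∀ {col k} → Proper col (suc k) → Proper col k
    Proper-pred proper v w v∈ w∈ vw same lt = proper v w v∈ w∈ vw same (m≤n⇒m≤1+n lt)

    cls⊆W : ∀ col j → cls col j ⊆ W
    cls⊆W col j v p = ∧-elimˡ p

    below⊆W : ∀ col k → below col k ⊆ W
    below⊆W col k v p = ∧-elimˡ p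

    outside⊆W : ∀ col k → outside col k ⊆ W
    outside⊆W col k v p = ∧-elimˡ p

    cls-colour : ∀ col j v → v ∈ cls col j → col v ≡ j
    cls-colour col j v p = ==-sound (col v) j (∧-elimʳ {W v} p)

    below-colour : ∀ col k v → v ∈ below col k → col v < k
    below-colour col k v p = <ᵇ-true (col v) k (∧-elimʳ {W v} p)

    outside-colour : ∀ col k v → v ∈ outside col k → ¬ col v < k
    outside-colour col k v p lt = not-elim (∧-elimʳ {W v} p) (true-<ᵇ lt)

    in-cls : ∀ col j v → v ∈ W → col v ≡ j → v ∈ cls col j
    in-cls col j v w eq = ∧-intro w (trans (cong (_≡ᵇ j) eq) (==-refl j))

    in-below : ∀ col k v → v ∈ W → col v < k → v ∈ below col k
    in-below col k v w lt = ∧-intro w (true-<ᵇ lt)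

    in-outside : ∀ col k v → v ∈ W → ¬ col v < k → v ∈ outside col k
    in-outside col k v w nlt = ∧-intro w (not-intro (nlt ∘ <ᵇ-true (col v) k))

    cls-below : ∀ col {j k} → j < k → cls col j ⊆ below col k
    cls-below col {j} {k} j<k v p = in-below col k v (∧-elimˡ p) (subst (_< k) (sym (cls-colour col j v p)) j<k)

    cls-independent : ∀ {col k j} → Proper col k → j < k → Independent (cls col j)
    cls-independent {col} {k} {j} proper j<k v w p q vw = proper v w (∧-elimˡ p) (∧-elimˡ q) vw
      (trans (cls-colour col j v p) (sym (cls-colour col j w q))) (subst (_< k) (sym (cls-colour col j v p)) j<k)

    below+outside : ∀ col k → count W ≡ count (below col k) + count (outside col k)
    below+outside col k = count-∩∖ W (λ v → col v <ᵇ k)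

    below-suc : ∀ col k → count (below col (suc k)) ≡ count (below col k) + count (cls col k)
    below-suc col k = ≤-antisym (tally 4 env hyp ls rs refl holds) (tally 4 env hyp rs ls refl holds)
      where
      env = λ v → W v ∷ (col v <ᵇ suc k) ∷ (col v <ᵇ k) ∷ (col v ≡ᵇ k) ∷ []
      hyp : Op 4
      hyp w b b′ c = (b ⇒ b′ ∨ c) ∧ (b′ ∨ c ⇒ b) ∧ not (b′ ∧ c)
      ls rs : List (Op 4)
      ls = (λ w b b′ c → w ∧ b) ∷ []
      rs = (λ w b b′ c → w ∧ b′) ∷ (λ w b b′ c → w ∧ c) ∷ []
      holds : ∀ v → apply hyp (env v) ≡ true
      holds v = ∧-intro {(col v <ᵇ suc k) ⇒ _} (⇒-intro (trans (sym (<ᵇ-suc (col v) k))))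
        (∧-intro {(col v <ᵇ k) ∨ _ ⇒ _} (⇒-intro (trans (<ᵇ-suc (col v) k))) (cong not (<ᵇ-≡ᵇ-disjoint (col v) k)))

    module _ {u : ℕ} (misses : MissesAtMost u W) where

      opaque
        cls-size : ∀ {col k j} → Proper col k → j < k → count (cls col j) ≤ u
        cls-size {col} {j = j} proper j<k = independent-size misses (cls⊆W col j) (cls-independent proper j<k)

      opaque
        below-size : ∀ {col} k → Proper col k → count (below col k) ≤ k * u
        below-size {col} zero    proper = ≤-reflexive (count-empty (λ v p → case ∧-elimʳ {W v} p of λ ()))
        below-size {col} (suc k) proper = begin
          count (below col (suc k))                ≡⟨ below-suc col k ⟩
          count (below col k) + count (cls col k)  ≤⟨ +-mono-≤ (below-size k (Proper-pred proper)) (cls-size proper ≤-refl) ⟩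
          k * u + u                                ≡⟨ +-comm (k * u) u ⟩
          u + k * u                                ∎
          where open ≤-Reasoning

      opaque
        -- Each of the remaining m - 1 classes has at most `u` vertices; the `u` on the left
        -- replaces the subtraction.
        other-classes : ∀ m {col j} → Proper col m → j < m →
          count (below col m ∖ cls col j) + u ≤ m * u
        other-classes (suc m) {col} {j} proper j<m with m ≟ j
        ... | yes refl = subst (count (below col (suc m) ∖ cls col m) + u ≤_) (+-comm (m * u) u)
          (+-monoˡ-≤ u (≤-trans (count-mono inside) (below-size m (Proper-pred proper))))
          where
          inside : below col (suc m) ∖ cls col m ⊆ below col m
          inside v p with b , c ← ∧-elim {below col (suc m) v} p = in-below col m v (below⊆W col (suc m) v b)
            (≤∧≢⇒< (s≤s⁻¹ (below-colour col (suc m) v b)) (not-elim c ∘ in-cls col m v (below⊆W col (suc m) v b)))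
        ... | no m≢j = farkas (count (below col (suc m) ∖ cls col j) ∷ u ∷ m * u ∷ count (below col m ∖ cls col j) ∷ count (cls col m) ∷ [])
            (x₀ :+ x₁ :≤ x₁ :+ x₂) ((κ 1 , x₀ :≤ x₃ :+ x₄) ∷ (κ 1 , x₃ :+ x₁ :≤ x₂) ∷ (κ 1 , x₄ :≤ x₁) ∷ []) refl
            (split ∷ other-classes m (Proper-pred proper) (≤∧≢⇒< (s≤s⁻¹ j<m) (m≢j ∘ sym)) ∷ cls-size proper ≤-refl ∷ [])
          where
          split : count (below col (suc m) ∖ cls col j) ≤ count (below col m ∖ cls col j) + count (cls col m)
          split = tally 5 (λ v → W v ∷ (col v <ᵇ suc m) ∷ (col v <ᵇ m) ∷ (col v ≡ᵇ m) ∷ (col v ≡ᵇ j) ∷ [])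
            (λ w b b′ c d → b ⇒ b′ ∨ c)
            ((λ w b b′ c d → (w ∧ b) ∧ not (w ∧ d)) ∷ []) ((λ w b b′ c d → (w ∧ b′) ∧ not (w ∧ d)) ∷ (λ w b b′ c d → w ∧ c) ∷ []) refl
            (λ v → ⇒-intro (trans (sym (<ᵇ-suc (col v) m))))

      -- Each vertex of a class misses that whole class, so it is non-adjacent to few vertices of the others.
      opaque
        transversal : ∀ k {col} A → Proper col k →
          (∀ j → j < k → k * u + count (cls col j ∖ A) < count (below col k) + u) → Clique (A ∩ below col k) k
        transversal zero    A proper room = nil
        transversal (suc k) {col} A proper room =
          let x , p = inhabited (cls col k ∩ A) nonempty in
          cons x (∧-intro {A x} (∧-elimʳ {cls col k x} p) (cls-below col ≤-refl x (∧-elimˡ p)))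
            (clique-mono shrink (transversal k (A ∩ adj x) (Proper-pred proper) (room′ x (∧-elimˡ p))))
          where
          nonempty : 0 < count (cls col k ∩ A)
          nonempty = farkas (k * u ∷ u ∷ count (cls col k ∖ A) ∷ count (below col (suc k)) ∷ count (below col k) ∷ count (cls col k) ∷ count (cls col k ∩ A) ∷ [])
            (κ 1 :≤ x₆)
            ((κ 1 , κ 1 :+ (x₁ :+ x₀ :+ x₂) :≤ x₃ :+ x₁) ∷ (κ 1 , x₃ :≤ x₄ :+ x₅) ∷ (κ 1 , x₅ :≤ x₆ :+ x₂) ∷ (κ 1 , x₄ :≤ x₀) ∷ []) refl
            (room k ≤-refl ∷ ≤-reflexive (below-suc col k) ∷ ≤-reflexive (count-∩∖ (cls col k) A) ∷ below-size k (Proper-pred proper) ∷ [])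

          room′ : ∀ x → x ∈ cls col k → ∀ j → j < k → k * u + count (cls col j ∖ (A ∩ adj x)) < count (below col k) + u
          room′ x p j j<k = farkas
            (k * u ∷ u ∷ count (cls col j ∖ A) ∷ count (below col (suc k)) ∷ count (below col k) ∷ count (cls col k) ∷ count (cls col j ∖ (A ∩ adj x)) ∷ count (W ∖ adj x) ∷ [])
            (κ 1 :+ (x₀ :+ x₆) :≤ x₄ :+ x₁)
            ((κ 1 , κ 1 :+ (x₁ :+ x₀ :+ x₂) :≤ x₃ :+ x₁) ∷ (κ 1 , x₃ :≤ x₄ :+ x₅) ∷ (κ 1 , x₅ :+ x₆ :≤ x₂ :+ x₇) ∷ (κ 1 , x₇ :≤ x₁) ∷ []) refl
            (room j (m≤n⇒m≤1+n j<k) ∷ ≤-reflexive (below-suc col k) ∷ missed ∷ misses x (∧-elimˡ p) ∷ [])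
            where
            missed : count (cls col k) + count (cls col j ∖ (A ∩ adj x)) ≤ count (cls col j ∖ A) + count (W ∖ adj x)
            missed = tally 5 (λ v → W v ∷ (col v ≡ᵇ k) ∷ (col v ≡ᵇ j) ∷ A v ∷ adj x v ∷ [])
              (λ w ck cj a x → not (ck ∧ cj) ∧ (w ∧ ck ⇒ not x))
              ((λ w ck cj a x → w ∧ ck) ∷ (λ w ck cj a x → (w ∧ cj) ∧ not (a ∧ x)) ∷ [])
              ((λ w ck cj a x → (w ∧ cj) ∧ not a) ∷ (λ w ck cj a x → w ∧ not x) ∷ []) refl
              (λ v → ∧-intro {not ((col v ≡ᵇ k) ∧ (col v ≡ᵇ j))}
                (not-intro (λ both → <⇒≢ j<k (trans (sym (==-sound (col v) j (∧-elimʳ {col v ≡ᵇ k} both))) (==-sound (col v) k (∧-elimˡ both)))))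
                (⇒-intro (λ q → not-intro (λ adjacent → cls-independent proper ≤-refl x v p q adjacent))))

          shrink : ∀ {x} → (A ∩ adj x) ∩ below col k ⊆ (A ∩ below col (suc k)) ∩ adj x
          shrink {x} v q with ax , b ← ∧-elim {A v ∧ adj x v} q | w , lt ← ∧-elim {W v} (∧-elimʳ {A v ∧ adj x v} q) =
            ∧-intro (∧-intro {A v} (∧-elimˡ ax) (in-below col (suc k) v w (m≤n⇒m≤1+n (<ᵇ-true (col v) k lt)))) (∧-elimʳ {A v} ax)

      opaque
        -- If no class has too many vertices outside `A`, the transversal argument applies.
        -- Otherwise some class `j` has, and a vertex `a` of `A` in this class misses the whole
        -- class. The vertices of class `j` outside `A` are then charged both to `a` and to the
        -- complement of `A`, and this surplus lets a greedy choice succeed in the neighbourhood of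
        -- `a`.
        clique-in-classes : ∀ k {col} A → Proper col k → (∀ j → j < k → Σ[ v ∈ Fin n ] v ∈ A ∩ cls col j) →
          2 * (k * u) + count (below col k ∖ A) < 2 * count (below col k) + 2 * u → Clique (A ∩ below col k) k
        clique-in-classes zero A proper meets room = nil
        clique-in-classes (suc k) {col} A proper meets room
          with anyUpTo? (λ j → count (below col (suc k)) + u ≤? suc k * u + count (cls col j ∖ A)) (suc k)
        ... | no none = transversal (suc k) A proper (λ j j<k → ≰⇒> (λ le → none (j , j<k , le)))
        ... | yes (j , j<k , le) with a , p ← meets j j<k =
          cons a (∧-intro {A a} (∧-elimˡ p) (cls-below col j<k a (∧-elimʳ {A a} p)))
            (greedy misses k (λ v q → ∧-elimˡ (∧-elimʳ {A v} (∧-elimˡ q)))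
              (farkas (k * u ∷ u ∷ count (below col (suc k)) ∷ count (below col (suc k) ∖ A) ∷ count (cls col j ∖ A) ∷ count ((A ∩ below col (suc k)) ∩ adj a) ∷ count (W ∖ adj a) ∷ [])
                (κ 1 :+ x₀ :≤ x₅ :+ x₁)
                ((κ 1 , κ 1 :+ (κ 2 :* (x₁ :+ x₀) :+ x₃) :≤ κ 2 :* x₂ :+ κ 2 :* x₁) ∷ (κ 1 , x₂ :+ x₁ :≤ x₁ :+ x₀ :+ x₄)
                  ∷ (κ 1 , x₂ :+ x₄ :≤ x₅ :+ (x₆ :+ x₃)) ∷ (κ 1 , x₆ :≤ x₁) ∷ []) refl
                (room ∷ le ∷ split ∷ misses a (∧-elimˡ (∧-elimʳ {A a} p)) ∷ [])))
          where
          split : count (below col (suc k)) + count (cls col j ∖ A) ≤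
                  count ((A ∩ below col (suc k)) ∩ adj a) + (count (W ∖ adj a) + count (below col (suc k) ∖ A))
          split = tally 5 (λ v → W v ∷ (col v <ᵇ suc k) ∷ (col v ≡ᵇ j) ∷ A v ∷ adj a v ∷ [])
            (λ w b c a x → (w ∧ c ⇒ w ∧ b) ∧ (w ∧ c ⇒ not x))
            ((λ w b c a x → w ∧ b) ∷ (λ w b c a x → (w ∧ c) ∧ not a) ∷ [])
            ((λ w b c a x → (a ∧ (w ∧ b)) ∧ x) ∷ (λ w b c a x → w ∧ not x) ∷ (λ w b c a x → (w ∧ b) ∧ not a) ∷ []) refl
            (λ v → ∧-intro {cls col j v ⇒ _} (⇒-intro (cls-below col j<k v))
              (⇒-intro (λ q → not-intro (cls-independent proper j<k a v (∧-elimʳ {A a} p) q))))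

    module TransversalCliques {k : ℕ} {col : Fin n → ℕ} (proper : Proper col k) where

      opaque
        -- Otherwise the clique and `y` together would be a clique of k + 1 vertices inside k
        -- independent classes.
        common-outside : ∀ A {y} (K : Clique (A ∩ below col k) k) → y ∈ below col k → y ∈ common K → ⊥
        common-outside A {y} K y∈B y∈K = pigeonhole k col (below-colour col k)
          (λ v w v∈ w∈ vw same → proper v w (below⊆W col k v v∈) (below⊆W col k w w∈) vw same (below-colour col k v v∈))
          (cons y y∈B (clique-mono (λ v p → let ab , vy = ∧-elim {(A ∩ below col k) v} p in ∧-intro (∧-elimʳ {A v} ab) vy) (restrict K y∈K)))

      opaque
        -- The k vertices of `K` miss at most k u vertices in total, and by `common-outside` every
        -- vertex of the family is among those missed. So if the family covers almost k u vertices,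
        -- nearly everything outside it is adjacent to all of `K`.
        kills : ∀ {u} → MissesAtMost u W → ∀ A (K : Clique (A ∩ below col k) k) →
          count (outside col k ∖ common K) + count (below col k) ≤ k * u
        kills {u} misses A K = ≤-trans
          (tally 3 (λ v → W v ∷ (col v <ᵇ k) ∷ common K v ∷ []) (λ w b c → w ∧ b ⇒ not c)
            ((λ w b c → (w ∧ not b) ∧ not c) ∷ (λ w b c → w ∧ b) ∷ []) ((λ w b c → w ∧ not c) ∷ []) refl
            (λ v → ⇒-intro (λ b → not-intro (common-outside A K b))))
          (common-misses W u (λ x p → misses x (below⊆W col k x (∧-elimʳ {A x} p))) K)

  -- A maximal family: a triangle-free remainder or one more class

  module MaximalFamily {n : ℕ} (G : Graph n) (W : VSet n) {u : ℕ} (misses : Cliques.MissesAtMost G u W) (e k : ℕ)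
    (free : ¬ Cliques.Clique G W (3 + k)) (large : (2 * k + 3) * u ≤ 2 * count W + e)
    (col : Fin n → ℕ) (proper : Families.Proper G W col k)
    (dense : 2 * (k * u) + e < 2 * count (Families.below G W col k) + u)
    (hit : ∀ z → z ∈ Families.outside G W col k → ∀ j → j < k → Σ[ v ∈ Fin n ] v ∈ Graph.adj G z ∩ Families.cls G W col j)
    (exchange : ∀ J → J ⊆ Families.outside G W col k → Cliques.Independent G J → ∀ j → j < k → count J ≤ count (Families.cls G W col j))
    where
    open Graph G
    open Cliques G
    open Families G W
    open TransversalCliques proper

    B Z : VSet n
    B = below col k
    Z = outside col k

    Z⊆W : Z ⊆ W
    Z⊆W = outside⊆W col k

    ∩B⊆W : ∀ A → A ∩ B ⊆ W
    ∩B⊆W A v p = below⊆W col k v (∧-elimʳ {A v} p)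

    miss : Fin n → ℕ
    miss z = count (B ∖ adj z)

    miss≤u : ∀ z → z ∈ W → miss z ≤ u
    miss≤u z z∈W = ≤-trans (count-mono (λ v p → let b , r = ∧-elim {B v} p in ∧-intro (below⊆W col k v b) r)) (misses z z∈W)

    -- Vertices missed inside the family use up part of the budget `u` for vertices missed outside.
    outside-degree : ∀ z → z ∈ W → count Z + miss z ≤ count (Z ∩ adj z) + u
    outside-degree z z∈W = ≤-trans
      (tally 3 (λ v → W v ∷ (col v <ᵇ k) ∷ adj z v ∷ []) (λ _ _ _ → true)
        ((λ w b x → w ∧ not b) ∷ (λ w b x → (w ∧ b) ∧ not x) ∷ [])
        ((λ w b x → (w ∧ not b) ∧ x) ∷ (λ w b x → w ∧ not x) ∷ []) refl (λ _ → refl))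
      (+-monoʳ-≤ (count (Z ∩ adj z)) (misses z z∈W))

    opaque
      no-triangle : ∀ A {x y z} (K : Clique (A ∩ B) k) → x ∈ W ∩ common K → y ∈ W ∩ common K → z ∈ W ∩ common K →
        y ∈ adj x → z ∈ adj x → z ∈ adj y → ⊥
      no-triangle A {x} {y} {z} K x∈ y∈ z∈ xy xz yz = free (subst (Clique W) (+-comm k 3)
        (append (∩B⊆W A) K (cons x x∈ (cons y (∧-intro y∈ xy) (cons z (∧-intro (∧-intro z∈ xz) yz) nil)))))

    opaque
      common-neighbour : ∀ A {z} (K : Clique (A ∩ B) k) → A ⊆ adj z → z ∈ W → z ∈ W ∩ common K
      common-neighbour A K A⊆ z∈W = ∧-intro z∈W (member-common K (λ v p → A⊆ v (∧-elimˡ {A v} p)))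

    opaque
      full : ∀ z → z ∈ Z → Clique (adj z ∩ B) k
      full z z∈Z = clique-in-classes misses k (adj z) proper (hit z z∈Z)
        (farkas (k * u ∷ e ∷ count B ∷ u ∷ miss z ∷ []) (κ 1 :+ (κ 2 :* x₀ :+ x₄) :≤ κ 2 :* x₂ :+ κ 2 :* x₃)
          ((κ 1 , κ 1 :+ (κ 2 :* x₀ :+ x₁) :≤ κ 2 :* x₂ :+ x₃) ∷ (κ 1 , x₄ :≤ x₃) ∷ []) refl
          (dense ∷ miss≤u z (Z⊆W z z∈Z) ∷ []))

    -- `J` consists of the common neighbours of `z` and of a k-clique `K` inside its neighbourhood.
    -- An edge in `J` would complete `K` and `z` to a clique of k + 3 vertices. For the size, `K`
    -- misses all of `B`, so the vertices of `B` missed by `z` are counted twice in the total of at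
    -- most (k + 1) u missed vertices.
    neighbourhood : ∀ z → z ∈ Z → Σ[ J ∈ VSet n ] J ⊆ Z × Independent J × count W + miss z ≤ count J + suc k * u
    neighbourhood z z∈Z = J , J⊆Z , J-independent , J-size
      where
      K = full z z∈Z
      J = (W ∩ adj z) ∩ common K

      J⊆Z : J ⊆ Z
      J⊆Z v p = in-outside col k v w∈ (λ lt → common-outside (adj z) K (in-below col k v w∈ lt) (∧-elimʳ {(W ∩ adj z) v} p))
        where w∈ = ∧-elimˡ (∧-elimˡ p)

      J-independent : Independent J
      J-independent v w p q vw = no-triangle (adj z) K (common-neighbour (adj z) K (λ _ → id) (Z⊆W z z∈Z))
        (∧-intro (∧-elimˡ (∧-elimˡ p)) (∧-elimʳ {(W ∩ adj z) v} p)) (∧-intro (∧-elimˡ (∧-elimˡ q)) (∧-elimʳ {(W ∩ adj z) w} q))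
        (∧-elimʳ {W v} (∧-elimˡ p)) (∧-elimʳ {W w} (∧-elimˡ q)) vw

      J-size : count W + miss z ≤ count J + suc k * u
      J-size = ≤-trans
        (tally 4 (λ v → W v ∷ (col v <ᵇ k) ∷ adj z v ∷ common K v ∷ []) (λ w b x c → w ∧ b ⇒ not c)
          ((λ w b x c → w) ∷ (λ w b x c → (w ∧ b) ∧ not x) ∷ [])
          ((λ w b x c → (w ∧ x) ∧ c) ∷ (λ w b x c → w ∧ not x) ∷ (λ w b x c → w ∧ not c) ∷ []) refl
          (λ v → ⇒-intro (λ b → not-intro (common-outside (adj z) K b))))
        (+-monoʳ-≤ (count J) (+-mono-≤ (misses z (Z⊆W z z∈Z)) (common-misses W u (λ x p → misses x (∩B⊆W (adj z) x p)) K)))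

    opaque
      -- The independent set from `neighbourhood` has at most `u` vertices, while 2 |W| is at least
      -- (2k + 3) u - e.
      miss-half : ∀ z → z ∈ Z → 2 * miss z ≤ u + e
      miss-half z z∈Z with J , J⊆Z , indep , size ← neighbourhood z z∈Z = farkas
        (k ∷ u ∷ e ∷ count W ∷ count J ∷ miss z ∷ []) (κ 2 :* x₅ :≤ x₁ :+ x₂)
        ((κ 2 , x₃ :+ x₅ :≤ x₄ :+ (κ 1 :+ x₀) :* x₁) ∷ (κ 2 , x₄ :≤ x₁) ∷ (κ 1 , (κ 2 :* x₀ :+ κ 3) :* x₁ :≤ κ 2 :* x₃ :+ x₂) ∷ []) refl
        (size ∷ independent-size misses (λ v p → Z⊆W v (J⊆Z v p)) indep ∷ large ∷ [])

    NoCommon : Fin n → Fin n → ℕ → Set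
    NoCommon z z′ j = ∀ v → ¬ v ∈ (adj z ∩ adj z′) ∩ cls col j

    opaque
      -- By `miss-half` the two vertices together miss at most u + e vertices of `B`, exactly what
      -- `dense` allows.
      full-pair : ∀ z z′ → z ∈ Z → z′ ∈ Z → (∀ j → j < k → ¬ NoCommon z z′ j) → Clique ((adj z ∩ adj z′) ∩ B) k
      full-pair z z′ z∈Z z′∈Z some = clique-in-classes misses k (adj z ∩ adj z′) proper meets
        (farkas-refute (k * u ∷ e ∷ count B ∷ u ∷ miss z ∷ miss z′ ∷ count (B ∖ (adj z ∩ adj z′)) ∷ [])
          (κ 1 :+ (κ 2 :* x₀ :+ x₆)) (κ 2 :* x₂ :+ κ 2 :* x₃) (κ 2)
          ((κ 2 , κ 1 :+ (κ 2 :* x₀ :+ x₁) :≤ κ 2 :* x₂ :+ x₃) ∷ (κ 1 , κ 2 :* x₄ :≤ x₃ :+ x₁) ∷ (κ 1 , κ 2 :* x₅ :≤ x₃ :+ x₁) ∷ (κ 2 , x₆ :≤ x₄ :+ x₅) ∷ []) refl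
          (dense ∷ miss-half z z∈Z ∷ miss-half z′ z′∈Z ∷ union ∷ []))
        where
        meets : ∀ j → j < k → Σ[ v ∈ Fin n ] v ∈ (adj z ∩ adj z′) ∩ cls col j
        meets j j<k with search ((adj z ∩ adj z′) ∩ cls col j)
        ... | inj₁ found = found
        ... | inj₂ none  = ⊥-elim (some j j<k none)

        union : count (B ∖ (adj z ∩ adj z′)) ≤ miss z + miss z′
        union = tally 3 (λ v → B v ∷ adj z v ∷ adj z′ v ∷ []) (λ _ _ _ → true)
          ((λ b x y → b ∧ not (x ∧ y)) ∷ []) ((λ b x y → b ∧ not x) ∷ (λ b x y → b ∧ not y) ∷ []) refl (λ _ → refl)

    -- Inclusion–exclusion for the three neighbourhoods outside the family, whose pairwise
    -- intersections are killed by the transversal cliques of the pairs.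
    triangle-free : (∀ z z′ j → z ∈ Z → z′ ∈ Z → z′ ∈ adj z → j < k → ¬ NoCommon z z′ j) →
      ∀ x y z → x ∈ Z → y ∈ Z → z ∈ Z → y ∈ adj x → z ∈ adj x → z ∈ adj y → ⊥
    triangle-free some x y z x∈ y∈ z∈ xy xz yz = no-triangle A K
      (common-neighbour A K (λ v p → ∧-elimˡ (∧-elimˡ p)) (Z⊆W x x∈))
      (common-neighbour A K (λ v p → ∧-elimʳ {adj x v} (∧-elimˡ p)) (Z⊆W y y∈))
      (common-neighbour A K (λ v p → ∧-elimʳ {adj x v ∧ adj y v} p) (Z⊆W z z∈)) xy xz yz
      where
      pair : ∀ {p q} → p ∈ Z → q ∈ Z → q ∈ adj p → Clique ((adj p ∩ adj q) ∩ B) k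
      pair {p} {q} p∈ q∈ pq = full-pair p q p∈ q∈ (λ j → some p q j p∈ q∈ pq)

      Kxy = pair x∈ y∈ xy
      Kxz = pair x∈ z∈ xz
      Kyz = pair y∈ z∈ yz

      killed : ∀ {p q} (p∈ : p ∈ Z) (q∈ : q ∈ Z) (pq : q ∈ adj p) v →
        (W v ∧ (adj p v ∧ adj q v) ⇒ not (common (pair p∈ q∈ pq) v)) ≡ true
      killed {p} {q} p∈ q∈ pq v = ⇒-intro (λ r → not-intro (λ c → let w , a = ∧-elim {W v} r ; vp , vq = ∧-elim {adj p v} a in
        no-triangle (adj p ∩ adj q) (pair p∈ q∈ pq) (common-neighbour (adj p ∩ adj q) (pair p∈ q∈ pq) (λ i s → ∧-elimˡ s) (Z⊆W p p∈))
          (common-neighbour (adj p ∩ adj q) (pair p∈ q∈ pq) (λ i s → ∧-elimʳ {adj p i} s) (Z⊆W q q∈)) (∧-intro w c) pq vp vq))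

      inclusion : count (Z ∩ adj x) + (count (Z ∩ adj y) + count (Z ∩ adj z)) ≤
                  count Z + (count (Z ∖ common Kxy) + (count (Z ∖ common Kxz) + count (Z ∖ common Kyz)))
      inclusion = tally 8 (λ v → W v ∷ (col v <ᵇ k) ∷ adj x v ∷ adj y v ∷ adj z v ∷ common Kxy v ∷ common Kxz v ∷ common Kyz v ∷ [])
        (λ w b p q r pq pr qr → (w ∧ (p ∧ q) ⇒ not pq) ∧ (w ∧ (p ∧ r) ⇒ not pr) ∧ (w ∧ (q ∧ r) ⇒ not qr))
        ((λ w b p q r pq pr qr → (w ∧ not b) ∧ p) ∷ (λ w b p q r pq pr qr → (w ∧ not b) ∧ q) ∷ (λ w b p q r pq pr qr → (w ∧ not b) ∧ r) ∷ [])
        ((λ w b p q r pq pr qr → w ∧ not b) ∷ (λ w b p q r pq pr qr → (w ∧ not b) ∧ not pq)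
          ∷ (λ w b p q r pq pr qr → (w ∧ not b) ∧ not pr) ∷ (λ w b p q r pq pr qr → (w ∧ not b) ∧ not qr) ∷ []) refl
        (λ v → ∧-intro (killed x∈ y∈ xy v) (∧-intro (killed x∈ z∈ xz v) (killed y∈ z∈ yz v)))

      A = (adj x ∩ adj y) ∩ adj z

      split : count B ≤ count (A ∩ B) + (miss x + (miss y + miss z))
      split = tally 4 (λ v → B v ∷ adj x v ∷ adj y v ∷ adj z v ∷ []) (λ _ _ _ _ → true)
        ((λ b p q r → b) ∷ []) ((λ b p q r → ((p ∧ q) ∧ r) ∧ b) ∷ (λ b p q r → b ∧ not p) ∷ (λ b p q r → b ∧ not q) ∷ (λ b p q r → b ∧ not r) ∷ [])
        refl (λ _ → refl)

      K : Clique (A ∩ B) k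
      K = greedy misses k (∩B⊆W A) (farkas
        (k ∷ u ∷ e ∷ count W ∷ count B ∷ count Z ∷ miss x + (miss y + miss z) ∷ count (A ∩ B) ∷
          count (Z ∩ adj x) + (count (Z ∩ adj y) + count (Z ∩ adj z)) ∷
          count (Z ∖ common Kxy) + (count (Z ∖ common Kxz) + count (Z ∖ common Kyz)) ∷ [])
        (κ 1 :+ x₀ :* x₁ :≤ x₇ :+ x₁)
        ((κ 1 , κ 1 :+ (κ 2 :* (x₀ :* x₁) :+ x₂) :≤ κ 2 :* x₄ :+ x₁) ∷ (κ 1 , (κ 2 :* x₀ :+ κ 3) :* x₁ :≤ κ 2 :* x₃ :+ x₂)
          ∷ (κ 2 , x₃ :≤ x₄ :+ x₅) ∷ (κ 1 , x₈ :≤ x₅ :+ x₉) ∷ (κ 1 , x₄ :≤ x₇ :+ x₆)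
          ∷ (κ 1 , κ 3 :* x₅ :+ x₆ :≤ x₈ :+ κ 3 :* x₁) ∷ (κ 1 , x₉ :+ κ 3 :* x₄ :≤ κ 3 :* (x₀ :* x₁)) ∷ []) refl
        (dense ∷ large ∷ ≤-reflexive (below+outside col k) ∷ inclusion ∷ split ∷ degrees ∷ kill ∷ []))
        where
        degrees : 3 * count Z + (miss x + (miss y + miss z)) ≤ count (Z ∩ adj x) + (count (Z ∩ adj y) + count (Z ∩ adj z)) + 3 * u
        degrees = farkas (count Z ∷ miss x ∷ miss y ∷ miss z ∷ count (Z ∩ adj x) ∷ count (Z ∩ adj y) ∷ count (Z ∩ adj z) ∷ u ∷ [])
          (κ 3 :* x₀ :+ (x₁ :+ (x₂ :+ x₃)) :≤ x₄ :+ (x₅ :+ x₆) :+ κ 3 :* x₇)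
          ((κ 1 , x₀ :+ x₁ :≤ x₄ :+ x₇) ∷ (κ 1 , x₀ :+ x₂ :≤ x₅ :+ x₇) ∷ (κ 1 , x₀ :+ x₃ :≤ x₆ :+ x₇) ∷ []) refl
          (outside-degree x (Z⊆W x x∈) ∷ outside-degree y (Z⊆W y y∈) ∷ outside-degree z (Z⊆W z z∈) ∷ [])

        kill : count (Z ∖ common Kxy) + (count (Z ∖ common Kxz) + count (Z ∖ common Kyz)) + 3 * count B ≤ 3 * (k * u)
        kill = farkas (count (Z ∖ common Kxy) ∷ count (Z ∖ common Kxz) ∷ count (Z ∖ common Kyz) ∷ count B ∷ k * u ∷ [])
          (x₀ :+ (x₁ :+ x₂) :+ κ 3 :* x₃ :≤ κ 3 :* x₄)
          ((κ 1 , x₀ :+ x₃ :≤ x₄) ∷ (κ 1 , x₁ :+ x₃ :≤ x₄) ∷ (κ 1 , x₂ :+ x₃ :≤ x₄) ∷ []) refl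
          (kills misses (adj x ∩ adj y) Kxy ∷ kills misses (adj x ∩ adj z) Kxz ∷ kills misses (adj y ∩ adj z) Kyz ∷ [])

    cover : ∀ z z′ {j} → j < k → NoCommon z z′ j → count (cls col j) ≤ miss z + miss z′
    cover z z′ {j} j<k none = tally 4 (λ v → cls col j v ∷ B v ∷ adj z v ∷ adj z′ v ∷ []) (λ c b x y → (c ⇒ b) ∧ not ((x ∧ y) ∧ c))
      ((λ c b x y → c) ∷ []) ((λ c b x y → b ∧ not x) ∷ (λ c b x y → b ∧ not y) ∷ []) refl
      (λ v → ∧-intro (⇒-intro (cls-below col j<k v)) (not-intro (none v)))

    private
      -- Bootstrapping: `neighbourhood` gives 2 |J| ≥ u - e + 2 `miss z`, and `exchange` gives |J| ≤
      -- |cls col j| ≤ 2 `miss z`. Hence |J| ≥ u - e, and by `exchange` again every class is at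
      -- least as large.
      larger-miss : ∀ z j → z ∈ Z → j < k → count (cls col j) ≤ 2 * miss z →
        (∀ q → q < k → u ≤ count (cls col q) + e) × (Σ[ J ∈ VSet n ] J ⊆ Z × Independent J × u ≤ count J + e)
      larger-miss z j z∈Z j<k half with J , J⊆Z , indep , size ← neighbourhood z z∈Z =
        (λ q q<k → ≤-trans bound (+-monoˡ-≤ e (exchange J J⊆Z indep q q<k))) , J , J⊆Z , indep , bound
        where
        bound : u ≤ count J + e
        bound = farkas (k ∷ u ∷ e ∷ count W ∷ count J ∷ miss z ∷ count (cls col j) ∷ []) (x₁ :≤ x₄ :+ x₂)
          ((κ 2 , x₃ :+ x₅ :≤ x₄ :+ (κ 1 :+ x₀) :* x₁) ∷ (κ 1 , x₆ :≤ κ 2 :* x₅) ∷ (κ 1 , x₄ :≤ x₆)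
            ∷ (κ 1 , (κ 2 :* x₀ :+ κ 3) :* x₁ :≤ κ 2 :* x₃ :+ x₂) ∷ []) refl
          (size ∷ half ∷ exchange J J⊆Z indep j j<k ∷ large ∷ [])

    -- Every vertex of class `j` is missed by `z` or `z′`, so one of them misses at least half of
    -- the class.
    pair-structure : ∀ z z′ j → z ∈ Z → z′ ∈ Z → j < k → NoCommon z z′ j →
      (∀ q → q < k → u ≤ count (cls col q) + e) × (Σ[ J ∈ VSet n ] J ⊆ Z × Independent J × u ≤ count J + e)
    pair-structure z z′ j z∈ z′∈ j<k none with ≤-total (miss z) (miss z′)
    ... | inj₁ le = larger-miss z′ j z′∈ j<k (farkas (miss z ∷ miss z′ ∷ count (cls col j) ∷ []) (x₂ :≤ κ 2 :* x₁)
            ((κ 1 , x₂ :≤ x₀ :+ x₁) ∷ (κ 1 , x₀ :≤ x₁) ∷ []) refl (cover z z′ j<k none ∷ le ∷ []))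
    ... | inj₂ le = larger-miss z j z∈ j<k (farkas (miss z ∷ miss z′ ∷ count (cls col j) ∷ []) (x₂ :≤ κ 2 :* x₀)
            ((κ 1 , x₂ :≤ x₀ :+ x₁) ∷ (κ 1 , x₁ :≤ x₀) ∷ []) refl (cover z z′ j<k none ∷ le ∷ []))

  -- Closed walks of length five in dense triangle-free graphs

  module FiveWalks {n : ℕ} (G : Graph n) where
    open Graph G
    open Cliques G

    -- In a triangle-free graph a closed walk of length five is a five-cycle.
    record FiveWalk (S : VSet n) : Set where
      field
        c₁ c₂ c₃ c₄ c₅ : Fin n
        in₁ : c₁ ∈ S
        in₂ : c₂ ∈ S
        in₃ : c₃ ∈ S
        in₄ : c₄ ∈ S
        in₅ : c₅ ∈ S
        e₁₂ : c₂ ∈ adj c₁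
        e₂₃ : c₃ ∈ adj c₂
        e₃₄ : c₄ ∈ adj c₃
        e₄₅ : c₅ ∈ adj c₄
        e₅₁ : c₁ ∈ adj c₅

    TriangleFree : VSet n → Set
    TriangleFree W = ∀ x y z → x ∈ W → y ∈ W → z ∈ W → y ∈ adj x → z ∈ adj x → z ∈ adj y → ⊥

    Colouring : VSet n → ℕ → Set
    Colouring W c = Σ[ col ∈ (Fin n → ℕ) ] (∀ v → v ∈ W → col v < c) × (∀ v w → v ∈ W → w ∈ W → w ∈ adj v → col v ≢ col w)

    -- Consecutive vertices of the walk have no common neighbour, and among five cyclic positions at
    -- most two are pairwise non-consecutive. So a vertex is counted at most twice on the left.
    walk-neighbours : ∀ {W S} → TriangleFree W → S ⊆ W → (c : FiveWalk W) → let open FiveWalk c in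
      count (S ∩ adj c₁) + (count (S ∩ adj c₂) + (count (S ∩ adj c₃) + (count (S ∩ adj c₄) + count (S ∩ adj c₅)))) ≤ count S + count S
    walk-neighbours {W} {S} free S⊆W c = tally 6
      (λ v → S v ∷ adj c₁ v ∷ adj c₂ v ∷ adj c₃ v ∷ adj c₄ v ∷ adj c₅ v ∷ [])
      (λ s a b c d e → not (s ∧ (a ∧ b)) ∧ not (s ∧ (b ∧ c)) ∧ not (s ∧ (c ∧ d)) ∧ not (s ∧ (d ∧ e)) ∧ not (s ∧ (e ∧ a)))
      ((λ s a b c d e → s ∧ a) ∷ (λ s a b c d e → s ∧ b) ∷ (λ s a b c d e → s ∧ c) ∷ (λ s a b c d e → s ∧ d) ∷ (λ s a b c d e → s ∧ e) ∷ [])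
      ((λ s a b c d e → s) ∷ (λ s a b c d e → s) ∷ []) refl
      (λ v → ∧-intro (apart in₁ in₂ e₁₂ v) (∧-intro (apart in₂ in₃ e₂₃ v) (∧-intro (apart in₃ in₄ e₃₄ v) (∧-intro (apart in₄ in₅ e₄₅ v) (apart in₅ in₁ e₅₁ v)))))
      where
      open FiveWalk c
      apart : ∀ {x y} → x ∈ W → y ∈ W → y ∈ adj x → ∀ v → not (S v ∧ (adj x v ∧ adj y v)) ≡ true
      apart {x} {y} x∈ y∈ xy v = not-intro (λ p → let s , a = ∧-elim {S v} p ; xv , yv = ∧-elim {adj x v} a in
        free x y v x∈ y∈ (S⊆W v s) xy xv yv)

    module _ {W : VSet n} {u e : ℕ} (free : TriangleFree W) (misses : MissesAtMost u W)
      (large : 3 * u ≤ 2 * count W + e) (small : 6 * e < u) (no-walk : ¬ FiveWalk W) where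

      private
        degree : ∀ x → x ∈ W → count W ≤ count (W ∩ adj x) + u
        degree x x∈ = ≤-trans (≤-reflexive (count-∩∖ W (adj x))) (+-monoʳ-≤ (count (W ∩ adj x)) (misses x x∈))

        linked : Fin n → VSet n
        linked x y = exists (W ∩ (adj x ∩ adj y))

        link : ∀ {x y} → y ∈ linked x → Σ[ g ∈ Fin n ] (g ∈ W × g ∈ adj x × g ∈ adj y)
        link {x} {y} p with g , q ← exists-witness (W ∩ (adj x ∩ adj y)) p =
          g , ∧-elimˡ {W g} q , ∧-elimˡ (∧-elimʳ {W g} q) , ∧-elimʳ {adj x g} (∧-elimʳ {W g} q)

        Apart : Fin n → Fin n → Set
        Apart x y = ∀ v → not (W v ∧ (adj x v ∧ adj y v)) ≡ true

        not-linked : ∀ {x y} → ¬ y ∈ linked x → Apart x y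
        not-linked {x} {y} p v = not-intro (exists-none (W ∩ (adj x ∩ adj y)) p v)

        adjacent-apart : ∀ {x y} → x ∈ W → y ∈ W → y ∈ adj x → Apart x y
        adjacent-apart {x} {y} x∈ y∈ xy v = not-intro (λ p → let w , a = ∧-elim {W v} p ; xv , yv = ∧-elim {adj x v} a in
          free x y v x∈ y∈ w xy xv yv)

        walk : ∀ {a b c d f} → a ∈ W → b ∈ W → c ∈ W → d ∈ W → f ∈ W → b ∈ adj a → c ∈ adj b → d ∈ adj c → f ∈ adj d → a ∈ adj f → ⊥
        walk a b c d f ab bc cd df fa = no-walk (record
          { in₁ = a ; in₂ = b ; in₃ = c ; in₄ = d ; in₅ = f ; e₁₂ = ab ; e₂₃ = bc ; e₃₄ = cd ; e₄₅ = df ; e₅₁ = fa })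

        three-walk-apart : ∀ {a b c d} → a ∈ W → b ∈ W → c ∈ W → d ∈ W → b ∈ adj a → c ∈ adj b → d ∈ adj c → Apart a d
        three-walk-apart {a} {b} {c} {d} a∈ b∈ c∈ d∈ ab bc cd v = not-intro (λ p → let w , r = ∧-elim {W v} p ; av , dv = ∧-elim {adj a v} r in
          walk a∈ b∈ c∈ d∈ w ab bc cd dv (adj-sym av))

      module _ {a b : Fin n} (a∈ : a ∈ W) (b∈ : b ∈ W) (ab : b ∈ adj a) where
        private
          linked-independent : ∀ {x} → x ∈ W → ∀ v w → v ∈ W → w ∈ W → v ∈ linked x → w ∈ linked x → w ∈ adj v → ⊥
          linked-independent x∈ v w v∈ w∈ p q vw with g , g∈ , xg , vg ← link p | h , h∈ , xh , wh ← link q =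
            walk x∈ g∈ v∈ w∈ h∈ xg (adj-sym vg) vw wh (adj-sym xh)

          linked-disjoint : ∀ v → v ∈ W → v ∈ linked a → v ∈ linked b → ⊥
          linked-disjoint v v∈ p q with g , g∈ , ag , vg ← link p | h , h∈ , bh , vh ← link q =
            walk a∈ g∈ v∈ h∈ b∈ ag (adj-sym vg) vh (adj-sym bh) (adj-sym ab)

          -- Otherwise `a`, `b`, `w`, `y` would have pairwise disjoint neighbourhoods, four sets of
          -- about a third of `W` or more.
          neighbour-linked : ∀ w y → w ∈ W → y ∈ W → y ∈ adj w → ¬ w ∈ linked a → ¬ w ∈ linked b → ¬ y ∈ linked a → ¬ y ∈ linked b → ⊥
          neighbour-linked w y w∈ y∈ wy wa wb ya yb = impossible
            (count W ∷ u ∷ e ∷ count (W ∩ adj a) ∷ count (W ∩ adj b) ∷ count (W ∩ adj w) ∷ count (W ∩ adj y) ∷ [])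
            ((κ 2 , x₃ :+ (x₄ :+ (x₅ :+ x₆)) :≤ x₀) ∷ (κ 2 , x₀ :≤ x₃ :+ x₁) ∷ (κ 2 , x₀ :≤ x₄ :+ x₁) ∷ (κ 2 , x₀ :≤ x₅ :+ x₁) ∷ (κ 2 , x₀ :≤ x₆ :+ x₁)
              ∷ (κ 3 , κ 3 :* x₁ :≤ κ 2 :* x₀ :+ x₂) ∷ (κ 1 , κ 1 :+ κ 6 :* x₂ :≤ x₁) ∷ []) refl
            (disjoint ∷ degree a a∈ ∷ degree b b∈ ∷ degree w w∈ ∷ degree y y∈ ∷ large ∷ small ∷ [])
            where
            disjoint : count (W ∩ adj a) + (count (W ∩ adj b) + (count (W ∩ adj w) + count (W ∩ adj y))) ≤ count W
            disjoint = tally 5 (λ v → W v ∷ adj a v ∷ adj b v ∷ adj w v ∷ adj y v ∷ [])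
              (λ m a b w y → not (m ∧ (a ∧ b)) ∧ not (m ∧ (a ∧ w)) ∧ not (m ∧ (a ∧ y)) ∧ not (m ∧ (b ∧ w)) ∧ not (m ∧ (b ∧ y)) ∧ not (m ∧ (w ∧ y)))
              ((λ m a b w y → m ∧ a) ∷ (λ m a b w y → m ∧ b) ∷ (λ m a b w y → m ∧ w) ∷ (λ m a b w y → m ∧ y) ∷ [])
              ((λ m a b w y → m) ∷ []) refl
              (λ v → ∧-intro (adjacent-apart a∈ b∈ ab v) (∧-intro (not-linked wa v) (∧-intro (not-linked ya v)
                (∧-intro (not-linked wb v) (∧-intro (not-linked yb v) (adjacent-apart w∈ y∈ wy v))))))

          -- No vertex lies in three of the seven neighbourhoods of a, b, w, y, y′ and of the midpoints p of a y and q of b y′.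
          one-side : ∀ w y y′ → w ∈ W → y ∈ W → y′ ∈ W → y ∈ adj w → y′ ∈ adj w → ¬ w ∈ linked a → ¬ w ∈ linked b →
            y ∈ linked a → y′ ∈ linked b → ⊥
          one-side w y y′ w∈ y∈ y′∈ wy wy′ wa wb ya yb with p , p∈ , ap , yp ← link ya | q , q∈ , bq , y′q ← link yb = impossible
            (count W ∷ u ∷ e ∷ count (W ∩ adj a) ∷ count (W ∩ adj b) ∷ count (W ∩ adj w) ∷ count (W ∩ adj y) ∷ count (W ∩ adj y′) ∷ count (W ∩ adj p) ∷ count (W ∩ adj q) ∷ [])
            ((κ 2 , x₃ :+ (x₄ :+ (x₅ :+ (x₆ :+ (x₇ :+ (x₈ :+ x₉))))) :≤ x₀ :+ x₀) ∷ (κ 2 , x₀ :≤ x₃ :+ x₁) ∷ (κ 2 , x₀ :≤ x₄ :+ x₁) ∷ (κ 2 , x₀ :≤ x₅ :+ x₁)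
              ∷ (κ 2 , x₀ :≤ x₆ :+ x₁) ∷ (κ 2 , x₀ :≤ x₇ :+ x₁) ∷ (κ 2 , x₀ :≤ x₈ :+ x₁) ∷ (κ 2 , x₀ :≤ x₉ :+ x₁)
              ∷ (κ 5 , κ 3 :* x₁ :≤ κ 2 :* x₀ :+ x₂) ∷ (κ 1 , κ 1 :+ κ 6 :* x₂ :≤ x₁) ∷ []) refl
            (at-most-two ∷ degree a a∈ ∷ degree b b∈ ∷ degree w w∈ ∷ degree y y∈ ∷ degree y′ y′∈ ∷ degree p p∈ ∷ degree q q∈ ∷ large ∷ small ∷ [])
            where
            at-most-two : count (W ∩ adj a) + (count (W ∩ adj b) + (count (W ∩ adj w) + (count (W ∩ adj y) + (count (W ∩ adj y′) + (count (W ∩ adj p) + count (W ∩ adj q))))))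
              ≤ count W + count W
            at-most-two = tally 8 (λ v → W v ∷ adj a v ∷ adj b v ∷ adj w v ∷ adj y v ∷ adj y′ v ∷ adj p v ∷ adj q v ∷ [])
              (λ m a b w y y′ p q → not (m ∧ (a ∧ b)) ∧ not (m ∧ (a ∧ w)) ∧ not (m ∧ (b ∧ w)) ∧ not (m ∧ (w ∧ y)) ∧ not (m ∧ (w ∧ y′))
                ∧ not (m ∧ (b ∧ y)) ∧ not (m ∧ (a ∧ y′)) ∧ not (m ∧ (a ∧ p)) ∧ not (m ∧ (b ∧ q)) ∧ not (m ∧ (y ∧ p)) ∧ not (m ∧ (y′ ∧ q))
                ∧ not (m ∧ (p ∧ q)) ∧ not (m ∧ (p ∧ y′)) ∧ not (m ∧ (q ∧ y)))
              ((λ m a b w y y′ p q → m ∧ a) ∷ (λ m a b w y y′ p q → m ∧ b) ∷ (λ m a b w y y′ p q → m ∧ w) ∷ (λ m a b w y y′ p q → m ∧ y)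
                ∷ (λ m a b w y y′ p q → m ∧ y′) ∷ (λ m a b w y y′ p q → m ∧ p) ∷ (λ m a b w y y′ p q → m ∧ q) ∷ [])
              ((λ m a b w y y′ p q → m) ∷ (λ m a b w y y′ p q → m) ∷ []) refl
              (λ v → ∧-intro (adjacent-apart a∈ b∈ ab v) (∧-intro (not-linked wa v) (∧-intro (not-linked wb v)
                (∧-intro (adjacent-apart w∈ y∈ wy v) (∧-intro (adjacent-apart w∈ y′∈ wy′ v)
                (∧-intro (not-linked (linked-disjoint y y∈ ya) v) (∧-intro (not-linked (λ r → linked-disjoint y′ y′∈ r yb) v)
                (∧-intro (adjacent-apart a∈ p∈ ap v) (∧-intro (adjacent-apart b∈ q∈ bq v) (∧-intro (adjacent-apart y∈ p∈ yp v)
                (∧-intro (adjacent-apart y′∈ q∈ y′q v) (∧-intro (three-walk-apart p∈ a∈ b∈ q∈ (adj-sym ap) ab bq v)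
                (∧-intro (three-walk-apart p∈ y∈ w∈ y′∈ (adj-sym yp) (adj-sym wy) wy′ v)
                  (three-walk-apart q∈ y′∈ w∈ y∈ (adj-sym y′q) (adj-sym wy′) wy v))))))))))))))

          meets-a : Fin n → Bool
          meets-a v = exists (W ∩ (adj v ∩ linked a))

          -- Vertices linked to `a` and vertices linked to `b` go to opposite sides. For a vertex
          -- linked to neither, `one-side` and `neighbour-linked` show that its neighbours are all
          -- linked to `a` or all linked to `b`, and it is placed opposite to them.
          side : Fin n → ℕ
          side v = if linked a v then 0 else if linked b v then 1 else if meets-a v then 1 else 0

          data Side (v : Fin n) : Set where
            left  : v ∈ linked a → side v ≡ 0 → Side v
            right : v ∈ linked b → side v ≡ 1 → Side v
            far   : ∀ y → ¬ v ∈ linked a → ¬ v ∈ linked b → y ∈ W → y ∈ adj v → y ∈ linked a → side v ≡ 1 → Side v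
            near  : ¬ v ∈ linked a → ¬ v ∈ linked b → (∀ y → y ∈ W → y ∈ adj v → ¬ y ∈ linked a) → side v ≡ 0 → Side v

          classify : ∀ v → Side v
          classify v with linked a v in la | linked b v in lb | meets-a v in m
          ... | true  | _     | _ = left la (side-left la)
            where
            side-left : linked a v ≡ true → side v ≡ 0
            side-left p rewrite p = refl
          ... | false | true  | _ = right lb (side-right la lb)
            where
            side-right : linked a v ≡ false → linked b v ≡ true → side v ≡ 1
            side-right p q rewrite p | q = refl
          ... | false | false | true with y , r ← exists-witness (W ∩ (adj v ∩ linked a)) m =
            far y (λ p → case trans (sym la) p of λ ()) (λ p → case trans (sym lb) p of λ ())
              (∧-elimˡ r) (∧-elimˡ (∧-elimʳ {W y} r)) (∧-elimʳ {adj v y} (∧-elimʳ {W y} r)) (side-far la lb m)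
            where
            side-far : linked a v ≡ false → linked b v ≡ false → meets-a v ≡ true → side v ≡ 1
            side-far p q r rewrite p | q | r = refl
          ... | false | false | false =
            near (λ p → case trans (sym la) p of λ ()) (λ p → case trans (sym lb) p of λ ())
              (λ y y∈ vy ya → exists-none (W ∩ (adj v ∩ linked a)) (λ p → case trans (sym m) p of λ ()) y (∧-intro y∈ (∧-intro vy ya)))
              (side-near la lb m)
            where
            side-near : linked a v ≡ false → linked b v ≡ false → meets-a v ≡ false → side v ≡ 0
            side-near p q r rewrite p | q | r = refl

          side<2 : ∀ v → side v < 2
          side<2 v with classify v
          ... | left _ eq            = subst (_< 2) (sym eq) (s≤s z≤n)
          ... | right _ eq           = subst (_< 2) (sym eq) (s≤s (s≤s z≤n))
          ... | far _ _ _ _ _ _ eq   = subst (_< 2) (sym eq) (s≤s (s≤s z≤n))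
          ... | near _ _ _ eq        = subst (_< 2) (sym eq) (s≤s z≤n)

          0≢1 : ∀ {s t : ℕ} → s ≡ 0 → t ≡ 1 → s ≢ t
          0≢1 refl refl ()

          proper : ∀ v w → v ∈ W → w ∈ W → w ∈ adj v → side v ≢ side w
          proper v w v∈ w∈ vw with classify v | classify w
          ... | left p _             | left q _             = λ _ → linked-independent a∈ v w v∈ w∈ p q vw
          ... | right p _            | right q _            = λ _ → linked-independent b∈ v w v∈ w∈ p q vw
          ... | left p _             | near _ _ none _      = λ _ → none v v∈ (adj-sym vw) p
          ... | near _ _ none _      | left q _             = λ _ → none w w∈ vw q
          ... | right p _            | far y wa wb y∈ wy ya _ = λ _ → one-side w y v w∈ y∈ v∈ wy (adj-sym vw) wa wb ya p
          ... | far y va vb y∈ vy ya _ | right q _          = λ _ → one-side v y w v∈ y∈ w∈ vy vw va vb ya q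
          ... | far _ va vb _ _ _ _  | far _ wa wb _ _ _ _  = λ _ → neighbour-linked v w v∈ w∈ vw va vb wa wb
          ... | near va vb _ _       | near wa wb _ _       = λ _ → neighbour-linked v w v∈ w∈ vw va vb wa wb
          ... | left _ p             | right _ q            = 0≢1 p q
          ... | right _ p            | left _ q             = 0≢1 q p ∘ sym
          ... | left _ p             | far _ _ _ _ _ _ q    = 0≢1 p q
          ... | far _ _ _ _ _ _ p    | left _ q             = 0≢1 q p ∘ sym
          ... | right _ p            | near _ _ _ q         = 0≢1 q p ∘ sym
          ... | near _ _ _ p         | right _ q            = 0≢1 p q
          ... | far _ _ _ _ _ _ p    | near _ _ _ q         = 0≢1 q p ∘ sym
          ... | near _ _ _ p         | far _ _ _ _ _ _ q    = 0≢1 p q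

        edge-bipartite : Colouring W 2
        edge-bipartite = side , (λ v _ → side<2 v) , proper

      -- An instance of the Andrásfai-Erdős-Sós theorem: in a graph without triangles and
      -- five-cycles, degrees above 2/7 of the number of vertices force two colours, and here they
      -- are at least about 1/3 of it.
      bipartite : Colouring W 2
      bipartite with search W
      ... | inj₂ none = (λ _ → 0) , (λ v p → ⊥-elim (none v p)) , λ v w p → ⊥-elim (none v p)
      ... | inj₁ (a , a∈) = let b , p = inhabited (W ∩ adj a) positive in edge-bipartite a∈ (∧-elimˡ p) (∧-elimʳ {W b} p)
        where
        positive : 0 < count (W ∩ adj a)
        positive = farkas-refute (count W ∷ u ∷ e ∷ count (W ∩ adj a) ∷ []) (κ 1) x₃ (κ 2)
          ((κ 2 , x₀ :≤ x₃ :+ x₁) ∷ (κ 1 , κ 3 :* x₁ :≤ κ 2 :* x₀ :+ x₂) ∷ (κ 1 , κ 1 :+ κ 6 :* x₂ :≤ x₁) ∷ []) refl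
          (degree a a∈ ∷ large ∷ small ∷ [])

  -- Exchange properties of a family of maximum size

  module OptimalFamily {n : ℕ} (G : Graph n) (W : VSet n) (k : ℕ) (col : Fin n → ℕ)
    (proper : Families.Proper G W col k)
    (best : ∀ col′ → Families.Proper G W col′ k → count (Families.below G W col′ k) ≤ count (Families.below G W col k))
    where
    open Graph G
    open Cliques G
    open Families G W

    -- `J` meets no class other than `j`, so it can take the place of class `j` while the others
    -- stay intact, and the total size of the family cannot grow.
    replace-class : ∀ j → j < k → ∀ J → (∀ v → v ∈ J → v ∈ W × (col v < k → col v ≡ j)) → Independent J → count J ≤ count (cls col j)
    replace-class j j<k J fits indep = farkas (count J ∷ count (cls col j) ∷ count (below col k) ∷ count (below col′ k) ∷ []) (x₀ :≤ x₁)
      ((κ 1 , x₂ :+ x₀ :≤ x₃ :+ x₁) ∷ (κ 1 , x₃ :≤ x₂) ∷ []) refl (gain ∷ best col′ proper′ ∷ [])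
      where
      col′ : Fin n → ℕ
      -- Colour `k` removes the rest of the old class `j` from the family.
      col′ v = if J v then j else if col v ≡ᵇ j then k else col v

      proper′ : Proper col′ k
      proper′ v w v∈ w∈ vw same lt with J v in jv | J w in jw
      ... | true  | true  = indep v w jv jw vw
      ... | true  | false with col w ≡ᵇ j in cw
      ...   | true  = <⇒≢ j<k same
      ...   | false = case trans (sym cw) (subst (λ c → (c ≡ᵇ j) ≡ true) same (==-refl j)) of λ ()
      proper′ v w v∈ w∈ vw same lt | false | true with col v ≡ᵇ j in cv
      ...   | true  = <-irrefl refl lt
      ...   | false = case trans (sym cv) (subst (λ c → (c ≡ᵇ j) ≡ true) (sym same) (==-refl j)) of λ ()
      proper′ v w v∈ w∈ vw same lt | false | false with col v ≡ᵇ j | col w ≡ᵇ j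
      ...   | true  | _     = <-irrefl refl lt
      ...   | false | true  = <-irrefl same lt
      ...   | false | false = proper v w v∈ w∈ vw same lt

      gain : count (below col k) + count J ≤ count (below col′ k) + count (cls col j)
      gain = tally 5 (λ v → W v ∷ J v ∷ (col v <ᵇ k) ∷ (col v ≡ᵇ j) ∷ (col′ v <ᵇ k) ∷ [])
        (λ w m b c b′ → (m ⇒ w) ∧ (m ∧ b ⇒ c) ∧ (m ⇒ b′) ∧ (b ∧ not c ⇒ b′))
        ((λ w m b c b′ → w ∧ b) ∷ (λ w m b c b′ → m) ∷ []) ((λ w m b c b′ → w ∧ b′) ∷ (λ w m b c b′ → w ∧ c) ∷ []) refl
        (λ v → ∧-intro (⇒-intro (proj₁ ∘ fits v)) (∧-intro (⇒-intro (inside v)) (∧-intro (⇒-intro (new v)) (⇒-intro (old v)))))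
        where
        inside : ∀ v → J v ∧ (col v <ᵇ k) ≡ true → (col v ≡ᵇ j) ≡ true
        inside v p = subst (λ c → (c ≡ᵇ j) ≡ true) (sym (proj₂ (fits v (∧-elimˡ p)) (<ᵇ-true (col v) k (∧-elimʳ {J v} p)))) (==-refl j)
        new : ∀ v → J v ≡ true → (col′ v <ᵇ k) ≡ true
        new v p rewrite p = true-<ᵇ j<k
        old : ∀ v → (col v <ᵇ k) ∧ not (col v ≡ᵇ j) ≡ true → (col′ v <ᵇ k) ≡ true
        old v p with J v | col v ≡ᵇ j | ∧-elimˡ {col v <ᵇ k} p | ∧-elimʳ {col v <ᵇ k} p
        ... | true  | _     | _ | _ = true-<ᵇ j<k
        ... | false | false | b | _ = b

    exchange : ∀ J → J ⊆ outside col k → Independent J → ∀ j → j < k → count J ≤ count (cls col j)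
    exchange J J⊆Z indep j j<k = replace-class j j<k J
      (λ v p → outside⊆W col k v (J⊆Z v p) , λ lt → ⊥-elim (outside-colour col k v (J⊆Z v p) lt)) indep

    -- A vertex outside the family without neighbours in class `j` could be added to that class.
    hit : ∀ z → z ∈ outside col k → ∀ j → j < k → Σ[ v ∈ Fin n ] v ∈ adj z ∩ cls col j
    hit z z∈Z j j<k with search (adj z ∩ cls col j)
    ... | inj₁ found = found
    ... | inj₂ none  = ⊥-elim (impossible (count J ∷ count (cls col j) ∷ []) ((κ 1 , x₀ :≤ x₁) ∷ (κ 1 , κ 1 :+ x₁ :≤ x₀) ∷ []) refl
      (replace-class j j<k J fits indep ∷ larger ∷ []))
      where
      is-z : VSet n
      is-z v = does (v FinP.≟ z)

      J : VSet n
      J v = cls col j v ∨ is-z v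

      cases : ∀ v → v ∈ J → v ∈ cls col j ⊎ v ≡ z
      cases v p with cls col j v in c
      ... | true  = inj₁ refl
      ... | false = inj₂ (dec-true (v FinP.≟ z) p)

      fits : ∀ v → v ∈ J → v ∈ W × (col v < k → col v ≡ j)
      fits v p with cases v p
      ... | inj₁ c    = ∧-elimˡ c , λ _ → cls-colour col j v c
      ... | inj₂ refl = outside⊆W col k z z∈Z , λ lt → ⊥-elim (outside-colour col k z z∈Z lt)

      indep : Independent J
      indep v w p q vw with cases v p | cases w q
      ... | inj₁ c    | inj₁ d    = cls-independent proper j<k v w c d vw
      ... | inj₁ c    | inj₂ refl = none v (∧-intro (adj-sym vw) c)
      ... | inj₂ refl | inj₁ d    = none w (∧-intro vw d)
      ... | inj₂ refl | inj₂ refl = adj-irrefl vw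

      singleton : ∀ {m} (x : Fin m) → 1 ≤ count (λ v → does (v FinP.≟ x))
      singleton zero    = s≤s z≤n
      singleton (suc x) = singleton x

      larger : suc (count (cls col j)) ≤ count J
      larger = farkas (count (cls col j) ∷ count J ∷ count is-z ∷ []) (κ 1 :+ x₀ :≤ x₁)
        ((κ 1 , x₀ :+ x₂ :≤ x₁) ∷ (κ 1 , κ 1 :≤ x₂) ∷ []) refl
        (tally 2 (λ v → cls col j v ∷ is-z v ∷ []) (λ c z → not (c ∧ z))
          ((λ c z → c) ∷ (λ c z → z) ∷ []) ((λ c z → c ∨ z) ∷ []) refl
          (λ v → not-intro (λ p → not-in v (dec-true (v FinP.≟ z) (∧-elimʳ {cls col j v} p)) (∧-elimˡ p)))
        ∷ singleton z ∷ [])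
        where
        not-in : ∀ v → v ≡ z → v ∈ cls col j → ⊥
        not-in v refl c = outside-colour col k z z∈Z (subst (_< k) (sym (cls-colour col j z c)) j<k)

  -- Wheels: a clique joined to a closed walk of length five

  module Wheels {n : ℕ} (G : Graph n) where
    open Graph G
    open Cliques G
    open FiveWalks G

    record Wheel (W : VSet n) (k : ℕ) : Set where
      constructor wheel
      field
        hub : Clique W k
        rim : FiveWalk (W ∩ common hub)

    walk-mono : ∀ {S S′} → S ⊆ S′ → FiveWalk S → FiveWalk S′
    walk-mono S⊆S′ c = record
      { in₁ = S⊆S′ c₁ in₁ ; in₂ = S⊆S′ c₂ in₂ ; in₃ = S⊆S′ c₃ in₃ ; in₄ = S⊆S′ c₄ in₄ ; in₅ = S⊆S′ c₅ in₅
      ; e₁₂ = e₁₂ ; e₂₃ = e₂₃ ; e₃₄ = e₃₄ ; e₄₅ = e₄₅ ; e₅₁ = e₅₁ }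
      where open FiveWalk c

    wheel-in : ∀ {A W k} (K : Clique A k) → A ⊆ W → FiveWalk (W ∩ common K) → Wheel W k
    wheel-in {W = W} K A⊆W c = wheel (clique-mono A⊆W K) (subst (λ S → FiveWalk (W ∩ S)) (sym (common-mono A⊆W K)) c)

  -- A wheel from a dense family

  module FamilyWheel {n : ℕ} (G : Graph n) (W : VSet n) {u : ℕ} (misses : Cliques.MissesAtMost G u W) (e k : ℕ)
    (free : ¬ Cliques.Clique G W (3 + k)) (large : (2 * k + 3) * u ≤ 2 * count W + e)
    (small : 2 * k * e + 7 * e < u)
    (col : Fin n → ℕ) (proper : Families.Proper G W col k)
    (dense : 2 * (k * u) + e < 2 * count (Families.below G W col k) + u)
    (best : ∀ col′ → Families.Proper G W col′ k → count (Families.below G W col′ k) ≤ count (Families.below G W col k))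
    where
    open Graph G
    open Cliques G
    open Families G W
    open FiveWalks G
    open Wheels G
    open OptimalFamily G W k col proper best
    open MaximalFamily G W misses e k free large col proper dense hit exchange

    outside-large : 3 * u ≤ 2 * count Z + e
    outside-large = farkas (k ∷ u ∷ e ∷ count W ∷ count B ∷ count Z ∷ []) (κ 3 :* x₁ :≤ κ 2 :* x₅ :+ x₂)
      ((κ 1 , (κ 2 :* x₀ :+ κ 3) :* x₁ :≤ κ 2 :* x₃ :+ x₂) ∷ (κ 2 , x₃ :≤ x₄ :+ x₅) ∷ (κ 2 , x₄ :≤ x₀ :* x₁) ∷ []) refl
      (large ∷ ≤-reflexive (below+outside col k) ∷ below-size misses k proper ∷ [])

    extend-colouring : ∀ c → Colouring Z c → Colouring W (c + k)
    extend-colouring c (colZ , bound , properZ) = col′ , bound′ , proper′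
      where
      col′ : Fin n → ℕ
      col′ v = if col v <ᵇ k then col v else colZ v + k

      outer : ∀ {v} → v ∈ W → (col v <ᵇ k) ≡ false → v ∈ Z
      outer {v} w eq = ∧-intro w (cong not eq)

      bound′ : ∀ v → v ∈ W → col′ v < c + k
      bound′ v w with col v <ᵇ k in eq
      ... | true  = <-≤-trans (<ᵇ-true (col v) k eq) (m≤n+m k c)
      ... | false = +-monoˡ-< k (bound v (outer w eq))

      proper′ : ∀ v w → v ∈ W → w ∈ W → w ∈ adj v → col′ v ≢ col′ w
      proper′ v w v∈ w∈ vw with col v <ᵇ k in ev | col w <ᵇ k in ew
      ... | true  | true  = λ same → proper v w v∈ w∈ vw same (<ᵇ-true (col v) k ev)
      ... | true  | false = λ same → <⇒≱ (<ᵇ-true (col v) k ev) (subst (k ≤_) (sym same) (m≤n+m k (colZ w)))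
      ... | false | true  = λ same → <⇒≱ (<ᵇ-true (col w) k ew) (subst (k ≤_) same (m≤n+m k (colZ v)))
      ... | false | false = λ same → properZ v w (outer v∈ ev) (outer w∈ ew) vw (+-cancelʳ-≡ k (colZ v) (colZ w) same)

    -- By `walk-neighbours` the five vertices have at most 2 |Z| neighbours in `Z` in total, while
    -- each has at least |Z| - u of them plus the number of vertices that it misses in `B`. As |Z|
    -- is about 3u / 2 or more, the five together miss at most about u / 2 vertices of `B`, and the
    -- hub is found greedily in their common neighbourhood.
    walk-wheel : TriangleFree Z → FiveWalk Z → Wheel W k
    walk-wheel tf c = wheel-in K (λ v p → below⊆W col k v (∧-elimʳ {A v} p)) (record
      { in₁ = on in₁ (λ v p → ∧-elimˡ p) ; in₂ = on in₂ (λ v p → ∧-elimˡ (∧-elimʳ {adj c₁ v} p))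
      ; in₃ = on in₃ (λ v p → ∧-elimˡ (∧-elimʳ {adj c₂ v} (∧-elimʳ {adj c₁ v} p)))
      ; in₄ = on in₄ (λ v p → ∧-elimˡ (∧-elimʳ {adj c₃ v} (∧-elimʳ {adj c₂ v} (∧-elimʳ {adj c₁ v} p))))
      ; in₅ = on in₅ (λ v p → ∧-elimʳ {adj c₄ v} (∧-elimʳ {adj c₃ v} (∧-elimʳ {adj c₂ v} (∧-elimʳ {adj c₁ v} p))))
      ; e₁₂ = e₁₂ ; e₂₃ = e₂₃ ; e₃₄ = e₃₄ ; e₄₅ = e₄₅ ; e₅₁ = e₅₁ })
      where
      open FiveWalk c
      A : VSet n
      A = adj c₁ ∩ (adj c₂ ∩ (adj c₃ ∩ (adj c₄ ∩ adj c₅)))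

      split : count B ≤ count (A ∩ B) + (miss c₁ + (miss c₂ + (miss c₃ + (miss c₄ + miss c₅))))
      split = tally 6 (λ v → B v ∷ adj c₁ v ∷ adj c₂ v ∷ adj c₃ v ∷ adj c₄ v ∷ adj c₅ v ∷ []) (λ _ _ _ _ _ _ → true)
        ((λ s a b c d e → s) ∷ [])
        ((λ s a b c d e → (a ∧ (b ∧ (c ∧ (d ∧ e)))) ∧ s) ∷ (λ s a b c d e → s ∧ not a) ∷ (λ s a b c d e → s ∧ not b)
          ∷ (λ s a b c d e → s ∧ not c) ∷ (λ s a b c d e → s ∧ not d) ∷ (λ s a b c d e → s ∧ not e) ∷ []) refl (λ _ → refl)

      degrees : 5 * count Z + (miss c₁ + (miss c₂ + (miss c₃ + (miss c₄ + miss c₅)))) ≤ 2 * count Z + 5 * u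
      degrees = farkas (count Z ∷ u ∷ miss c₁ ∷ miss c₂ ∷ miss c₃ ∷ miss c₄ ∷ miss c₅ ∷
          count (Z ∩ adj c₁) ∷ count (Z ∩ adj c₂) ∷ count (Z ∩ adj c₃) ∷ count (Z ∩ adj c₄) ∷ count (Z ∩ adj c₅) ∷ [])
        (κ 5 :* x₀ :+ (x₂ :+ (x₃ :+ (x₄ :+ (x₅ :+ x₆)))) :≤ κ 2 :* x₀ :+ κ 5 :* x₁)
        ((κ 1 , x₀ :+ x₂ :≤ x₇ :+ x₁) ∷ (κ 1 , x₀ :+ x₃ :≤ x₈ :+ x₁) ∷ (κ 1 , x₀ :+ x₄ :≤ x₉ :+ x₁)
          ∷ (κ 1 , x₀ :+ x₅ :≤ var 10 :+ x₁) ∷ (κ 1 , x₀ :+ x₆ :≤ var 11 :+ x₁)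
          ∷ (κ 1 , x₇ :+ (x₈ :+ (x₉ :+ (var 10 :+ var 11))) :≤ x₀ :+ x₀) ∷ []) refl
        (outside-degree c₁ (Z⊆W c₁ in₁) ∷ outside-degree c₂ (Z⊆W c₂ in₂) ∷ outside-degree c₃ (Z⊆W c₃ in₃)
          ∷ outside-degree c₄ (Z⊆W c₄ in₄) ∷ outside-degree c₅ (Z⊆W c₅ in₅) ∷ walk-neighbours tf (λ _ → id) c ∷ [])

      K : Clique (A ∩ B) k
      K = greedy misses k (∩B⊆W A) (farkas-refute
        (k ∷ u ∷ e ∷ count W ∷ count B ∷ count Z ∷ miss c₁ + (miss c₂ + (miss c₃ + (miss c₄ + miss c₅))) ∷ count (A ∩ B) ∷ [])
        (κ 1 :+ x₀ :* x₁) (x₇ :+ x₁) (κ 2)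
        ((κ 3 , (κ 2 :* x₀ :+ κ 3) :* x₁ :≤ κ 2 :* x₃ :+ x₂) ∷ (κ 6 , x₃ :≤ x₄ :+ x₅) ∷ (κ 4 , x₄ :≤ x₀ :* x₁) ∷ (κ 2 , x₄ :≤ x₇ :+ x₆)
          ∷ (κ 2 , κ 5 :* x₅ :+ x₆ :≤ κ 2 :* x₅ :+ κ 5 :* x₁) ∷ (κ 1 , κ 1 :+ (κ 2 :* x₀ :* x₂ :+ κ 7 :* x₂) :≤ x₁) ∷ []) refl
        (large ∷ ≤-reflexive (below+outside col k) ∷ below-size misses k proper ∷ split ∷ degrees ∷ small ∷ []))

      on : ∀ {x} → x ∈ Z → A ⊆ adj x → x ∈ W ∩ common K
      on {x} x∈ A⊆ = common-neighbour A K A⊆ (Z⊆W x x∈)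

    classes-total : ∀ m → (∀ q → q < m → u ≤ count (cls col q) + e) → m * u ≤ count (below col m) + m * e
    classes-total zero    big = z≤n
    classes-total (suc m) big = farkas (u ∷ e ∷ m ∷ count (below col m) ∷ count (cls col m) ∷ count (below col (suc m)) ∷ [])
      ((κ 1 :+ x₂) :* x₀ :≤ x₅ :+ (κ 1 :+ x₂) :* x₁)
      ((κ 1 , x₀ :≤ x₄ :+ x₁) ∷ (κ 1 , x₂ :* x₀ :≤ x₃ :+ x₂ :* x₁) ∷ (κ 1 , x₃ :+ x₄ :≤ x₅) ∷ []) refl
      (big m ≤-refl ∷ classes-total m (λ q q<m → big q (m≤n⇒m≤1+n q<m)) ∷ ≤-reflexive (sym (below-suc col m)) ∷ [])

    private
      -- `x` misses its own class, which is almost all that it may miss.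
      outside-class : ∀ q x → q < k → x ∈ cls col q → u ≤ count (cls col q) + e → count ((W ∖ cls col q) ∖ adj x) ≤ e
      outside-class q x q<k x∈ big = farkas (u ∷ e ∷ count (cls col q) ∷ count ((W ∖ cls col q) ∖ adj x) ∷ count (W ∖ adj x) ∷ []) (x₃ :≤ x₁)
        ((κ 1 , x₀ :≤ x₂ :+ x₁) ∷ (κ 1 , x₂ :+ x₃ :≤ x₄) ∷ (κ 1 , x₄ :≤ x₀) ∷ []) refl
        (big ∷ tally 3 (λ v → W v ∷ (col v ≡ᵇ q) ∷ adj x v ∷ []) (λ w c a → w ∧ c ⇒ not a)
          ((λ w c a → w ∧ c) ∷ (λ w c a → (w ∧ not (w ∧ c)) ∧ not a) ∷ []) ((λ w c a → w ∧ not a) ∷ []) refl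
          (λ v → ⇒-intro (λ p → not-intro (cls-independent proper q<k x v x∈ p)))
        ∷ misses x (∧-elimˡ x∈) ∷ [])

    -- The rim is `z`, `b`, `w`, `b′`, `z′`, where `b` and `b′` are neighbours of `z` and `z′` in
    -- class `j` and `w` lies outside the family. The hub is a vertex `x` outside the family
    -- together with a clique `T` from the other classes. Vertices of the classes miss at most `e`
    -- vertices outside their own class, so adjacency to them costs almost nothing.
    pair-wheel : ∀ z z′ j → z ∈ Z → z′ ∈ Z → z′ ∈ adj z → j < k → NoCommon z z′ j →
      (∀ q → q < k → u ≤ count (cls col q) + e) → ∀ k′ → k ≡ suc k′ → Wheel W (suc k′)
    pair-wheel z z′ j z∈ z′∈ zz′ j<k none big k′ refl = wheel-in hub (λ v p → ∧-elimˡ p) (record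
      { in₁ = on (Z⊆W z z∈) (λ v p → ∧-elimˡ (∧-elimʳ {W v} p))
      ; in₂ = on (∧-elimˡ b∈) (λ v p → ∧-elimˡ (∧-elimʳ {adj z′ v} (∧-elimʳ {adj z v} (∧-elimʳ {W v} p))))
      ; in₃ = ∧-intro (Z⊆W w w∈Z) (∧-intro w∈x w∈K)
      ; in₄ = on (∧-elimˡ b′∈) (λ v p → ∧-elimʳ {adj b v} (∧-elimʳ {adj z′ v} (∧-elimʳ {adj z v} (∧-elimʳ {W v} p))))
      ; in₅ = on (Z⊆W z′ z′∈) (λ v p → ∧-elimˡ (∧-elimʳ {adj z v} (∧-elimʳ {W v} p)))
      ; e₁₂ = zb ; e₂₃ = bw ; e₃₄ = adj-sym b′w ; e₄₅ = adj-sym z′b′ ; e₅₁ = adj-sym zz′ })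
      where
      b b′ : Fin n
      b = proj₁ (hit z z∈ j j<k)
      b′ = proj₁ (hit z′ z′∈ j j<k)

      b∈ : b ∈ cls col j
      b∈ = ∧-elimʳ {adj z b} (proj₂ (hit z z∈ j j<k))
      b′∈ : b′ ∈ cls col j
      b′∈ = ∧-elimʳ {adj z′ b′} (proj₂ (hit z′ z′∈ j j<k))
      zb : b ∈ adj z
      zb = ∧-elimˡ (proj₂ (hit z z∈ j j<k))
      z′b′ : b′ ∈ adj z′
      z′b′ = ∧-elimˡ (proj₂ (hit z′ z′∈ j j<k))

      N : VSet n
      N = adj z ∩ (adj z′ ∩ (adj b ∩ adj b′))

      far far′ : VSet n
      far  = (W ∖ cls col j) ∖ adj b
      far′ = (W ∖ cls col j) ∖ adj b′

      far≤ : count far ≤ e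
      far≤ = outside-class j b j<k b∈ (big j j<k)
      far′≤ : count far′ ≤ e
      far′≤ = outside-class j b′ j<k b′∈ (big j j<k)

      not-class : ∀ {v} → v ∈ Z → not (cls col j v) ≡ true
      not-class {v} p = not-intro (λ c → outside-colour col k v p (subst (_< k) (sym (cls-colour col j v c)) j<k))

      -- Together `z` and `z′` miss all of class `j`, so at least u - e vertices of the family, and
      -- therefore at most u + e vertices of `Z`, which has about 3u / 2 or more.
      x₀-exists : Σ[ x ∈ Fin n ] x ∈ Z ∩ N
      x₀-exists = inhabited (Z ∩ N) (farkas-refute
        (u ∷ e ∷ count Z ∷ miss z ∷ miss z′ ∷ count (cls col j) ∷ count (Z ∩ N) ∷ count far ∷ count far′ ∷ k ∷ [])
        (κ 1) x₆ (κ 2)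
        ((κ 2 , x₂ :+ (x₃ :+ x₄) :≤ x₆ :+ (x₇ :+ (x₈ :+ (x₀ :+ x₀)))) ∷ (κ 2 , x₅ :≤ x₃ :+ x₄) ∷ (κ 2 , x₀ :≤ x₅ :+ x₁) ∷ (κ 2 , x₇ :≤ x₁) ∷ (κ 2 , x₈ :≤ x₁)
          ∷ (κ 1 , κ 3 :* x₀ :≤ κ 2 :* x₂ :+ x₁) ∷ (κ 1 , κ 1 :+ (κ 2 :* x₉ :* x₁ :+ κ 7 :* x₁) :≤ x₀) ∷ []) refl
        (≤-trans cut (+-monoʳ-≤ (count (Z ∩ N)) (+-monoʳ-≤ (count far) (+-monoʳ-≤ (count far′) (+-mono-≤ (misses z (Z⊆W z z∈)) (misses z′ (Z⊆W z′ z′∈))))))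
          ∷ cover z z′ j<k none ∷ big j j<k ∷ far≤ ∷ far′≤ ∷ outside-large ∷ small ∷ []))
        where
        cut : count Z + (miss z + miss z′) ≤ count (Z ∩ N) + (count far + (count far′ + (count (W ∖ adj z) + count (W ∖ adj z′))))
        cut = tally 7 (λ v → W v ∷ (col v <ᵇ k) ∷ cls col j v ∷ adj z v ∷ adj z′ v ∷ adj b v ∷ adj b′ v ∷ [])
          (λ w l c p q r s → w ∧ not l ⇒ not c)
          ((λ w l c p q r s → w ∧ not l) ∷ (λ w l c p q r s → (w ∧ l) ∧ not p) ∷ (λ w l c p q r s → (w ∧ l) ∧ not q) ∷ [])
          ((λ w l c p q r s → (w ∧ not l) ∧ (p ∧ (q ∧ (r ∧ s)))) ∷ (λ w l c p q r s → (w ∧ not c) ∧ not r) ∷ (λ w l c p q r s → (w ∧ not c) ∧ not s)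
            ∷ (λ w l c p q r s → w ∧ not p) ∷ (λ w l c p q r s → w ∧ not q) ∷ []) refl
          (λ v → ⇒-intro not-class)

      x : Fin n
      x = proj₁ x₀-exists
      x∈Z : x ∈ Z
      x∈Z = ∧-elimˡ (proj₂ x₀-exists)
      x∈N : x ∈ N
      x∈N = ∧-elimʳ {Z x} (proj₂ x₀-exists)

      A : VSet n
      A = ((B ∖ cls col j) ∩ N) ∩ adj x

      A⊆B : A ⊆ B
      A⊆B v p = ∧-elimˡ (∧-elimˡ (∧-elimˡ p))

      -- Leaving class `j` out of `A` costs nothing, as each of its vertices is missed by `z` or
      -- `z′` anyway. The vertices `z`, `z′`, `x` miss at most about 3u / 2 vertices of `B`, which
      -- leaves more than (k′ - 1) u.
      T : Clique A k′
      T = greedy misses k′ (λ v p → below⊆W col k v (A⊆B v p)) (farkas-refute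
        (u ∷ e ∷ count B ∷ miss z ∷ miss z′ ∷ miss x ∷ count A ∷ count far ∷ count far′ ∷ k′ ∷ []) (κ 1 :+ x₉ :* x₀) (x₆ :+ x₀) (κ 2)
        ((κ 2 , x₂ :≤ x₆ :+ (x₇ :+ (x₈ :+ (x₃ :+ (x₄ :+ x₅))))) ∷ (κ 2 , x₇ :≤ x₁) ∷ (κ 2 , x₈ :≤ x₁)
          ∷ (κ 1 , κ 2 :* x₃ :≤ x₀ :+ x₁) ∷ (κ 1 , κ 2 :* x₄ :≤ x₀ :+ x₁) ∷ (κ 1 , κ 2 :* x₅ :≤ x₀ :+ x₁)
          ∷ (κ 2 , (κ 1 :+ x₉) :* x₀ :≤ x₂ :+ (κ 1 :+ x₉) :* x₁)
          ∷ (κ 1 , κ 1 :+ (κ 2 :* (κ 1 :+ x₉) :* x₁ :+ κ 7 :* x₁) :≤ x₀) ∷ []) refl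
        (cut ∷ far≤ ∷ far′≤ ∷ miss-half z z∈ ∷ miss-half z′ z′∈ ∷ miss-half x x∈Z ∷ classes-total (suc k′) big ∷ small ∷ []))
        where
        cut : count B ≤ count A + (count far + (count far′ + (miss z + (miss z′ + miss x))))
        cut = tally 8 (λ v → W v ∷ (col v <ᵇ k) ∷ cls col j v ∷ adj z v ∷ adj z′ v ∷ adj b v ∷ adj b′ v ∷ adj x v ∷ [])
          (λ w l c p q r s t → not ((p ∧ q) ∧ c))
          ((λ w l c p q r s t → w ∧ l) ∷ [])
          ((λ w l c p q r s t → (((w ∧ l) ∧ not c) ∧ (p ∧ (q ∧ (r ∧ s)))) ∧ t) ∷ (λ w l c p q r s t → (w ∧ not c) ∧ not r) ∷ (λ w l c p q r s t → (w ∧ not c) ∧ not s)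
            ∷ (λ w l c p q r s t → (w ∧ l) ∧ not p) ∷ (λ w l c p q r s t → (w ∧ l) ∧ not q) ∷ (λ w l c p q r s t → (w ∧ l) ∧ not t) ∷ []) refl
          (λ v → not-intro (none v))

      hub : Clique (W ∩ N) (suc k′)
      hub = cons x (∧-intro (Z⊆W x x∈Z) x∈N) (clique-mono
        (λ v p → ∧-intro (∧-intro (below⊆W col k v (A⊆B v p)) (∧-elimʳ {(B ∖ cls col j) v} (∧-elimˡ p))) (∧-elimʳ {((B ∖ cls col j) ∩ N) v} p)) T)

      T-kills : ∀ y → y ∈ A → count (Z ∖ adj y) ≤ e
      T-kills y y∈ = ≤-trans (count-mono (λ v p → let zv , a = ∧-elim {Z v} p in ∧-intro (∧-intro (Z⊆W v zv)
          (not-intro (λ c → outside-colour col k v zv (subst (_< k) (sym (cls-colour col (col y) v c)) y<k)))) a))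
        (outside-class (col y) y y<k (in-cls col (col y) y (below⊆W col k y (A⊆B y y∈)) refl) (big (col y) y<k))
        where
        y<k : col y < k
        y<k = below-colour col k y (A⊆B y y∈)

      w-exists : Σ[ w ∈ Fin n ] w ∈ Z ∩ (adj b ∩ (adj b′ ∩ (adj x ∩ common T)))
      w-exists = inhabited _ (farkas-refute
        (u ∷ e ∷ count Z ∷ count (Z ∩ (adj b ∩ (adj b′ ∩ (adj x ∩ common T)))) ∷ count far ∷ count far′ ∷ count (W ∖ adj x) ∷ count (Z ∖ common T) ∷ k′ ∷ [])
        (κ 1) x₃ (κ 2)
        ((κ 2 , x₂ :≤ x₃ :+ (x₄ :+ (x₅ :+ (x₆ :+ x₇)))) ∷ (κ 2 , x₄ :≤ x₁) ∷ (κ 2 , x₅ :≤ x₁) ∷ (κ 2 , x₆ :≤ x₀) ∷ (κ 2 , x₇ :≤ x₈ :* x₁)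
          ∷ (κ 1 , κ 3 :* x₀ :≤ κ 2 :* x₂ :+ x₁) ∷ (κ 1 , κ 1 :+ (κ 2 :* (κ 1 :+ x₈) :* x₁ :+ κ 7 :* x₁) :≤ x₀) ∷ []) refl
        (cut ∷ far≤ ∷ far′≤ ∷ misses x (Z⊆W x x∈Z) ∷ common-misses Z e T-kills T ∷ outside-large ∷ small ∷ []))
        where
        cut : count Z ≤ count (Z ∩ (adj b ∩ (adj b′ ∩ (adj x ∩ common T)))) + (count far + (count far′ + (count (W ∖ adj x) + count (Z ∖ common T))))
        cut = tally 7 (λ v → W v ∷ (col v <ᵇ k) ∷ cls col j v ∷ adj b v ∷ adj b′ v ∷ adj x v ∷ common T v ∷ [])
          (λ w l c r s t m → w ∧ not l ⇒ not c)
          ((λ w l c r s t m → w ∧ not l) ∷ [])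
          ((λ w l c r s t m → (w ∧ not l) ∧ (r ∧ (s ∧ (t ∧ m)))) ∷ (λ w l c r s t m → (w ∧ not c) ∧ not r) ∷ (λ w l c r s t m → (w ∧ not c) ∧ not s)
            ∷ (λ w l c r s t m → w ∧ not t) ∷ (λ w l c r s t m → (w ∧ not l) ∧ not m) ∷ []) refl
          (λ v → ⇒-intro not-class)

      w : Fin n
      w = proj₁ w-exists
      w∈Z : w ∈ Z
      w∈Z = ∧-elimˡ (proj₂ w-exists)
      bw : w ∈ adj b
      bw = ∧-elimˡ (∧-elimʳ {Z w} (proj₂ w-exists))
      b′w : w ∈ adj b′
      b′w = ∧-elimˡ (∧-elimʳ {adj b w} (∧-elimʳ {Z w} (proj₂ w-exists)))
      w∈x : w ∈ adj x
      w∈x = ∧-elimˡ (∧-elimʳ {adj b′ w} (∧-elimʳ {adj b w} (∧-elimʳ {Z w} (proj₂ w-exists))))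
      w∈K : w ∈ common (clique-mono _ T)
      w∈K = subst (w ∈_) (sym (common-mono _ T)) (∧-elimʳ {adj x w} (∧-elimʳ {adj b′ w} (∧-elimʳ {adj b w} (∧-elimʳ {Z w} (proj₂ w-exists)))))

      on : ∀ {y} → y ∈ W → W ∩ N ⊆ adj y → y ∈ W ∩ common hub
      on y∈ N⊆ = ∧-intro y∈ (member-common hub N⊆)

    -- Without a wheel, `Z` is triangle-free by `pair-wheel` and has no closed five-walk by
    -- `walk-wheel`. Hence it is bipartite, and two colours added to those of the family suffice for
    -- `W`.
    family-wheel : ¬ Colouring W (2 + k) → ¬ Wheel W k → ⊥
    family-wheel no-colouring no-wheel = no-colouring (extend-colouring 2
      (bipartite tf (misses-mono Z⊆W misses) outside-large small′ (no-wheel ∘ walk-wheel tf)))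
      where
      some : ∀ z z′ j → z ∈ Z → z′ ∈ Z → z′ ∈ adj z → j < k → ¬ NoCommon z z′ j
      some z z′ j z∈ z′∈ zz′ j<k none = no-wheel (subst (Wheel W) (sym k≡) (pair-wheel z z′ j z∈ z′∈ zz′ j<k none (proj₁ (pair-structure z z′ j z∈ z′∈ j<k none)) (pred k) k≡))
        where
        k≡ : k ≡ suc (pred k)
        k≡ = sym (suc-pred k {{>-nonZero (≤-<-trans z≤n j<k)}})

      tf : TriangleFree Z
      tf = triangle-free some

      small′ : 6 * e < u
      small′ = farkas (k ∷ e ∷ u ∷ []) (κ 1 :+ κ 6 :* x₁ :≤ x₂) ((κ 1 , κ 1 :+ (κ 2 :* x₀ :* x₁ :+ κ 7 :* x₁) :≤ x₂) ∷ []) refl (small ∷ [])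

  -- A dense family from a wheel

  module WheelFamily {n : ℕ} (G : Graph n) (W : VSet n) {u : ℕ} (misses : Cliques.MissesAtMost G u W) (e k : ℕ)
    (free : ¬ Cliques.Clique G W (3 + k)) (large : (2 * k + 3) * u ≤ 2 * count W + e) (small : 21 * e < u) where
    open Graph G
    open Cliques G
    open Families G W
    open FiveWalks G
    open Wheels G

    missed first-missed : ∀ {A l} → Clique A l → Fin n → ℕ
    missed nil v          = 0
    missed (cons x _ K) v = ⟦ not (adj x v) ⟧ + missed K v
    first-missed nil v          = 0
    first-missed (cons x _ K) v = if adj x v then suc (first-missed K v) else 0

    missed-none : ∀ {A l} (K : Clique A l) v → missed K v ≡ 0 → v ∈ common K
    missed-none nil v eq = refl
    missed-none (cons x _ K) v eq with adj x v
    ... | true = missed-none K v eq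

    first-missed-bound : ∀ {A l} (K : Clique A l) v → missed K v ≡ 1 → first-missed K v < l
    first-missed-bound (cons x _ K) v eq with adj x v
    ... | true  = s≤s (first-missed-bound K v eq)
    ... | false = s≤s z≤n

    missed-total : ∀ {A l} (K : Clique A l) → A ⊆ W → sum (λ v → ⟦ W v ⟧ * missed K v) ≤ l * u
    missed-total nil A⊆W = ≤-reflexive (trans (sum-cong-≗ (λ v → *-zeroʳ ⟦ W v ⟧)) (sum-replicate-zero n))
    missed-total {A} (cons x a K) A⊆W = begin
      sum (λ v → ⟦ W v ⟧ * (⟦ not (adj x v) ⟧ + missed K v))              ≡⟨ sum-cong-≗ (λ v → split (W v) (adj x v) (missed K v)) ⟩
      sum (λ v → ⟦ W v ∧ not (adj x v) ⟧ + ⟦ W v ⟧ * missed K v)          ≡⟨ ∑-distrib-+ (λ v → ⟦ W v ∧ not (adj x v) ⟧) (λ v → ⟦ W v ⟧ * missed K v) ⟩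
      count (W ∖ adj x) + sum (λ v → ⟦ W v ⟧ * missed K v)                ≤⟨ +-mono-≤ (misses x (A⊆W x a)) (missed-total K (λ v p → A⊆W v (∧-elimˡ {A v} p))) ⟩
      _ ∎
      where
      open ≤-Reasoning
      split : ∀ w b m → ⟦ w ⟧ * (⟦ not b ⟧ + m) ≡ ⟦ w ∧ not b ⟧ + ⟦ w ⟧ * m
      split true  true  m = refl
      split true  false m = refl
      split false b     m = refl

    -- Two vertices that both miss exactly the same element of K can replace it.
    drop-missed : ∀ {A l} (K : Clique A l) y y′ → missed K y ≡ 1 → missed K y′ ≡ 1 → first-missed K y ≡ first-missed K y′ →
      Σ[ l′ ∈ ℕ ] l ≡ suc l′ × Σ[ K′ ∈ Clique A l′ ] (y ∈ common K′ × y′ ∈ common K′ × common K ⊆ common K′)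
    drop-missed {A} (cons x a K) y y′ my my′ same with adj x y in ey | adj x y′ in ey′
    ... | true | true with l′ , refl , K′ , yK , yK′ , incl ← drop-missed K y y′ my my′ (suc-injective same) =
      suc l′ , refl , cons x a K′ , ∧-intro ey yK , ∧-intro ey′ yK′ , λ v p → ∧-intro (∧-elimˡ p) (incl v (∧-elimʳ {adj x v} p))
    ... | false | false = _ , refl , clique-mono A′⊆A K , on (missed-none K y (suc-injective my)) , on (missed-none K y′ (suc-injective my′))
        , λ v p → on (∧-elimʳ {adj x v} p)
      where
      A′⊆A : A ∩ adj x ⊆ A
      A′⊆A v p = ∧-elimˡ {A v} p
      on : ∀ {v} → v ∈ common K → v ∈ common (clique-mono A′⊆A K)
      on {v} = subst (v ∈_) (sym (common-mono A′⊆A K))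

    private
      -- At most one of the five bits is false; for adjacencies to the rim, at most one rim vertex
      -- is missed.
      few : Op 5
      few a b c d f = height (not ∷ []) (a ∷ []) + (height (not ∷ []) (b ∷ []) + (height (not ∷ []) (c ∷ []) + (height (not ∷ []) (d ∷ []) + height (not ∷ []) (f ∷ [])))) ≤ᵇ 1

      shared-edge : Op 10
      shared-edge a b c d f a′ b′ c′ d′ f′ =
        ((a ∧ a′) ∧ (b ∧ b′)) ∨ ((b ∧ b′) ∧ (c ∧ c′)) ∨ ((c ∧ c′) ∧ (d ∧ d′)) ∨ ((d ∧ d′) ∧ (f ∧ f′)) ∨ ((f ∧ f′) ∧ (a ∧ a′))

    module _ (wh : Wheel W k) where
      open Wheel wh
      open FiveWalk rim

      private
        M₀ M₁ : VSet n
        M₀ v = missed hub v ≡ᵇ 0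
        M₁ v = missed hub v ≡ᵇ 1

        rim-few : VSet n
        rim-few v = few (adj c₁ v) (adj c₂ v) (adj c₃ v) (adj c₄ v) (adj c₅ v)

      -- A class collects the vertices that miss one particular hub vertex, no other hub vertex and
      -- at most one rim vertex: they could nearly replace this hub vertex.
      col : Fin n → ℕ
      col v = if M₁ v ∧ rim-few v then first-missed hub v else k

      private
        coloured : ∀ v → col v < k → M₁ v ≡ true × rim-few v ≡ true × col v ≡ first-missed hub v
        coloured v lt with M₁ v | rim-few v
        ... | true  | true  = refl , refl , refl
        ... | true  | false = ⊥-elim (<-irrefl refl lt)
        ... | false | _     = ⊥-elim (<-irrefl refl lt)

        col-bound : ∀ v → M₁ v ∧ rim-few v ≡ true → col v < k
        col-bound v p rewrite p = first-missed-bound hub v (==-sound (missed hub v) 1 (∧-elimˡ p))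

        square : ∀ {y y′ c c′ l′} → k ≡ suc l′ → (K′ : Clique W l′) → y ∈ W → y′ ∈ W → y ∈ common K′ → y′ ∈ common K′ → common hub ⊆ common K′ →
          y′ ∈ adj y → c ∈ W ∩ common hub → c′ ∈ W ∩ common hub → c′ ∈ adj c →
          (adj c y ∧ adj c y′) ∧ (adj c′ y ∧ adj c′ y′) ≡ true → ⊥
        square {y} {y′} {c} {c′} {l′} refl K′ y∈ y′∈ yK y′K incl yy′ c∈ c′∈ cc′ all = free (subst (Clique W) (+-comm l′ 4)
          (append (λ _ → id) K′ (cons y (∧-intro y∈ yK) (cons y′ (∧-intro (∧-intro y′∈ y′K) yy′)
            (cons c (∧-intro (∧-intro (on c∈) yc) y′c) (cons c′ (∧-intro (∧-intro (∧-intro (on c′∈) yc′) y′c′) cc′) nil))))))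
          where
          on : ∀ {v} → v ∈ W ∩ common hub → v ∈ W ∩ common K′
          on {v} p = ∧-intro (∧-elimˡ p) (incl v (∧-elimʳ {W v} p))
          p₁ = ∧-elimˡ {adj c y ∧ adj c y′} all
          p₂ = ∧-elimʳ {adj c y ∧ adj c y′} all
          yc = adj-sym (∧-elimˡ {adj c y} p₁)
          y′c = adj-sym (∧-elimʳ {adj c y} p₁)
          yc′ = adj-sym (∧-elimˡ {adj c′ y} p₂)
          y′c′ = adj-sym (∧-elimʳ {adj c′ y} p₂)

      -- Adjacent `y` and `y′` of one class miss the same hub vertex and together at most two rim
      -- vertices, so some rim edge has both ends adjacent to both. The other k - 1 hub vertices,
      -- `y`, `y′` and this edge form a clique of k + 3 vertices.
      wheel-proper : Proper col k
      wheel-proper y y′ y∈ y′∈ yy′ same lt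
        with my , fy , cy ← coloured y lt | my′ , fy′ , cy′ ← coloured y′ (subst (_< k) same lt)
        with l′ , k≡ , K′ , yK , y′K , incl ← drop-missed hub y y′ (==-sound (missed hub y) 1 my) (==-sound (missed hub y′) 1 my′) (trans (sym cy) (trans same cy′)) =
        conclude (everywhere-sound 10 (λ { (a ∷ b ∷ c ∷ d ∷ f ∷ a′ ∷ b′ ∷ c′ ∷ d′ ∷ f′ ∷ []) → few a b c d f ∧ few a′ b′ c′ d′ f′ ⇒ shared-edge a b c d f a′ b′ c′ d′ f′ })
          refl (adj c₁ y ∷ adj c₂ y ∷ adj c₃ y ∷ adj c₄ y ∷ adj c₅ y ∷ adj c₁ y′ ∷ adj c₂ y′ ∷ adj c₃ y′ ∷ adj c₄ y′ ∷ adj c₅ y′ ∷ []))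
        where
        or : ∀ {a b} → a ∨ b ≡ true → a ≡ true ⊎ b ≡ true
        or {true}  p = inj₁ refl
        or {false} p = inj₂ p

        sq = λ {c} {c′} → square {y} {y′} {c} {c′} k≡ K′ y∈ y′∈ yK y′K incl yy′

        conclude : (few (adj c₁ y) (adj c₂ y) (adj c₃ y) (adj c₄ y) (adj c₅ y) ∧ few (adj c₁ y′) (adj c₂ y′) (adj c₃ y′) (adj c₄ y′) (adj c₅ y′)
          ⇒ shared-edge (adj c₁ y) (adj c₂ y) (adj c₃ y) (adj c₄ y) (adj c₅ y) (adj c₁ y′) (adj c₂ y′) (adj c₃ y′) (adj c₄ y′) (adj c₅ y′)) ≡ true → ⊥
        conclude imp with or {(adj c₁ y ∧ adj c₁ y′) ∧ (adj c₂ y ∧ adj c₂ y′)} (⇒-elim imp (∧-intro fy fy′))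
        ... | inj₁ p = sq in₁ in₂ e₁₂ p
        ... | inj₂ r with or {(adj c₂ y ∧ adj c₂ y′) ∧ (adj c₃ y ∧ adj c₃ y′)} r
        ... | inj₁ p = sq in₂ in₃ e₂₃ p
        ... | inj₂ r with or {(adj c₃ y ∧ adj c₃ y′) ∧ (adj c₄ y ∧ adj c₄ y′)} r
        ... | inj₁ p = sq in₃ in₄ e₃₄ p
        ... | inj₂ r with or {(adj c₄ y ∧ adj c₄ y′) ∧ (adj c₅ y ∧ adj c₅ y′)} r
        ... | inj₁ p = sq in₄ in₅ e₄₅ p
        ... | inj₂ p = sq in₅ in₁ e₅₁ p

      private
        rest : VSet n
        rest v = (W v ∧ not (M₀ v)) ∧ not (M₁ v ∧ rim-few v)

        hub-misses : count (W ∖ M₀) + count ((W ∖ M₀) ∖ M₁) ≤ k * u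
        hub-misses = ≤-trans (≤-reflexive (sym (∑-distrib-+ (λ v → ⟦ (W ∖ M₀) v ⟧) (λ v → ⟦ ((W ∖ M₀) ∖ M₁) v ⟧))))
          (≤-trans (∑-mono (λ v → pointwise (W v) (missed hub v))) (missed-total hub (λ _ → id)))
          where
          pointwise : ∀ w m → ⟦ w ∧ not (m ≡ᵇ 0) ⟧ + ⟦ (w ∧ not (m ≡ᵇ 0)) ∧ not (m ≡ᵇ 1) ⟧ ≤ ⟦ w ⟧ * m
          pointwise true  0             = z≤n
          pointwise true  1             = ≤-refl
          pointwise true  (suc (suc m)) = s≤s (s≤s z≤n)
          pointwise false m             = z≤n

        env : Fin n → Vec Bool 8
        env v = W v ∷ M₀ v ∷ M₁ v ∷ adj c₁ v ∷ adj c₂ v ∷ adj c₃ v ∷ adj c₄ v ∷ adj c₅ v ∷ []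

        hyp : Op 8
        hyp w m m′ a b c d f = not (m ∧ m′) ∧ (not ((w ∧ m) ∧ (a ∧ b)) ∧ not ((w ∧ m) ∧ (b ∧ c)) ∧ not ((w ∧ m) ∧ (c ∧ d)) ∧ not ((w ∧ m) ∧ (d ∧ f)) ∧ not ((w ∧ m) ∧ (f ∧ a)))

        holds : ∀ v → apply hyp (env v) ≡ true
        holds v = ∧-intro (exclusive (missed hub v)) (∧-intro (apart in₁ in₂ e₁₂) (∧-intro (apart in₂ in₃ e₂₃) (∧-intro (apart in₃ in₄ e₃₄) (∧-intro (apart in₄ in₅ e₄₅) (apart in₅ in₁ e₅₁)))))
          where
          exclusive : ∀ m → not ((m ≡ᵇ 0) ∧ (m ≡ᵇ 1)) ≡ true
          exclusive zero    = refl
          exclusive (suc m) = refl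
          apart : ∀ {c c′} → c ∈ W ∩ common hub → c′ ∈ W ∩ common hub → c′ ∈ adj c → not ((W v ∧ M₀ v) ∧ (adj c v ∧ adj c′ v)) ≡ true
          apart {c} {c′} c∈ c′∈ cc′ = not-intro (λ p → let wm , cv = ∧-elim {W v ∧ M₀ v} p ; w , m = ∧-elim {W v} wm ; c~v , c′~v = ∧-elim {adj c v} cv in
            free (subst (Clique W) (+-comm k 3) (append (λ _ → id) hub (cons c c∈ (cons c′ (∧-intro c′∈ cc′)
              (cons v (∧-intro (∧-intro (∧-intro w (missed-none hub v (==-sound (missed hub v) 0 m))) c~v) c′~v) nil))))))

        rim-sets : List (Op 8)
        rim-sets = (λ w m m′ a b c d f → w ∧ not a) ∷ (λ w m m′ a b c d f → w ∧ not b) ∷ (λ w m m′ a b c d f → w ∧ not c)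
          ∷ (λ w m m′ a b c d f → w ∧ not d) ∷ (λ w m m′ a b c d f → w ∧ not f) ∷ []

        rim-misses : ℕ
        rim-misses = count (W ∖ adj c₁) + (count (W ∖ adj c₂) + (count (W ∖ adj c₃) + (count (W ∖ adj c₄) + count (W ∖ adj c₅))))

        rim-misses≤ : rim-misses ≤ 5 * u
        rim-misses≤ = farkas (count (W ∖ adj c₁) ∷ count (W ∖ adj c₂) ∷ count (W ∖ adj c₃) ∷ count (W ∖ adj c₄) ∷ count (W ∖ adj c₅) ∷ u ∷ [])
          (x₀ :+ (x₁ :+ (x₂ :+ (x₃ :+ x₄))) :≤ κ 5 :* x₅)
          ((κ 1 , x₀ :≤ x₅) ∷ (κ 1 , x₁ :≤ x₅) ∷ (κ 1 , x₂ :≤ x₅) ∷ (κ 1 , x₃ :≤ x₅) ∷ (κ 1 , x₄ :≤ x₅) ∷ []) refl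
          (misses c₁ (∧-elimˡ in₁) ∷ misses c₂ (∧-elimˡ in₂) ∷ misses c₃ (∧-elimˡ in₃) ∷ misses c₄ (∧-elimˡ in₄) ∷ misses c₅ (∧-elimˡ in₅) ∷ [])

        -- A vertex adjacent to the whole hub is adjacent to no two consecutive rim vertices, hence
        -- misses at least three.
        common-few : count (W ∩ M₀) + (count (W ∩ M₀) + count (W ∩ M₀)) ≤ rim-misses
        common-few = tally 8 env hyp
          ((λ w m m′ a b c d f → w ∧ m) ∷ (λ w m m′ a b c d f → w ∧ m) ∷ (λ w m m′ a b c d f → w ∧ m) ∷ []) rim-sets refl holds

        -- Pointwise: a vertex adjacent to the whole hub misses at least three rim vertices. A
        -- vertex of `rest` misses at least two hub vertices, which weighs 6, or one hub vertex and
        -- two rim vertices, which weighs at least 3 + 2. The other vertices of `W` miss a hub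
        -- vertex, which weighs 3.
        weights : count W + (count W + (count W + (count rest + count rest))) ≤
          count (W ∖ M₀) + (count (W ∖ M₀) + (count (W ∖ M₀) + (count ((W ∖ M₀) ∖ M₁) + (count ((W ∖ M₀) ∖ M₁) + (count ((W ∖ M₀) ∖ M₁) + rim-misses)))))
        weights = tally 8 env hyp
          ((λ w m m′ a b c d f → w) ∷ (λ w m m′ a b c d f → w) ∷ (λ w m m′ a b c d f → w)
            ∷ (λ w m m′ a b c d f → (w ∧ not m) ∧ not (m′ ∧ few a b c d f)) ∷ (λ w m m′ a b c d f → (w ∧ not m) ∧ not (m′ ∧ few a b c d f)) ∷ [])
          ((λ w m m′ a b c d f → w ∧ not m) ∷ (λ w m m′ a b c d f → w ∧ not m) ∷ (λ w m m′ a b c d f → w ∧ not m)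
            ∷ (λ w m m′ a b c d f → (w ∧ not m) ∧ not m′) ∷ (λ w m m′ a b c d f → (w ∧ not m) ∧ not m′) ∷ (λ w m m′ a b c d f → (w ∧ not m) ∧ not m′) ∷ rim-sets)
          refl holds

        partition : count W ≤ count (W ∩ M₀) + (count (below col k) + count rest)
        partition = tally 5 (λ v → W v ∷ M₀ v ∷ M₁ v ∷ rim-few v ∷ (col v <ᵇ k) ∷ []) (λ w m m′ r b → m′ ∧ r ⇒ b)
          ((λ w m m′ r b → w) ∷ []) ((λ w m m′ r b → w ∧ m) ∷ (λ w m m′ r b → w ∧ b) ∷ (λ w m m′ r b → (w ∧ not m) ∧ not (m′ ∧ r)) ∷ []) refl
          (λ v → ⇒-intro (λ p → true-<ᵇ (col-bound v p)))

      -- Up to terms in `e`, the worst case is |W| = (k + 3/2) u. Then at most 5u / 3 vertices see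
      -- the whole hub and at most u / 4 lie in `rest`, so the family has at least (k - 5/12) u
      -- vertices, more than the required (k - 1/2) u.
      wheel-dense : 2 * (k * u) + e < 2 * count (below col k) + u
      wheel-dense = farkas-refute
        (k ∷ u ∷ e ∷ count W ∷ count (below col k) ∷ count (W ∩ M₀) ∷ count rest ∷ count (W ∖ M₀) ∷ count ((W ∖ M₀) ∖ M₁) ∷ rim-misses ∷ [])
        (κ 1 :+ (κ 2 :* (x₀ :* x₁) :+ x₂)) (κ 2 :* x₄ :+ x₁) (κ 6)
        ((κ 12 , x₃ :≤ x₅ :+ (x₄ :+ x₆)) ∷ (κ 4 , x₅ :+ (x₅ :+ x₅) :≤ x₉) ∷ (κ 6 , x₃ :+ (x₃ :+ (x₃ :+ (x₆ :+ x₆))) :≤ x₇ :+ (x₇ :+ (x₇ :+ (x₈ :+ (x₈ :+ (x₈ :+ x₉))))))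
          ∷ (κ 18 , x₇ :+ x₈ :≤ x₀ :* x₁) ∷ (κ 10 , x₉ :≤ κ 5 :* x₁) ∷ (κ 15 , (κ 2 :* x₀ :+ κ 3) :* x₁ :≤ κ 2 :* x₃ :+ x₂) ∷ (κ 1 , κ 1 :+ κ 21 :* x₂ :≤ x₁) ∷ []) refl
        (partition ∷ common-few ∷ weights ∷ hub-misses ∷ rim-misses≤ ∷ large ∷ small ∷ [])

  -- Existence of a wheel by induction

  module WheelExistence {n : ℕ} (G : Graph n) where
    open Graph G
    open Cliques G
    open FiveWalks G
    open Wheels G

    small-class : ∀ W (col : Fin n → ℕ) m → let open Families G W in
      Σ[ j ∈ ℕ ] j < suc m × suc m * count (cls col j) ≤ count (below col (suc m))
    small-class W col m with anyUpTo? (λ j → suc m * count (Families.cls G W col j) ≤? count (Families.below G W col (suc m))) (suc m)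
    ... | yes found = found
    ... | no none   = ⊥-elim (<-irrefl refl (*-cancelˡ-≤ (suc m) (total (suc m) ≤-refl)))
      where
      open Families G W
      N = count (below col (suc m))
      total : ∀ l → l ≤ suc m → l * suc N ≤ suc m * count (below col l)
      total zero    le = z≤n
      total (suc l) le = farkas (l ∷ N ∷ suc m ∷ count (below col l) ∷ count (cls col l) ∷ count (below col (suc l)) ∷ [])
        ((κ 1 :+ x₀) :* (κ 1 :+ x₁) :≤ x₂ :* x₅)
        ((κ 1 , κ 1 :+ x₁ :≤ x₂ :* x₄) ∷ (κ 1 , x₀ :* (κ 1 :+ x₁) :≤ x₂ :* x₃) ∷ (x₂ , x₃ :+ x₄ :≤ x₅) ∷ []) refl
        (≰⇒> (λ small → none (l , le , small)) ∷ total l (≤-trans (n≤1+n l) le) ∷ ≤-reflexive (sym (below-suc col l)) ∷ [])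

    module _ (W : VSet n) {u : ℕ} (misses : MissesAtMost u W) (e k : ℕ) (large : (2 * suc k + 3) * u ≤ 2 * count W + e)
      (small : (2 * k + 3) * e < u) (x : Fin n) (x∈ : x ∈ W) (c : Colouring (W ∩ adj x) (2 + k)) where
      open Families G W

      private
        W′ : VSet n
        W′ = W ∩ adj x
        colour = proj₁ c
        j = proj₁ (small-class W′ colour (suc k))
        j<  = proj₁ (proj₂ (small-class W′ colour (suc k)))
        j-small = proj₂ (proj₂ (small-class W′ colour (suc k)))

      -- The smallest colour class `j` of the neighbourhood is left out, and the last class takes
      -- over its number, so that the remaining colours are those below k + 1.
      neighbourhood-family : Fin n → ℕ
      neighbourhood-family v =
        if W′ v then (if colour v ≡ᵇ j then suc k else if colour v ≡ᵇ suc k then j else colour v) else suc k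

      private
        col = neighbourhood-family

        data View (v : Fin n) : Set where
          moved  : v ∈ W′ → colour v ≢ j → colour v ≡ suc k → col v ≡ j → View v
          kept   : v ∈ W′ → colour v ≢ j → colour v ≢ suc k → col v ≡ colour v → View v
          absent : ¬ (v ∈ W′ × colour v ≢ j) → col v ≡ suc k → View v

        ≢-from : ∀ {a b} → (a ≡ᵇ b) ≡ false → a ≢ b
        ≢-from {a} eq refl = case trans (sym eq) (==-refl a) of λ ()

        view : ∀ v → View v
        view v with W′ v in w | colour v ≡ᵇ j in cj | colour v ≡ᵇ suc k in ck
        ... | false | _     | _     = absent (λ p → case trans (sym w) (proj₁ p) of λ ()) (eq w)
          where
          eq : W′ v ≡ false → col v ≡ suc k
          eq p rewrite p = refl
        ... | true  | true  | _     = absent (λ p → proj₂ p (==-sound (colour v) j cj)) (eq w cj)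
          where
          eq : W′ v ≡ true → (colour v ≡ᵇ j) ≡ true → col v ≡ suc k
          eq p q rewrite p | q = refl
        ... | true  | false | true  = moved w (≢-from cj) (==-sound (colour v) (suc k) ck) (eq w cj ck)
          where
          eq : W′ v ≡ true → (colour v ≡ᵇ j) ≡ false → (colour v ≡ᵇ suc k) ≡ true → col v ≡ j
          eq p q r rewrite p | q | r = refl
        ... | true  | false | false = kept w (≢-from cj) (≢-from ck) (eq w cj ck)
          where
          eq : W′ v ≡ true → (colour v ≡ᵇ j) ≡ false → (colour v ≡ᵇ suc k) ≡ false → col v ≡ colour v
          eq p q r rewrite p | q | r = refl

      neighbourhood-proper : Proper col (suc k)
      neighbourhood-proper v w v∈ w∈ vw same lt with view v | view w
      ... | absent _ eq   | _             = <-irrefl eq lt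
      ... | _             | absent _ eq   = <-irrefl eq (subst (_< suc k) same lt)
      ... | moved p _ a _ | moved q _ b _ = proj₂ (proj₂ c) v w p q vw (trans a (sym b))
      ... | kept p _ _ a  | kept q _ _ b  = proj₂ (proj₂ c) v w p q vw (trans (sym a) (trans same b))
      ... | moved _ _ _ a | kept _ b _ d  = b (trans (sym d) (trans (sym same) a))
      ... | kept _ b _ d  | moved _ _ _ a = b (trans (sym d) (trans same a))

      -- The neighbourhood has about (k + 3/2) u vertices or more, and at most the fraction 1 / (k +
      -- 2) of it is left out. What remains exceeds (k + 1/2) u by about u / (2k + 4), which absorbs
      -- the terms in `e`.
      neighbourhood-dense : 2 * (suc k * u) + e < 2 * count (below col (suc k)) + u
      neighbourhood-dense = farkas-refute
        (k ∷ u ∷ e ∷ count W ∷ count W′ ∷ count (below col (suc k)) ∷ count (Families.cls G W′ colour j) ∷ count (Families.below G W′ colour (2 + k)) ∷ [])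
        (κ 1 :+ (κ 2 :* ((κ 1 :+ x₀) :* x₁) :+ x₂)) (κ 2 :* x₅ :+ x₁) (κ 2 :+ x₀)
        ((κ 2 , (κ 2 :+ x₀) :* x₆ :≤ x₇) ∷ (κ 2 , x₇ :≤ x₄) ∷ (κ 2 :* (κ 2 :+ x₀) , x₄ :≤ x₅ :+ x₆) ∷ (κ 2 :* (κ 1 :+ x₀) , x₃ :≤ x₄ :+ x₁)
          ∷ (κ 1 :+ x₀ , (κ 2 :* (κ 1 :+ x₀) :+ κ 3) :* x₁ :≤ κ 2 :* x₃ :+ x₂) ∷ (κ 1 , κ 1 :+ ((κ 2 :* x₀ :+ κ 3) :* x₂) :≤ x₁) ∷ []) refl
        (j-small ∷ count-mono (λ v p → ∧-elimˡ {W′ v} p) ∷ split ∷ ≤-trans (≤-reflexive (count-∩∖ W (adj x))) (+-monoʳ-≤ (count W′) (misses x x∈)) ∷ large ∷ small ∷ [])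
        where
        split : count W′ ≤ count (below col (suc k)) + count (Families.cls G W′ colour j)
        split = tally 4 (λ v → W v ∷ adj x v ∷ (col v <ᵇ suc k) ∷ (colour v ≡ᵇ j) ∷ []) (λ w a b c → ((w ∧ a) ∧ not c) ⇒ b)
          ((λ w a b c → w ∧ a) ∷ []) ((λ w a b c → w ∧ b) ∷ (λ w a b c → (w ∧ a) ∧ c) ∷ []) refl
          (λ v → ⇒-intro (λ p → true-<ᵇ (placed v (∧-elimˡ p) (λ eq → not-elim (∧-elimʳ {W v ∧ adj x v} p) (trans (cong (_≡ᵇ j) eq) (==-refl j))))))
          where
          placed : ∀ v → v ∈ W′ → colour v ≢ j → col v < suc k
          placed v w ≢j with view v
          ... | absent gone _      = ⊥-elim (gone (w , ≢j))
          ... | moved _ ≢j last eq = subst (_< suc k) (sym eq) (≤∧≢⇒< (s≤s⁻¹ j<) (λ eq′ → ≢j (trans last (sym eq′))))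
          ... | kept _ _ ≢last eq  = subst (_< suc k) (sym eq) (≤∧≢⇒< (s≤s⁻¹ (proj₁ (proj₂ c) v w)) ≢last)

    optimal-family : ∀ W k col → Families.Proper G W col k →
      (∀ best → Families.Proper G W best k → (∀ col′ → Families.Proper G W col′ k → count (Families.below G W col′ k) ≤ count (Families.below G W best k)) → ⊥) → ⊥
    optimal-family W k col proper = maximise (λ c → Families.Proper G W c k) (λ c → count (Families.below G W c k)) n
      (λ c _ → count≤n (Families.below G W c k)) col proper

    -- For k + 1: if the neighbourhood of `x` is not (k + 2)-colourable, it contains a wheel by
    -- induction, and `x` joins the hub. Otherwise all its colour classes but the smallest form a
    -- family dense enough for `FamilyWheel`.
    wheel-exists : ∀ k W {u e} → MissesAtMost u W → ¬ Clique W (3 + k) → (2 * k + 3) * u ≤ 2 * count W + e →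
      30 * (suc k * e) < u → ¬ Colouring W (2 + k) → (Wheel W k → ⊥) → ⊥
    wheel-exists zero W {u} {e} misses free large small no-colouring no-wheel = no-colouring (bipartite
      (λ x y z x∈ y∈ z∈ xy xz yz → free (cons x x∈ (cons y (∧-intro y∈ xy) (cons z (∧-intro (∧-intro z∈ xz) yz) nil))))
      misses large (farkas (u ∷ e ∷ []) (κ 1 :+ κ 6 :* x₁ :≤ x₀) ((κ 1 , κ 1 :+ κ 30 :* ((κ 1 :+ κ 0) :* x₁) :≤ x₀) ∷ []) refl (small ∷ []))
      (λ c → no-wheel (wheel nil (walk-mono (λ v p → ∧-intro p refl) c))))
    wheel-exists (suc k) W {u} {e} misses free large small no-colouring no-wheel with search W
    ... | inj₂ none = no-colouring ((λ _ → 0) , (λ v p → ⊥-elim (none v p)) , λ v w p → ⊥-elim (none v p))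
    ... | inj₁ (x , x∈) = wheel-exists k (W ∩ adj x) (misses-mono W′⊆W misses) (free ∘ cons x x∈) large′
        (farkas (k ∷ u ∷ e ∷ []) (κ 1 :+ κ 30 :* ((κ 1 :+ x₀) :* x₂) :≤ x₁) ((κ 1 , κ 1 :+ κ 30 :* ((κ 2 :+ x₀) :* x₂) :≤ x₁) ∷ []) refl (small ∷ []))
        neighbourhood-colouring
        (λ { (wheel K c) → no-wheel (wheel (cons x x∈ K) (walk-mono (λ v p → let wx , m = ∧-elim {(W ∩ adj x) v} p ; w , xv = ∧-elim {W v} wx in ∧-intro w (∧-intro xv m)) c)) })
      where
      W′⊆W : W ∩ adj x ⊆ W
      W′⊆W v p = ∧-elimˡ p

      large′ : (2 * k + 3) * u ≤ 2 * count (W ∩ adj x) + e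
      large′ = farkas (k ∷ u ∷ e ∷ count W ∷ count (W ∩ adj x) ∷ count (W ∖ adj x) ∷ []) ((κ 2 :* x₀ :+ κ 3) :* x₁ :≤ κ 2 :* x₄ :+ x₂)
        ((κ 1 , (κ 2 :* (κ 1 :+ x₀) :+ κ 3) :* x₁ :≤ κ 2 :* x₃ :+ x₂) ∷ (κ 2 , x₃ :≤ x₄ :+ x₅) ∷ (κ 2 , x₅ :≤ x₁) ∷ []) refl
        (large ∷ ≤-reflexive (count-∩∖ W (adj x)) ∷ misses x x∈ ∷ [])

      neighbourhood-colouring : ¬ Colouring (W ∩ adj x) (2 + k)
      neighbourhood-colouring c = optimal-family W (suc k) (neighbourhood-family W misses e k large small₁ x x∈ c) (neighbourhood-proper W misses e k large small₁ x x∈ c)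
        (λ best proper optimal → FamilyWheel.family-wheel G W misses e (suc k) free large small₂ best proper
          (<-≤-trans (neighbourhood-dense W misses e k large small₁ x x∈ c)
            (+-monoˡ-≤ u (*-monoʳ-≤ 2 (optimal _ (neighbourhood-proper W misses e k large small₁ x x∈ c))))) optimal no-colouring no-wheel)
        where
        small₁ : (2 * k + 3) * e < u
        small₁ = farkas (k ∷ u ∷ e ∷ []) (κ 1 :+ (κ 2 :* x₀ :+ κ 3) :* x₂ :≤ x₁) ((κ 1 , κ 1 :+ κ 30 :* ((κ 2 :+ x₀) :* x₂) :≤ x₁) ∷ []) refl (small ∷ [])
        small₂ : 2 * suc k * e + 7 * e < u
        small₂ = farkas (k ∷ u ∷ e ∷ []) (κ 1 :+ (κ 2 :* (κ 1 :+ x₀) :* x₂ :+ κ 7 :* x₂) :≤ x₁) ((κ 1 , κ 1 :+ κ 30 :* ((κ 2 :+ x₀) :* x₂) :≤ x₁) ∷ []) refl (small ∷ [])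

  -- Second moments

  sq : ℤ → ℕ
  sq z = ℤ.∣ z ∣ * ℤ.∣ z ∣

  ι : Bool → ℤ
  ι b = + ⟦ b ⟧

  pos-sq : ∀ z → + sq z ≡ z ℤ.* z
  pos-sq (+ m)    = ℤP.pos-* m m
  pos-sq -[1+ m ] = refl

  pos-sum : ∀ {n} (f : Fin n → ℕ) → + sum f ≡ sumℤ (λ v → + f v)
  pos-sum {zero}  f = refl
  pos-sum {suc n} f = trans (ℤP.pos-+ (f zero) (sum (f ∘ suc))) (cong (ℤ._+_ (+ f zero)) (pos-sum (f ∘ suc)))

  ∑-zero : ∀ {n} (f : Fin n → ℕ) → (∀ v → f v ≡ 0) → sum f ≡ 0
  ∑-zero {zero}  f zeros = refl
  ∑-zero {suc n} f zeros = cong₂ _+_ (zeros zero) (∑-zero (f ∘ suc) (zeros ∘ suc))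

  sumℤ-zero : ∀ {n} (f : Fin n → ℤ) → (∀ v → f v ≡ + 0) → sumℤ f ≡ + 0
  sumℤ-zero {zero}  f zeros = refl
  sumℤ-zero {suc n} f zeros = cong₂ ℤ._+_ (zeros zero) (sumℤ-zero (f ∘ suc) (zeros ∘ suc))

  opaque
    sq-+ : ∀ p q → sq (p ℤ.+ q) ≤ 2 * sq p + 2 * sq q
    sq-+ p q = ≤-trans (*-mono-≤ (ℤP.∣i+j∣≤∣i∣+∣j∣ p q) (ℤP.∣i+j∣≤∣i∣+∣j∣ p q)) (square ℤ.∣ p ∣ ℤ.∣ q ∣)
      where
      ordered : ∀ a d → (a + (a + d)) * (a + (a + d)) ≤ 2 * (a * a) + 2 * ((a + d) * (a + d))
      ordered a d = farkas (a ∷ d ∷ []) ((x₀ :+ (x₀ :+ x₁)) :* (x₀ :+ (x₀ :+ x₁)) :≤ κ 2 :* (x₀ :* x₀) :+ κ 2 :* ((x₀ :+ x₁) :* (x₀ :+ x₁))) [] refl []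
      square : ∀ a b → (a + b) * (a + b) ≤ 2 * (a * a) + 2 * (b * b)
      square a b with ≤-total a b
      ... | inj₁ a≤b = subst (λ b → (a + b) * (a + b) ≤ 2 * (a * a) + 2 * (b * b)) (m+[n∸m]≡n a≤b) (ordered a (b ∸ a))
      ... | inj₂ b≤a = subst₂ _≤_ (cong₂ _*_ (+-comm b a) (+-comm b a)) (+-comm (2 * (b * b)) (2 * (a * a)))
        (subst (λ a → (b + a) * (b + a) ≤ 2 * (b * b) + 2 * (a * a)) (m+[n∸m]≡n b≤a) (ordered b (a ∸ b)))

    sq-neg : ∀ p → sq (ℤ.- p) ≡ sq p
    sq-neg p = cong₂ _*_ (ℤP.∣-i∣≡∣i∣ p) (ℤP.∣-i∣≡∣i∣ p)

    sq-scale : ∀ a p → sq (+ a ℤ.* p) ≡ a * a * sq p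
    sq-scale a p = trans (cong₂ _*_ (ℤP.abs-* (+ a) p) (ℤP.abs-* (+ a) p))
      (≤-antisym (farkas (a ∷ ℤ.∣ p ∣ ∷ []) (x₀ :* x₁ :* (x₀ :* x₁) :≤ x₀ :* x₀ :* (x₁ :* x₁)) [] refl [])
                 (farkas (a ∷ ℤ.∣ p ∣ ∷ []) (x₀ :* x₀ :* (x₁ :* x₁) :≤ x₀ :* x₁ :* (x₀ :* x₁)) [] refl []))

    sq-− : ∀ p q → sq (p ℤ.- q) ≤ 2 * sq p + 2 * sq q
    sq-− p q = subst (λ s → sq (p ℤ.- q) ≤ 2 * sq p + 2 * s) (sq-neg q) (sq-+ p (ℤ.- q))

  module _ {n : ℕ} (W : VSet n) where

    private
      expand : ∀ i h b → i ℤ.* ((h ℤ.+ b) ℤ.* (h ℤ.+ b)) ≡ (h ℤ.* h) ℤ.* i ℤ.+ ((h ℤ.+ h) ℤ.* (i ℤ.* b) ℤ.+ i ℤ.* (b ℤ.* b))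
      expand = ℤRing.solve-∀

      pos-weighted : (f : Fin n → ℤ) → + sum (λ v → ⟦ W v ⟧ * sq (f v)) ≡ sumℤ (λ v → ι (W v) ℤ.* (f v ℤ.* f v))
      pos-weighted f = trans (pos-sum (λ v → ⟦ W v ⟧ * sq (f v)))
        (sumℤ-cong (λ v → trans (ℤP.pos-* ⟦ W v ⟧ (sq (f v))) (cong (ι (W v) ℤ.*_) (pos-sq (f v)))))

    opaque
      -- The mixed term is 2h times the sum of `b` over `W`, which vanishes.
      variance : ∀ h (b : Fin n → ℤ) → sumℤ (λ v → ι (W v) ℤ.* b v) ≡ + 0 →
        sum (λ v → ⟦ W v ⟧ * sq (h ℤ.+ b v)) ≡ count W * sq h + sum (λ v → ⟦ W v ⟧ * sq (b v))
      variance h b centred = ℤP.+-injective (begin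
        + sum (λ v → ⟦ W v ⟧ * sq (h ℤ.+ b v))
          ≡⟨ pos-weighted (λ v → h ℤ.+ b v) ⟩
        sumℤ (λ v → ι (W v) ℤ.* ((h ℤ.+ b v) ℤ.* (h ℤ.+ b v)))
          ≡⟨ sumℤ-cong (λ v → expand (ι (W v)) h (b v)) ⟩
        sumℤ (λ v → (h ℤ.* h) ℤ.* ι (W v) ℤ.+ ((h ℤ.+ h) ℤ.* (ι (W v) ℤ.* b v) ℤ.+ ι (W v) ℤ.* (b v ℤ.* b v)))
          ≡⟨ ∑ℤ-distrib-+ (λ v → (h ℤ.* h) ℤ.* ι (W v)) (λ v → (h ℤ.+ h) ℤ.* (ι (W v) ℤ.* b v) ℤ.+ ι (W v) ℤ.* (b v ℤ.* b v)) ⟩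
        sumℤ (λ v → (h ℤ.* h) ℤ.* ι (W v)) ℤ.+ sumℤ (λ v → (h ℤ.+ h) ℤ.* (ι (W v) ℤ.* b v) ℤ.+ ι (W v) ℤ.* (b v ℤ.* b v))
          ≡⟨ cong₂ ℤ._+_ (sym (*-distribˡ-sumℤ (h ℤ.* h) (ι ∘ W)))
               (∑ℤ-distrib-+ (λ v → (h ℤ.+ h) ℤ.* (ι (W v) ℤ.* b v)) (λ v → ι (W v) ℤ.* (b v ℤ.* b v))) ⟩
        (h ℤ.* h) ℤ.* sumℤ (ι ∘ W) ℤ.+ (sumℤ (λ v → (h ℤ.+ h) ℤ.* (ι (W v) ℤ.* b v)) ℤ.+ sumℤ (λ v → ι (W v) ℤ.* (b v ℤ.* b v)))
          ≡⟨ cong₂ (λ s t → (h ℤ.* h) ℤ.* s ℤ.+ (t ℤ.+ sumℤ (λ v → ι (W v) ℤ.* (b v ℤ.* b v)))) (sym (pos-sum (λ v → ⟦ W v ⟧)))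
               (trans (sym (*-distribˡ-sumℤ (h ℤ.+ h) (λ v → ι (W v) ℤ.* b v))) (trans (cong ((h ℤ.+ h) ℤ.*_) centred) (ℤP.*-zeroʳ (h ℤ.+ h)))) ⟩
        (h ℤ.* h) ℤ.* + count W ℤ.+ (+ 0 ℤ.+ sumℤ (λ v → ι (W v) ℤ.* (b v ℤ.* b v)))
          ≡⟨ cong₂ ℤ._+_ (trans (cong (ℤ._* + count W) (sym (pos-sq h))) (trans (ℤP.*-comm (+ sq h) (+ count W)) (sym (ℤP.pos-* (count W) (sq h)))))
               (trans (ℤP.+-identityˡ _) (sym (pos-weighted b))) ⟩
        + (count W * sq h) ℤ.+ + sum (λ v → ⟦ W v ⟧ * sq (b v))
          ≡⟨ ℤP.pos-+ (count W * sq h) (sum (λ v → ⟦ W v ⟧ * sq (b v))) ⟨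
        + (count W * sq h + sum (λ v → ⟦ W v ⟧ * sq (b v))) ∎)
        where open ≡-Reasoning

    -- For `X` supported on `W` this is the mean of `X` over `W` minus `X y`, multiplied by |W| to
    -- remain an integer.
    deviation : (Fin n → ℤ) → Fin n → ℤ
    deviation X y = sumℤ X ℤ.- + count W ℤ.* X y

    opaque
      deviation-centred : ∀ X → (∀ v → ι (W v) ℤ.* X v ≡ X v) → sumℤ (λ v → ι (W v) ℤ.* deviation X v) ≡ + 0
      deviation-centred X supported = begin
        sumℤ (λ v → ι (W v) ℤ.* deviation X v)
          ≡⟨ sumℤ-cong (λ v → rearrange (ι (W v)) (sumℤ X) (+ count W) (X v)) ⟩
        sumℤ (λ v → sumℤ X ℤ.* ι (W v) ℤ.+ (ℤ.- + count W) ℤ.* (ι (W v) ℤ.* X v))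
          ≡⟨ ∑ℤ-distrib-+ (λ v → sumℤ X ℤ.* ι (W v)) (λ v → (ℤ.- + count W) ℤ.* (ι (W v) ℤ.* X v)) ⟩
        sumℤ (λ v → sumℤ X ℤ.* ι (W v)) ℤ.+ sumℤ (λ v → (ℤ.- + count W) ℤ.* (ι (W v) ℤ.* X v))
          ≡⟨ cong₂ ℤ._+_ (trans (sym (*-distribˡ-sumℤ (sumℤ X) (ι ∘ W))) (cong (sumℤ X ℤ.*_) (sym (pos-sum (λ v → ⟦ W v ⟧)))))
               (trans (sym (*-distribˡ-sumℤ (ℤ.- + count W) (λ v → ι (W v) ℤ.* X v))) (cong ((ℤ.- + count W) ℤ.*_) (sumℤ-cong supported))) ⟩
        sumℤ X ℤ.* + count W ℤ.+ (ℤ.- + count W) ℤ.* sumℤ X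
          ≡⟨ cancel (sumℤ X) (+ count W) ⟩
        + 0 ∎
        where
        open ≡-Reasoning
        rearrange : ∀ i s a x → i ℤ.* (s ℤ.- a ℤ.* x) ≡ s ℤ.* i ℤ.+ (ℤ.- a) ℤ.* (i ℤ.* x)
        rearrange = ℤRing.solve-∀
        cancel : ∀ s a → s ℤ.* a ℤ.+ (ℤ.- a) ℤ.* s ≡ + 0
        cancel = ℤRing.solve-∀

      -- Shifting the deviation by minus the sum of `X` gives -|W| `X`, so by `variance` the centred
      -- second moment is at most the uncentred one.
      deviation-size : ∀ X → (∀ v → ι (W v) ℤ.* X v ≡ X v) →
        sum (λ v → ⟦ W v ⟧ * sq (deviation X v)) ≤ count W * count W * sum (λ v → ⟦ W v ⟧ * sq (X v))
      deviation-size X supported = begin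
        sum (λ v → ⟦ W v ⟧ * sq (deviation X v))
          ≤⟨ m≤n+m _ (count W * sq (ℤ.- sumℤ X)) ⟩
        count W * sq (ℤ.- sumℤ X) + sum (λ v → ⟦ W v ⟧ * sq (deviation X v))
          ≡⟨ variance (ℤ.- sumℤ X) (deviation X) (deviation-centred X supported) ⟨
        sum (λ v → ⟦ W v ⟧ * sq (ℤ.- sumℤ X ℤ.+ deviation X v))
          ≡⟨ sum-cong-≗ (λ v → cong (⟦ W v ⟧ *_) (trans (cong sq (cancel (sumℤ X) (+ count W ℤ.* X v))) (trans (sq-neg (+ count W ℤ.* X v)) (sq-scale (count W) (X v))))) ⟩
        sum (λ v → ⟦ W v ⟧ * (count W * count W * sq (X v)))
          ≡⟨ sum-cong-≗ (λ v → trans (sym (*-assoc ⟦ W v ⟧ (count W * count W) (sq (X v)))) (trans (cong (_* sq (X v)) (*-comm ⟦ W v ⟧ (count W * count W))) (*-assoc (count W * count W) ⟦ W v ⟧ (sq (X v))))) ⟩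
        sum (λ v → count W * count W * (⟦ W v ⟧ * sq (X v)))
          ≡⟨ *-distribˡ-sum (count W * count W) (λ v → ⟦ W v ⟧ * sq (X v)) ⟨
        count W * count W * sum (λ v → ⟦ W v ⟧ * sq (X v)) ∎
        where
        open ≤-Reasoning
        cancel : ∀ s t → ℤ.- s ℤ.+ (s ℤ.- t) ≡ ℤ.- t
        cancel = ℤRing.solve-∀

      average : ∀ (f : Fin n → ℕ) → 0 < count W → Σ[ y ∈ Fin n ] (y ∈ W × count W * f y ≤ sum (λ v → ⟦ W v ⟧ * f v))
      average f positive with search (λ y → W y ∧ leq (count W * f y) (sum (λ v → ⟦ W v ⟧ * f v)))
      ... | inj₁ (y , p) = y , ∧-elimˡ p , leq-sound (∧-elimʳ {W y} p)
      ... | inj₂ none = ⊥-elim (<-irrefl refl (begin-strict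
        count W * total                                          <⟨ *-monoʳ-< (count W) {{>-nonZero positive}} (n<1+n total) ⟩
        count W * suc total                                      ≡⟨ *-comm (count W) (suc total) ⟩
        suc total * count W                                      ≡⟨ *-distribˡ-sum (suc total) (λ v → ⟦ W v ⟧) ⟩
        sum (λ v → suc total * ⟦ W v ⟧)                          ≤⟨ ∑-mono (λ v → large v (W v) refl) ⟩
        sum (λ v → count W * (⟦ W v ⟧ * f v))                    ≡⟨ *-distribˡ-sum (count W) (λ v → ⟦ W v ⟧ * f v) ⟨
        count W * total ∎))
        where
        open ≤-Reasoning
        total : ℕ
        total = sum (λ v → ⟦ W v ⟧ * f v)
        large : ∀ v w → W v ≡ w → suc total * ⟦ w ⟧ ≤ count W * (⟦ w ⟧ * f v)
        large v false _ = subst (_≤ count W * 0) (sym (*-zeroʳ (suc total))) z≤n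
        large v true  p = subst₂ _≤_ (sym (*-identityʳ (suc total))) (cong (count W *_) (sym (+-identityʳ (f v))))
          (≰⇒> (λ le → none v (∧-intro p (leq-complete le))))

  distinct-traces : ∀ m {k} (S : VSet k) (trace : Fin k → Vec Bool m) →
    (∀ i j → i ∈ S → j ∈ S → trace i ≡ trace j → i ≡ j) → count S ≤ 2 ^ m
  distinct-traces zero S trace inj with search S
  ... | inj₂ none = subst (_≤ 1) (sym (count-empty none)) z≤n
  ... | inj₁ (i , i∈S) = ≤-trans (count-mono {B = λ j → does (j FinP.≟ i)} (λ j j∈S → true-dec (j FinP.≟ i) (inj j i j∈S i∈S (empty (trace j) (trace i))))) (singleton i)
    where
    empty : ∀ (xs ys : Vec Bool 0) → xs ≡ ys
    empty [] [] = refl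
    singleton : ∀ {l} (x : Fin l) → count (λ v → does (v FinP.≟ x)) ≤ 1
    singleton {suc l} zero = s≤s (≤-reflexive (count-empty {l} {A = λ v → does (suc v FinP.≟ zero)} (λ v ())))
    singleton (suc x) = singleton x
  distinct-traces (suc m) S trace inj = begin
    count S                                         ≡⟨ count-∩∖ S (Vec.head ∘ trace) ⟩
    count (S ∩ (Vec.head ∘ trace)) + count (S ∖ (Vec.head ∘ trace))
      ≤⟨ +-mono-≤ (distinct-traces m (S ∩ (Vec.head ∘ trace)) (Vec.tail ∘ trace) (λ i j p q eq →
                     inj i j (∧-elimˡ p) (∧-elimˡ q) (rebuild (trace i) (trace j) (trans (∧-elimʳ {S i} p) (sym (∧-elimʳ {S j} q))) eq)))
                  (distinct-traces m (S ∖ (Vec.head ∘ trace)) (Vec.tail ∘ trace) (λ i j p q eq →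
                     inj i j (∧-elimˡ p) (∧-elimˡ q) (rebuild (trace i) (trace j) (not-injective (trans (∧-elimʳ {S i} p) (sym (∧-elimʳ {S j} q)))) eq))) ⟩
    2 ^ m + 2 ^ m                                   ≡⟨ cong (_+_ (2 ^ m)) (+-identityʳ (2 ^ m)) ⟨
    2 ^ suc m ∎
    where
    open ≤-Reasoning
    not-injective : ∀ {a b} → not a ≡ not b → a ≡ b
    not-injective {true}  {true}  _ = refl
    not-injective {false} {false} _ = refl
    rebuild : ∀ {l} (xs ys : Vec Bool (suc l)) → Vec.head xs ≡ Vec.head ys → Vec.tail xs ≡ Vec.tail ys → xs ≡ ys
    rebuild (x ∷ xs) (y ∷ ys) refl refl = refl

  private
    -- Two errors of at most m² c / 2400 bound the distance by 4c / 2400 = c / 600.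
    far-traces : ∀ m c d f f′ → 1280 ≤ m → c < 600 * d → m * m * d ≤ 2 * f + 2 * f′ → 2400 * f ≤ m * m * c → 2400 * f′ ≤ m * m * c → ⊥
    far-traces m c d f f′ enough far close good good′ = impossible (c ∷ f ∷ f′ ∷ d ∷ m ∷ [])
      ((κ 2 :* x₄ :* x₄ , κ 1 :+ x₀ :≤ κ 600 :* x₃) ∷ (x₄ , κ 1280 :≤ x₄) ∷ (κ 1280 , κ 1280 :≤ x₄) ∷ (κ 1200 , x₄ :* x₄ :* x₃ :≤ κ 2 :* x₁ :+ κ 2 :* x₂)
        ∷ (κ 1 , κ 2400 :* x₁ :≤ x₄ :* x₄ :* x₀) ∷ (κ 1 , κ 2400 :* x₂ :≤ x₄ :* x₄ :* x₀) ∷ []) refl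
      (far ∷ enough ∷ enough ∷ close ∷ good ∷ good′ ∷ [])

    -- By Markov's inequality the bad part is at most 1200 k / m. For m ≥ 1280 this is at most 15k /
    -- 16, so at least a sixteenth is good.
    few-bad : ∀ m c k g b q → 1280 ≤ m → k ≤ g + b → b * (m * m * c) ≤ 2400 * q → 2 * q ≤ m * (k * c) → 80 * (m * c) * k ≤ 80 * (m * c) * (16 * g)
    few-bad m c k g b q enough total heavy light = farkas (c ∷ k ∷ g ∷ b ∷ q ∷ m ∷ []) (κ 80 :* (x₅ :* x₀) :* x₁ :≤ κ 80 :* (x₅ :* x₀) :* (κ 16 :* x₂))
      ((κ 1280 :* x₅ :* x₀ , x₁ :≤ x₂ :+ x₃) ∷ (x₃ :* x₅ :* x₀ , κ 1280 :≤ x₅) ∷ (κ 1 , x₃ :* (x₅ :* x₅ :* x₀) :≤ κ 2400 :* x₄) ∷ (κ 1200 , κ 2 :* x₄ :≤ x₅ :* (x₁ :* x₀)) ∷ []) refl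
      (total ∷ enough ∷ heavy ∷ light ∷ [])

  -- Sampling neighbourhoods

  module Sampling {n : ℕ} (G : Graph n) (W : VSet n) where
    open Graph G
    open Cliques G
    open FiveWalks G

    deg : Fin n → ℕ
    deg x = count (W ∩ adj x)

    codeg : Fin n → Fin n → ℕ
    codeg x w = count ((W ∩ adj x) ∩ adj w)

    -- The signed sum over y ∈ N(x) of +1 or -1 according to whether y ∈ N(w): it equals 2 codeg - deg,
    -- and its summands have a smaller second moment than the indicators summed by codeg.
    X : Fin n → Fin n → Fin n → ℤ
    X x w y = + (2 * ⟦ ((W ∩ adj x) ∩ adj w) y ⟧) ℤ.- + ⟦ (W ∩ adj x) y ⟧

    β : Fin n → Fin n → ℤ
    β x w = sumℤ (X x w)

    dist : Fin n → Fin n → ℕ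
    dist x x′ = sum (λ w → ⟦ W w ⟧ * sq (β x w ℤ.- β x′ w))

    b : Fin n → Fin n → Fin n → ℤ
    b x w y = if W w then deviation W (X x w) y else + 0

    -- For `w` in `W` this is m `β x w` minus |W| times the sum of `X x w` over the m samples: the
    -- error of the sampled estimate of `β x w`, scaled to be an integer.
    H : ∀ {m} → Vec (Fin n) m → Fin n → Fin n → ℤ
    H []       x w = + 0
    H (y ∷ ys) x w = H ys x w ℤ.+ b x w y

    F : ∀ {m} → Vec (Fin n) m → Fin n → ℕ
    F ys x = sum (λ w → sq (H ys x w))

    Q : ∀ {m k} → Vec (Fin n) m → (Fin k → Fin n) → ℕ
    Q ys xs = sum (λ i → F ys (xs i))

    private
      a : ℕ
      a = count W

      a³ : ℕ
      a³ = a * a * a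

      X-supported : ∀ x w v → ι (W v) ℤ.* X x w v ≡ X x w v
      X-supported x w v with W v
      ... | true  = ℤP.*-identityˡ _
      ... | false = refl

      X-size : ∀ x w v → ⟦ W v ⟧ * sq (X x w v) ≡ ⟦ (W ∩ adj x) v ⟧
      X-size x w v with W v | adj x v | adj w v
      ... | true  | true  | true  = refl
      ... | true  | true  | false = refl
      ... | true  | false | true  = refl
      ... | true  | false | false = refl
      ... | false | _     | _     = refl

    opaque
      β-codeg : ∀ x w → β x w ≡ + (2 * codeg x w) ℤ.- + deg x
      β-codeg x w = begin
        sumℤ (λ y → + (2 * ⟦ C y ⟧) ℤ.+ ℤ.- (+ ⟦ D y ⟧))
          ≡⟨ ∑ℤ-distrib-+ (λ y → + (2 * ⟦ C y ⟧)) (λ y → ℤ.- (+ ⟦ D y ⟧)) ⟩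
        sumℤ (λ y → + (2 * ⟦ C y ⟧)) ℤ.+ sumℤ (λ y → ℤ.- (+ ⟦ D y ⟧))
          ≡⟨ cong₂ ℤ._+_ (trans (sym (pos-sum (λ y → 2 * ⟦ C y ⟧))) (cong (λ s → + s) (sym (*-distribˡ-sum 2 (λ y → ⟦ C y ⟧)))))
               (trans (sumℤ-cong (λ y → sym (ℤP.-1*i≡-i (+ ⟦ D y ⟧)))) (trans (sym (*-distribˡ-sumℤ (ℤ.- (+ 1)) (λ y → + ⟦ D y ⟧)))
                 (trans (ℤP.-1*i≡-i _) (cong ℤ.-_ (sym (pos-sum (λ y → ⟦ D y ⟧))))))) ⟩
        + (2 * codeg x w) ℤ.- + deg x ∎
        where
        open ≡-Reasoning
        C D : VSet n
        C = (W ∩ adj x) ∩ adj w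
        D = W ∩ adj x

      b-centred : ∀ x w → sumℤ (λ y → ι (W y) ℤ.* b x w y) ≡ + 0
      b-centred x w with W w
      ... | true  = deviation-centred W (X x w) (X-supported x w)
      ... | false = sumℤ-zero (λ y → ι (W y) ℤ.* + 0) (λ y → ℤP.*-zeroʳ (ι (W y)))

      -- `X x w` is 1 or -1 on the neighbours of `x` in `W` and 0 elsewhere, so its second moment is
      -- `deg x`, at most half of |W|.
      b-size : ∀ x w → 2 * deg x ≤ a → 2 * sum (λ y → ⟦ W y ⟧ * sq (b x w y)) ≤ ⟦ W w ⟧ * a³
      b-size x w light with W w
      ... | false = ≤-reflexive (cong (2 *_) (∑-zero (λ y → ⟦ W y ⟧ * 0) (λ y → *-zeroʳ ⟦ W y ⟧)))
      ... | true  = farkas (a ∷ deg x ∷ sum (λ y → ⟦ W y ⟧ * sq (deviation W (X x w) y)) ∷ [])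
        (κ 2 :* x₂ :≤ κ 1 :* (x₀ :* x₀ :* x₀))
        ((κ 2 , x₂ :≤ x₀ :* x₀ :* x₁) ∷ (x₀ :* x₀ , κ 2 :* x₁ :≤ x₀) ∷ []) refl
        (subst (λ s → sum (λ y → ⟦ W y ⟧ * sq (deviation W (X x w) y)) ≤ a * a * s) (sum-cong-≗ (X-size x w)) (deviation-size W (X x w) (X-supported x w)) ∷ light ∷ [])

      -- The second moments add up along independent samples, so some choice is at most the average.
      next-sample : ∀ {m k} (ys : Vec (Fin n) m) (xs : Fin k → Fin n) → 0 < a → (∀ i → 2 * deg (xs i) ≤ a) →
        Σ[ y ∈ Fin n ] 2 * Q (y ∷ ys) xs ≤ 2 * Q ys xs + k * a³
      next-sample {m} {k} ys xs positive light with y , y∈ , le ← average W (λ y → Q (y ∷ ys) xs) positive =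
        y , *-cancelˡ-≤ a {{>-nonZero positive}} (farkas (a ∷ Q (y ∷ ys) xs ∷ Q ys xs ∷ k ∷ total ∷ spread ∷ [])
          (x₀ :* (κ 2 :* x₁) :≤ x₀ :* (κ 2 :* x₂ :+ x₃ :* (x₀ :* x₀ :* x₀)))
          ((κ 2 , x₀ :* x₁ :≤ x₄) ∷ (κ 2 , x₄ :≤ x₀ :* x₂ :+ x₅) ∷ (κ 1 , κ 2 :* x₅ :≤ x₃ :* (x₀ :* (x₀ :* x₀ :* x₀))) ∷ []) refl
          (le ∷ ≤-reflexive exchange ∷ spread≤ ∷ []))
        where
        total spread : ℕ
        total  = sum (λ y → ⟦ W y ⟧ * Q (y ∷ ys) xs)
        spread = sum (λ i → sum (λ w → sum (λ y → ⟦ W y ⟧ * sq (b (xs i) w y))))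

        exchange : total ≡ a * Q ys xs + spread
        exchange = begin
          sum (λ y → ⟦ W y ⟧ * sum (λ i → F (y ∷ ys) (xs i)))
            ≡⟨ sum-cong-≗ (λ y → *-distribˡ-sum ⟦ W y ⟧ (λ i → F (y ∷ ys) (xs i))) ⟩
          sum (λ y → sum (λ i → ⟦ W y ⟧ * F (y ∷ ys) (xs i)))
            ≡⟨ ∑-comm (λ y i → ⟦ W y ⟧ * F (y ∷ ys) (xs i)) ⟩
          sum (λ i → sum (λ y → ⟦ W y ⟧ * F (y ∷ ys) (xs i)))
            ≡⟨ sum-cong-≗ (λ i → row (xs i)) ⟩
          sum (λ i → a * F ys (xs i) + sum (λ w → sum (λ y → ⟦ W y ⟧ * sq (b (xs i) w y))))
            ≡⟨ ∑-distrib-+ (λ i → a * F ys (xs i)) (λ i → sum (λ w → sum (λ y → ⟦ W y ⟧ * sq (b (xs i) w y)))) ⟩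
          sum (λ i → a * F ys (xs i)) + spread
            ≡⟨ cong (_+ spread) (*-distribˡ-sum a (λ i → F ys (xs i))) ⟨
          a * Q ys xs + spread ∎
          where
          open ≡-Reasoning
          row : ∀ x → sum (λ y → ⟦ W y ⟧ * F (y ∷ ys) x) ≡ a * F ys x + sum (λ w → sum (λ y → ⟦ W y ⟧ * sq (b x w y)))
          row x = begin
            sum (λ y → ⟦ W y ⟧ * sum (λ w → sq (H ys x w ℤ.+ b x w y)))
              ≡⟨ sum-cong-≗ (λ y → *-distribˡ-sum ⟦ W y ⟧ (λ w → sq (H ys x w ℤ.+ b x w y))) ⟩
            sum (λ y → sum (λ w → ⟦ W y ⟧ * sq (H ys x w ℤ.+ b x w y)))
              ≡⟨ ∑-comm (λ y w → ⟦ W y ⟧ * sq (H ys x w ℤ.+ b x w y)) ⟩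
            sum (λ w → sum (λ y → ⟦ W y ⟧ * sq (H ys x w ℤ.+ b x w y)))
              ≡⟨ sum-cong-≗ (λ w → variance W (H ys x w) (b x w) (b-centred x w)) ⟩
            sum (λ w → a * sq (H ys x w) + sum (λ y → ⟦ W y ⟧ * sq (b x w y)))
              ≡⟨ ∑-distrib-+ (λ w → a * sq (H ys x w)) (λ w → sum (λ y → ⟦ W y ⟧ * sq (b x w y))) ⟩
            sum (λ w → a * sq (H ys x w)) + sum (λ w → sum (λ y → ⟦ W y ⟧ * sq (b x w y)))
              ≡⟨ cong (_+ _) (*-distribˡ-sum a (λ w → sq (H ys x w))) ⟨
            a * F ys x + sum (λ w → sum (λ y → ⟦ W y ⟧ * sq (b x w y))) ∎

        spread≤ : 2 * spread ≤ k * (a * a³)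
        spread≤ = begin
          2 * spread
            ≡⟨ *-distribˡ-sum 2 (λ i → sum (λ w → sum (λ y → ⟦ W y ⟧ * sq (b (xs i) w y)))) ⟩
          sum (λ i → 2 * sum (λ w → sum (λ y → ⟦ W y ⟧ * sq (b (xs i) w y))))
            ≤⟨ ∑-mono (λ i → row (xs i) (light i)) ⟩
          sum {k} (λ i → a * a³)
            ≡⟨ constant k (a * a³) ⟩
          k * (a * a³) ∎
          where
          open ≤-Reasoning
          constant : ∀ k c → sum {k} (λ _ → c) ≡ k * c
          constant zero    c = refl
          constant (suc k) c = cong (_+_ c) (constant k c)
          row : ∀ x → 2 * deg x ≤ a → 2 * sum (λ w → sum (λ y → ⟦ W y ⟧ * sq (b x w y))) ≤ a * a³
          row x light = begin
            2 * sum (λ w → sum (λ y → ⟦ W y ⟧ * sq (b x w y)))  ≡⟨ *-distribˡ-sum 2 (λ w → sum (λ y → ⟦ W y ⟧ * sq (b x w y))) ⟩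
            sum (λ w → 2 * sum (λ y → ⟦ W y ⟧ * sq (b x w y)))  ≤⟨ ∑-mono (λ w → b-size x w light) ⟩
            sum (λ w → ⟦ W w ⟧ * a³)                            ≡⟨ *-distribʳ-sum a³ (λ w → ⟦ W w ⟧) ⟨
            a * a³ ∎

      samples : ∀ m {k} (xs : Fin k → Fin n) → 0 < a → (∀ i → 2 * deg (xs i) ≤ a) → Σ[ ys ∈ Vec (Fin n) m ] 2 * Q ys xs ≤ m * (k * a³)
      samples zero {k} xs positive light = [] , ≤-reflexive (cong (2 *_) (∑-zero (λ i → F [] (xs i)) (λ i → ∑-zero {n} (λ w → sq (+ 0)) (λ _ → refl))))
      samples (suc m) {k} xs positive light with ys , le ← samples m xs positive light with y , le′ ← next-sample ys xs positive light =
        y ∷ ys , farkas (2 * Q (y ∷ ys) xs ∷ 2 * Q ys xs ∷ k * a³ ∷ m ∷ []) (x₀ :≤ (κ 1 :+ x₃) :* x₂)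
          ((κ 1 , x₀ :≤ x₁ :+ x₂) ∷ (κ 1 , x₁ :≤ x₃ :* x₂) ∷ []) refl (le′ ∷ le ∷ [])

    trace : ∀ {m} → Vec (Fin n) m → Fin n → Vec Bool m
    trace ys x = Vec.map (adj x) ys

    opaque
      -- A sampled value of `X` depends on `x` only through the adjacency of the sample to `x`. For
      -- equal traces the sampled terms cancel and only those in `β` remain.
      same-trace : ∀ {m} (ys : Vec (Fin n) m) x x′ → trace ys x ≡ trace ys x′ → ∀ w → w ∈ W →
        H ys x w ℤ.- H ys x′ w ≡ + m ℤ.* (β x w ℤ.- β x′ w)
      same-trace [] x x′ eq w w∈ = sym (ℤP.*-zeroˡ (β x w ℤ.- β x′ w))
      same-trace {suc m} (y ∷ ys) x x′ eq w w∈ rewrite w∈ = begin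
        (H ys x w ℤ.+ (β x w ℤ.- + a ℤ.* X x w y)) ℤ.- (H ys x′ w ℤ.+ (β x′ w ℤ.- + a ℤ.* X x′ w y))
          ≡⟨ cong (λ z → (H ys x w ℤ.+ (β x w ℤ.- + a ℤ.* z)) ℤ.- (H ys x′ w ℤ.+ (β x′ w ℤ.- + a ℤ.* X x′ w y))) same-X ⟩
        (H ys x w ℤ.+ (β x w ℤ.- + a ℤ.* X x′ w y)) ℤ.- (H ys x′ w ℤ.+ (β x′ w ℤ.- + a ℤ.* X x′ w y))
          ≡⟨ cancel (H ys x w) (H ys x′ w) (β x w) (β x′ w) (+ a ℤ.* X x′ w y) ⟩
        (H ys x w ℤ.- H ys x′ w) ℤ.+ (β x w ℤ.- β x′ w)
          ≡⟨ cong (ℤ._+ (β x w ℤ.- β x′ w)) (same-trace ys x x′ (cong Vec.tail eq) w w∈) ⟩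
        + m ℤ.* (β x w ℤ.- β x′ w) ℤ.+ (β x w ℤ.- β x′ w)
          ≡⟨ step (+ m) (β x w ℤ.- β x′ w) ⟩
        + suc m ℤ.* (β x w ℤ.- β x′ w) ∎
        where
        open ≡-Reasoning
        same-X : X x w y ≡ X x′ w y
        same-X = cong (λ c → + (2 * ⟦ (W y ∧ c) ∧ adj w y ⟧) ℤ.- + ⟦ W y ∧ c ⟧) (cong Vec.head eq)
        cancel : ∀ h h′ β β′ z → (h ℤ.+ (β ℤ.- z)) ℤ.- (h′ ℤ.+ (β′ ℤ.- z)) ≡ (h ℤ.- h′) ℤ.+ (β ℤ.- β′)
        cancel = ℤRing.solve-∀
        step : ∀ m d → m ℤ.* d ℤ.+ d ≡ (+ 1 ℤ.+ m) ℤ.* d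
        step = ℤRing.solve-∀

      same-trace-dist : ∀ {m} (ys : Vec (Fin n) m) x x′ → trace ys x ≡ trace ys x′ → m * m * dist x x′ ≤ 2 * F ys x + 2 * F ys x′
      same-trace-dist {m} ys x x′ eq = begin
        m * m * dist x x′
          ≡⟨ *-distribˡ-sum (m * m) (λ w → ⟦ W w ⟧ * sq (β x w ℤ.- β x′ w)) ⟩
        sum (λ w → m * m * (⟦ W w ⟧ * sq (β x w ℤ.- β x′ w)))
          ≤⟨ ∑-mono (λ w → pointwise w (W w) refl) ⟩
        sum (λ w → 2 * sq (H ys x w) + 2 * sq (H ys x′ w))
          ≡⟨ ∑-distrib-+ (λ w → 2 * sq (H ys x w)) (λ w → 2 * sq (H ys x′ w)) ⟩
        sum (λ w → 2 * sq (H ys x w)) + sum (λ w → 2 * sq (H ys x′ w))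
          ≡⟨ cong₂ _+_ (*-distribˡ-sum 2 (λ w → sq (H ys x w))) (*-distribˡ-sum 2 (λ w → sq (H ys x′ w))) ⟨
        2 * F ys x + 2 * F ys x′ ∎
        where
        open ≤-Reasoning
        pointwise : ∀ w i → W w ≡ i → m * m * (⟦ i ⟧ * sq (β x w ℤ.- β x′ w)) ≤ 2 * sq (H ys x w) + 2 * sq (H ys x′ w)
        pointwise w false _ = subst (_≤ 2 * sq (H ys x w) + 2 * sq (H ys x′ w)) (sym (*-zeroʳ (m * m))) z≤n
        pointwise w true  p = begin
          m * m * (1 * sq (β x w ℤ.- β x′ w))   ≡⟨ cong (m * m *_) (*-identityˡ (sq (β x w ℤ.- β x′ w))) ⟩
          m * m * sq (β x w ℤ.- β x′ w)         ≡⟨ sq-scale m (β x w ℤ.- β x′ w) ⟨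
          sq (+ m ℤ.* (β x w ℤ.- β x′ w))       ≡⟨ cong sq (same-trace ys x x′ eq w p) ⟨
          sq (H ys x w ℤ.- H ys x′ w)           ≤⟨ sq-− (H ys x w) (H ys x′ w) ⟩
          2 * sq (H ys x w) + 2 * sq (H ys x′ w) ∎

      dist-triangle : ∀ x y z → dist x z ≤ 2 * dist x y + 2 * dist y z
      dist-triangle x y z = begin
        dist x z
          ≤⟨ ∑-mono (λ w → pointwise (W w) (β x w) (β y w) (β z w)) ⟩
        sum (λ w → 2 * (⟦ W w ⟧ * sq (β x w ℤ.- β y w)) + 2 * (⟦ W w ⟧ * sq (β y w ℤ.- β z w)))
          ≡⟨ ∑-distrib-+ (λ w → 2 * (⟦ W w ⟧ * sq (β x w ℤ.- β y w))) (λ w → 2 * (⟦ W w ⟧ * sq (β y w ℤ.- β z w))) ⟩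
        sum (λ w → 2 * (⟦ W w ⟧ * sq (β x w ℤ.- β y w))) + sum (λ w → 2 * (⟦ W w ⟧ * sq (β y w ℤ.- β z w)))
          ≡⟨ cong₂ _+_ (*-distribˡ-sum 2 (λ w → ⟦ W w ⟧ * sq (β x w ℤ.- β y w))) (*-distribˡ-sum 2 (λ w → ⟦ W w ⟧ * sq (β y w ℤ.- β z w))) ⟨
        2 * dist x y + 2 * dist y z ∎
        where
        open ≤-Reasoning
        telescope : ∀ p q r → (p ℤ.- q) ℤ.+ (q ℤ.- r) ≡ p ℤ.- r
        telescope = ℤRing.solve-∀
        pointwise : ∀ i p q r → ⟦ i ⟧ * sq (p ℤ.- r) ≤ 2 * (⟦ i ⟧ * sq (p ℤ.- q)) + 2 * (⟦ i ⟧ * sq (q ℤ.- r))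
        pointwise false p q r = z≤n
        pointwise true  p q r = farkas (sq (p ℤ.- r) ∷ sq (p ℤ.- q) ∷ sq (q ℤ.- r) ∷ []) (κ 1 :* x₀ :≤ κ 2 :* (κ 1 :* x₁) :+ κ 2 :* (κ 1 :* x₂))
          ((κ 1 , x₀ :≤ κ 2 :* x₁ :+ κ 2 :* x₂) ∷ []) refl (subst (λ z → sq z ≤ 2 * sq (p ℤ.- q) + 2 * sq (q ℤ.- r)) (telescope p q r) (sq-+ (p ℤ.- q) (q ℤ.- r)) ∷ [])

      -- Good centres are those with squared error at most m² |W|³ / 2400. As they are far apart,
      -- they have distinct traces, so there are at most 2 ^ m of them, and they make up at least a
      -- sixteenth of all centres.
      sampled-packing : ∀ m → 1280 ≤ m → ∀ {k} (xs : Fin k → Fin n) → 0 < a → (∀ i j → i ≢ j → a³ < 600 * dist (xs i) (xs j)) →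
        (ys : Vec (Fin n) m) → 2 * Q ys xs ≤ m * (k * a³) → k ≤ 16 * 2 ^ m
      sampled-packing m enough {k} xs positive far ys le =
        ≤-trans (*-cancelˡ-≤ (80 * (m * a³)) {{>-nonZero (*-mono-≤ {1} {80} (s≤s z≤n) (*-mono-≤ (≤-trans (s≤s z≤n) enough) (*-mono-≤ (*-mono-≤ positive positive) positive)))}}
            (few-bad m a³ k (count good) bad (Q ys xs) enough good+bad bad-heavy le))
          (*-monoʳ-≤ 16 (distinct-traces m good (trace ys ∘ xs) injective))
        where
        good : VSet k
        good i = leq (2400 * F ys (xs i)) (m * m * a³)

        injective : ∀ i j → i ∈ good → j ∈ good → trace ys (xs i) ≡ trace ys (xs j) → i ≡ j
        injective i j p q eq = case i FinP.≟ j of λ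
          { (yes i≡j) → i≡j
          ; (no i≢j)  → ⊥-elim (far-traces m a³ (dist (xs i) (xs j)) (F ys (xs i)) (F ys (xs j)) enough (far i j i≢j)
              (same-trace-dist ys (xs i) (xs j) eq) (leq-sound p) (leq-sound q)) }

        bad : ℕ
        bad = count {k} (λ i → not (good i))

        good+bad : k ≤ count good + bad
        good+bad = subst (_≤ count good + bad) (count-everything k) (tally 1 (λ i → good i ∷ []) (λ _ → true)
          ((λ g → true) ∷ []) ((λ g → g) ∷ (λ g → not g) ∷ []) refl (λ _ → refl))

        bad-heavy : bad * (m * m * a³) ≤ 2400 * Q ys xs
        bad-heavy = begin
          bad * (m * m * a³)                               ≡⟨ *-distribʳ-sum (m * m * a³) (λ i → ⟦ not (good i) ⟧) ⟩
          sum (λ i → ⟦ not (good i) ⟧ * (m * m * a³))      ≤⟨ ∑-mono (λ i → pointwise i (good i) refl) ⟩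
          sum (λ i → 2400 * F ys (xs i))                         ≡⟨ *-distribˡ-sum 2400 (λ i → F ys (xs i)) ⟨
          2400 * Q ys xs ∎
          where
          open ≤-Reasoning
          pointwise : ∀ i g → good i ≡ g → ⟦ not g ⟧ * (m * m * a³) ≤ 2400 * F ys (xs i)
          pointwise i true  _ = z≤n
          pointwise i false p = subst (_≤ 2400 * F ys (xs i)) (sym (*-identityˡ (m * m * a³)))
            (≰⇒≥ (λ le → case trans (sym p) (leq-complete le) of λ ()))

      packing-bound : ∀ m → 1280 ≤ m → ∀ {k} (xs : Fin k → Fin n) → 0 < a → (∀ i → 2 * deg (xs i) ≤ a) →
        (∀ i j → i ≢ j → a³ < 600 * dist (xs i) (xs j)) → k ≤ 16 * 2 ^ m
      packing-bound m enough xs positive light far =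
        sampled-packing m enough xs positive far (proj₁ (samples m xs positive light)) (proj₂ (samples m xs positive light))

  Cauchy–Schwarz : ∀ {n} (S : VSet n) (f : Fin n → ℕ) →
    sum (λ v → ⟦ S v ⟧ * f v) * sum (λ v → ⟦ S v ⟧ * f v) ≤ count S * sum (λ v → ⟦ S v ⟧ * (f v * f v))
  Cauchy–Schwarz {n} S f = conclude (count S) refl
    where
    T R : ℕ
    T = sum (λ v → ⟦ S v ⟧ * f v)
    R = sum (λ v → ⟦ S v ⟧ * (f v * f v))

    am-gm : ∀ p q → 2 * (p * q) ≤ p * p + q * q
    am-gm p q = [ ordered p q , (λ q≤p → subst₂ _≤_ (cong (2 *_) (*-comm q p)) (+-comm (q * q) (p * p)) (ordered q p q≤p)) ]′ (≤-total p q)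
      where
      ordered : ∀ p q → p ≤ q → 2 * (p * q) ≤ p * p + q * q
      ordered p q le = subst (λ q → 2 * (p * q) ≤ p * p + q * q) (m+[n∸m]≡n le)
        (farkas (p ∷ q ∸ p ∷ []) (κ 2 :* (x₀ :* (x₀ :+ x₁)) :≤ x₀ :* x₀ :+ (x₀ :+ x₁) :* (x₀ :+ x₁)) [] refl [])

    -- The inequality 2 T (N f) ≤ T² + N² f² is summed over `S`; for N = |S| a factor N cancels.
    weighted : ∀ N → 2 * (T * N) * T ≤ T * T * count S + N * N * R
    weighted N = begin
      2 * (T * N) * T                                                     ≡⟨ *-distribˡ-sum (2 * (T * N)) (λ v → ⟦ S v ⟧ * f v) ⟩
      sum (λ v → 2 * (T * N) * (⟦ S v ⟧ * f v))                           ≤⟨ ∑-mono (λ v → pointwise (S v) (f v)) ⟩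
      sum (λ v → T * T * ⟦ S v ⟧ + N * N * (⟦ S v ⟧ * (f v * f v)))       ≡⟨ ∑-distrib-+ (λ v → T * T * ⟦ S v ⟧) (λ v → N * N * (⟦ S v ⟧ * (f v * f v))) ⟩
      sum (λ v → T * T * ⟦ S v ⟧) + sum (λ v → N * N * (⟦ S v ⟧ * (f v * f v)))
        ≡⟨ cong₂ _+_ (*-distribˡ-sum (T * T) (λ v → ⟦ S v ⟧)) (*-distribˡ-sum (N * N) (λ v → ⟦ S v ⟧ * (f v * f v))) ⟨
      T * T * count S + N * N * R ∎
      where
      open ≤-Reasoning
      pointwise : ∀ s x → 2 * (T * N) * (⟦ s ⟧ * x) ≤ T * T * ⟦ s ⟧ + N * N * (⟦ s ⟧ * (x * x))
      pointwise false x = subst (_≤ T * T * 0 + N * N * 0) (sym (*-zeroʳ (2 * (T * N)))) z≤n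
      pointwise true  x = farkas (T ∷ N ∷ x ∷ []) (κ 2 :* (x₀ :* x₁) :* (κ 1 :* x₂) :≤ x₀ :* x₀ :* κ 1 :+ x₁ :* x₁ :* (κ 1 :* (x₂ :* x₂)))
        ((κ 1 , κ 2 :* (x₀ :* (x₁ :* x₂)) :≤ x₀ :* x₀ :+ (x₁ :* x₂) :* (x₁ :* x₂)) ∷ []) refl (am-gm T (N * x) ∷ [])

    conclude : ∀ N → count S ≡ N → T * T ≤ N * R
    conclude zero    eq = subst (λ t → t * t ≤ 0) (sym (∑-zero (λ v → ⟦ S v ⟧ * f v) (λ v → absent v (S v) refl))) z≤n
      where
      absent : ∀ v s → S v ≡ s → ⟦ s ⟧ * f v ≡ 0
      absent v false _ = refl
      absent v true  p = ⊥-elim (<-irrefl (sym eq) (≤-trans (singleton v) (count-mono {A = λ w → does (w FinP.≟ v)} (λ w w≡v → subst (_∈ S) (sym (dec-true (w FinP.≟ v) w≡v)) p))))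
        where
        singleton : ∀ {l} (x : Fin l) → 1 ≤ count (λ v → does (v FinP.≟ x))
        singleton zero    = s≤s z≤n
        singleton (suc x) = singleton x
    conclude (suc N) eq = *-cancelˡ-≤ (suc N) (farkas (T ∷ suc N ∷ R ∷ []) (x₁ :* (x₀ :* x₀) :≤ x₁ :* (x₁ :* x₂))
      ((κ 1 , κ 2 :* (x₀ :* x₁) :* x₀ :≤ x₀ :* x₀ :* x₁ :+ x₁ :* x₁ :* x₂) ∷ []) refl
      (subst (λ c → 2 * (T * suc N) * T ≤ T * T * c + suc N * suc N * R) eq (weighted (suc N)) ∷ []))

  -- An edge whose ends have similar codegrees

  module SimilarPairs {n : ℕ} (G : Graph n) (W : VSet n) (tf : FiveWalks.TriangleFree G W) where
    open Graph G
    open Cliques G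
    open FiveWalks G
    open Sampling G W

    private
      a a³ : ℕ
      a = count W
      a³ = a * a * a

      -- Two vertices within 1 / 600 of a common centre are within 2 / 600 + 2 / 600 = 1 / 150 of
      -- each other, because squared distances satisfy the triangle inequality with a factor 2.
      near-near : ∀ c d d₁ d₂ → d ≤ 2 * d₁ + 2 * d₂ → 600 * d₁ ≤ c → 600 * d₂ ≤ c → 150 * d ≤ c
      near-near c d d₁ d₂ tri n₁ n₂ = *-cancelˡ-≤ 4 (farkas (c ∷ d ∷ d₁ ∷ d₂ ∷ []) (κ 4 :* (κ 150 :* x₁) :≤ κ 4 :* x₀)
        ((κ 600 , x₁ :≤ κ 2 :* x₂ :+ κ 2 :* x₃) ∷ (κ 2 , κ 600 :* x₂ :≤ x₀) ∷ (κ 2 , κ 600 :* x₃ :≤ x₀) ∷ []) refl (tri ∷ n₁ ∷ n₂ ∷ []))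

      dist-sym : ∀ x y → dist x y ≡ dist y x
      dist-sym x y = sum-cong-≗ (λ w → cong (λ p → ⟦ W w ⟧ * (p * p)) (ℤP.∣i-j∣≡∣j-i∣ (β x w) (β y w)))

      opaque
        spread : Fin n → Fin n → ℕ
        spread x y = 600 * dist x y

        spread-dist : ∀ x y → spread x y ≡ 600 * dist x y
        spread-dist x y = refl

        spread-sym : ∀ x y → spread x y ≡ spread y x
        spread-sym x y = cong (600 *_) (dist-sym x y)

      Packing : Set
      Packing = Σ[ k ∈ ℕ ] (Fin k → Fin n)

      Scattered : Packing → Set
      Scattered (k , xs) = (∀ i → 2 * deg (xs i) ≤ a) × (∀ i j → i ≢ j → a³ < spread (xs i) (xs j))

      _◂_ : ∀ {k} → Fin n → (Fin k → Fin n) → Fin (suc k) → Fin n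
      (v ◂ xs) zero    = v
      (v ◂ xs) (suc i) = xs i

      scattered-cons : ∀ {k xs} v → Scattered (k , xs) → 2 * deg v ≤ a → (∀ i → a³ < spread (xs i) v) → Scattered (suc k , v ◂ xs)
      scattered-cons {k} {xs} v (light , far) lv fv = light′ , far′
        where
        light′ : ∀ i → 2 * deg ((v ◂ xs) i) ≤ a
        light′ zero    = lv
        light′ (suc i) = light i
        far′ : ∀ i j → i ≢ j → a³ < spread ((v ◂ xs) i) ((v ◂ xs) j)
        far′ zero    zero    ne = ⊥-elim (ne refl)
        far′ zero    (suc j) ne = subst (a³ <_) (spread-sym (xs j) v) (fv j)
        far′ (suc i) zero    ne = fv i
        far′ (suc i) (suc j) ne = far i j (ne ∘ cong suc)

      two-heavy : ∀ v w → v ∈ W → w ∈ W → w ∈ adj v → ¬ 2 * deg v ≤ a → ¬ 2 * deg w ≤ a → ⊥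
      two-heavy v w v∈ w∈ vw hv hw = impossible (a ∷ deg v ∷ deg w ∷ [])
        ((κ 2 , x₁ :+ x₂ :≤ x₀) ∷ (κ 1 , κ 1 :+ x₀ :≤ κ 2 :* x₁) ∷ (κ 1 , κ 1 :+ x₀ :≤ κ 2 :* x₂) ∷ []) refl
        (tally 3 (λ y → W y ∷ adj v y ∷ adj w y ∷ []) (λ m p q → not (m ∧ (p ∧ q)))
          ((λ m p q → m ∧ p) ∷ (λ m p q → m ∧ q) ∷ []) ((λ m p q → m) ∷ []) refl
          (λ y → not-intro (λ r → let m , pq = ∧-elim {W y} r ; p , q = ∧-elim {adj v y} pq in tf v w y v∈ w∈ m vw p q))
        ∷ ≰⇒> hv ∷ ≰⇒> hw ∷ [])

      module Centres (no-similar : ∀ x y → x ∈ W → y ∈ W → y ∈ adj x → 150 * dist x y ≤ a³ → ⊥)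
        {k : ℕ} (xs : Fin k → Fin n) (scattered : Scattered (k , xs)) (best : ∀ p → Scattered p → proj₁ p ≤ k) where

        near : Fin n → VSet k
        near v i = leq (spread (xs i) v) a³

        data View (v : Fin n) : ℕ → Set where
          heavy : ¬ 2 * deg v ≤ a → View v k
          light : ∀ i → spread (xs i) v ≤ a³ → View v (toℕ i)

        view : ∀ v → Σ[ c ∈ ℕ ] View v c
        view v = decide (2 * deg v ≤? a) (search (near v))
          where
          decide : Dec (2 * deg v ≤ a) → (Σ[ i ∈ Fin k ] i ∈ near v) ⊎ (∀ i → ¬ i ∈ near v) → Σ[ c ∈ ℕ ] View v c
          decide (no h)  _              = k , heavy h
          decide (yes l) (inj₁ (i , p)) = toℕ i , light i (leq-sound p)
          decide (yes l) (inj₂ none)    = ⊥-elim (<-irrefl refl (best (suc k , v ◂ xs)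
            (scattered-cons {xs = xs} v scattered l (λ i → ≰⇒> (λ le → none i (leq-complete le))))))

        centre-colouring : Colouring W (suc k)
        centre-colouring = (λ v → proj₁ (view v)) , (λ v _ → bound (proj₂ (view v))) , λ v w v∈ w∈ vw → proper v w v∈ w∈ vw (proj₂ (view v)) (proj₂ (view w))
          where
          bound : ∀ {v c} → View v c → c < suc k
          bound (heavy _)   = ≤-refl
          bound (light i _) = m≤n⇒m≤1+n (FinP.toℕ<n i)
          proper : ∀ v w → v ∈ W → w ∈ W → w ∈ adj v → ∀ {c d} → View v c → View w d → c ≢ d
          proper v w v∈ w∈ vw (heavy h)   (heavy h′)   = λ _ → two-heavy v w v∈ w∈ vw h h′
          proper v w v∈ w∈ vw (heavy _)   (light i _)  = λ eq → <-irrefl (sym eq) (FinP.toℕ<n i)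
          proper v w v∈ w∈ vw (light i _) (heavy _)    = λ eq → <-irrefl eq (FinP.toℕ<n i)
          proper v w v∈ w∈ vw (light i p) (light j q) = λ eq → no-similar v w v∈ w∈ vw
            (near-near a³ (dist v w) (dist v (xs i)) (dist (xs i) w) (dist-triangle v (xs i) w)
              (subst (_≤ a³) (trans (spread-sym (xs i) v) (spread-dist v (xs i))) p)
              (subst (_≤ a³) (trans (cong (λ i → spread (xs i) w) (sym (FinP.toℕ-injective eq))) (spread-dist (xs i) w)) q))

    -- The colour of a vertex is the nearest element of a maximal scattered family; the vertices of degree above a / 2 are independent.
    similar-edge : 0 < a → ∀ c → 16 * 2 ^ 1280 < c → ¬ Colouring W c →
      (∀ x y → x ∈ W → y ∈ W → y ∈ adj x → 150 * dist x y ≤ a³ → ⊥) → ⊥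
    similar-edge positive c enough no-colouring no-similar = maximise Scattered proj₁ (16 * 2 ^ 1280) bounded (0 , λ ()) ((λ ()) , λ ())
      (λ { (k , xs) scattered best → let col , bound , proper = Centres.centre-colouring no-similar xs scattered best in
        no-colouring (col , (λ v v∈ → <-≤-trans (bound v v∈) (≤-trans (s≤s (bounded (k , xs) scattered)) enough)) , proper) })
      where
      bounded : ∀ p → Scattered p → proj₁ p ≤ 16 * 2 ^ 1280
      bounded (k , xs) (light , far) = packing-bound 1280 ≤-refl xs positive light
        (λ i j i≢j → subst (a³ <_) (spread-dist (xs i) (xs j)) (far i j i≢j))

  -- Few edges between two similar neighbourhoods

  module SimilarEdge {n : ℕ} (G : Graph n) (W : VSet n) (tf : FiveWalks.TriangleFree G W)
    (x y : Fin n) (x∈ : x ∈ W) (y∈ : y ∈ W) (xy : y ∈ Graph.adj G x)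
    (similar : 150 * Sampling.dist G W x y ≤ count W * count W * count W) where
    open Graph G
    open Cliques G
    open FiveWalks G
    open Sampling G W

    private
      a : ℕ
      a = count W

      U V S : VSet n
      U = W ∩ adj x
      V = W ∩ adj y
      S v = U v ∨ V v

      disjoint : ∀ v → not (U v ∧ V v) ≡ true
      disjoint v = not-intro (λ p → let u , q = ∧-elim {U v} p ; m , xv = ∧-elim {W v} u in tf x y v x∈ y∈ m xy xv (∧-elimʳ {W v} q))

    -- The edges between `U` and `V`, counted at their ends in `U`.
    edges : ℕ
    edges = sum (λ w → ⟦ U w ⟧ * codeg y w)

    private
      adj-comm : ∀ v w → adj v w ≡ adj w v
      adj-comm v w with adj v w in p | adj w v in q
      ... | true  | true  = refl
      ... | false | false = refl
      ... | true  | false = case trans (sym q) (adj-sym p) of λ ()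
      ... | false | true  = case trans (sym p) (adj-sym q) of λ ()

    opaque
      edges-flip : sum (λ w → ⟦ V w ⟧ * codeg x w) ≡ edges
      edges-flip = begin
        sum (λ w → ⟦ V w ⟧ * sum (λ v → ⟦ (U ∩ adj w) v ⟧))      ≡⟨ sum-cong-≗ (λ w → *-distribˡ-sum ⟦ V w ⟧ (λ v → ⟦ (U ∩ adj w) v ⟧)) ⟩
        sum (λ w → sum (λ v → ⟦ V w ⟧ * ⟦ (U ∩ adj w) v ⟧))      ≡⟨ ∑-comm (λ w v → ⟦ V w ⟧ * ⟦ (U ∩ adj w) v ⟧) ⟩
        sum (λ v → sum (λ w → ⟦ V w ⟧ * ⟦ (U ∩ adj w) v ⟧))      ≡⟨ sum-cong-≗ (λ v → sum-cong-≗ (λ w → flip (U v) (V w) (adj w v) (adj v w) (adj-comm w v))) ⟩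
        sum (λ v → sum (λ w → ⟦ U v ⟧ * ⟦ (V ∩ adj v) w ⟧))      ≡⟨ sum-cong-≗ (λ v → *-distribˡ-sum ⟦ U v ⟧ (λ w → ⟦ (V ∩ adj v) w ⟧)) ⟨
        edges ∎
        where
        open ≡-Reasoning
        flip : ∀ u v c d → c ≡ d → ⟦ v ⟧ * ⟦ u ∧ c ⟧ ≡ ⟦ u ⟧ * ⟦ v ∧ d ⟧
        flip true  true  c d p = cong (λ b → ⟦ b ⟧ + 0) p
        flip true  false c d p = refl
        flip false true  c d p = refl
        flip false false c d p = refl

    private
      h : Fin n → ℕ
      h w = ℤ.∣ β x w ℤ.- β y w ∣

      gap : ∀ p q c d → p + c ≤ d + q + ℤ.∣ (+ p ℤ.- + q) ℤ.- (+ d ℤ.- + c) ∣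
      gap p q c d = subst (_≤ d + q + ℤ.∣ z ∣) (cong ℤ.∣_∣ eq) (ℤP.∣i+j∣≤∣i∣+∣j∣ (+ (d + q)) z)
        where
        z = (+ p ℤ.- + q) ℤ.- (+ d ℤ.- + c)
        identity : ∀ p q c d → (d ℤ.+ q) ℤ.+ ((p ℤ.- q) ℤ.- (d ℤ.- c)) ≡ p ℤ.+ c
        identity = ℤRing.solve-∀
        eq : + (d + q) ℤ.+ z ≡ + (p + c)
        eq = trans (cong (ℤ._+ z) (ℤP.pos-+ d q)) (trans (identity (+ p) (+ q) (+ c) (+ d)) (sym (ℤP.pos-+ p c)))

      codeg-zero : ∀ z w → z ∈ W → w ∈ W ∩ adj z → codeg z w ≡ 0
      codeg-zero z w z∈ w∈ = count-empty {A = (W ∩ adj z) ∩ adj w} (λ v p → let wv , r = ∧-elim {(W ∩ adj z) v} p ; m , zv = ∧-elim {W v} wv in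
        tf z w v z∈ (∧-elimˡ w∈) m (∧-elimʳ {W w} w∈) zv r)

      -- As `w` and `x` are adjacent, they have no common neighbour and `β x w` is -`deg x`; the
      -- difference of `β y w` and `β x w` is then 2 `codeg y w` + `deg x` - `deg y`.
      gap-U : ∀ w → w ∈ U → 2 * codeg y w + deg x ≤ deg y + h w
      gap-U w w∈ = subst₂ (λ c s → 2 * codeg y w + deg x ≤ 2 * c + deg y + s) (codeg-zero x w x∈ w∈)
          (trans (cong ℤ.∣_∣ (cong₂ ℤ._-_ (sym (β-codeg y w)) (sym (β-codeg x w)))) (ℤP.∣i-j∣≡∣j-i∣ (β y w) (β x w)))
        (gap (2 * codeg y w) (deg y) (deg x) (2 * codeg x w))

      gap-V : ∀ w → w ∈ V → 2 * codeg x w + deg y ≤ deg x + h w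
      gap-V w w∈ = subst₂ (λ c s → 2 * codeg x w + deg y ≤ 2 * c + deg x + s) (codeg-zero y w y∈ w∈)
          (cong ℤ.∣_∣ (cong₂ ℤ._-_ (sym (β-codeg x w)) (sym (β-codeg y w))))
        (gap (2 * codeg x w) (deg x) (deg y) (2 * codeg y w))

      weighted : ∀ (A : VSet n) (f g : Fin n → ℕ) c d → (∀ w → w ∈ A → 2 * f w + c ≤ d + g w) →
        2 * sum (λ w → ⟦ A w ⟧ * f w) + c * count A ≤ d * count A + sum (λ w → ⟦ A w ⟧ * g w)
      weighted A f g c d le = begin
        2 * sum (λ w → ⟦ A w ⟧ * f w) + c * count A
          ≡⟨ cong₂ _+_ (*-distribˡ-sum 2 (λ w → ⟦ A w ⟧ * f w)) (*-distribˡ-sum c (λ w → ⟦ A w ⟧)) ⟩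
        sum (λ w → 2 * (⟦ A w ⟧ * f w)) + sum (λ w → c * ⟦ A w ⟧)
          ≡⟨ ∑-distrib-+ (λ w → 2 * (⟦ A w ⟧ * f w)) (λ w → c * ⟦ A w ⟧) ⟨
        sum (λ w → 2 * (⟦ A w ⟧ * f w) + c * ⟦ A w ⟧)
          ≤⟨ ∑-mono (λ w → pointwise w (A w) refl) ⟩
        sum (λ w → d * ⟦ A w ⟧ + ⟦ A w ⟧ * g w)
          ≡⟨ ∑-distrib-+ (λ w → d * ⟦ A w ⟧) (λ w → ⟦ A w ⟧ * g w) ⟩
        sum (λ w → d * ⟦ A w ⟧) + sum (λ w → ⟦ A w ⟧ * g w)
          ≡⟨ cong (_+ sum (λ w → ⟦ A w ⟧ * g w)) (*-distribˡ-sum d (λ w → ⟦ A w ⟧)) ⟨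
        d * count A + sum (λ w → ⟦ A w ⟧ * g w) ∎
        where
        open ≤-Reasoning
        pointwise : ∀ w b → A w ≡ b → 2 * (⟦ b ⟧ * f w) + c * ⟦ b ⟧ ≤ d * ⟦ b ⟧ + ⟦ b ⟧ * g w
        pointwise w false _ = farkas (c ∷ d ∷ f w ∷ g w ∷ []) (κ 2 :* (κ 0 :* x₂) :+ x₀ :* κ 0 :≤ x₁ :* κ 0 :+ κ 0 :* x₃) [] refl []
        pointwise w true  p = farkas (c ∷ d ∷ f w ∷ g w ∷ []) (κ 2 :* (κ 1 :* x₂) :+ x₀ :* κ 1 :≤ x₁ :* κ 1 :+ κ 1 :* x₃)
          ((κ 1 , κ 2 :* x₂ :+ x₀ :≤ x₁ :+ x₃) ∷ []) refl (le w p ∷ [])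

      size-S : count S ≤ count U + count V
      size-S = tally 2 (λ v → U v ∷ V v ∷ []) (λ _ _ → true) ((λ p q → p ∨ q) ∷ []) ((λ p q → p) ∷ (λ p q → q) ∷ []) refl (λ _ → refl)

      total : ℕ
      total = sum (λ w → ⟦ S w ⟧ * h w)

      split-total : sum (λ w → ⟦ U w ⟧ * h w) + sum (λ w → ⟦ V w ⟧ * h w) ≤ total
      split-total = ≤-trans (≤-reflexive (sym (∑-distrib-+ (λ w → ⟦ U w ⟧ * h w) (λ w → ⟦ V w ⟧ * h w)))) (∑-mono (λ w → pointwise (U w) (V w) (h w) (disjoint w)))
        where
        pointwise : ∀ u v p → not (u ∧ v) ≡ true → ⟦ u ⟧ * p + ⟦ v ⟧ * p ≤ ⟦ u ∨ v ⟧ * p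
        pointwise true  false p _ = ≤-reflexive (+-identityʳ _)
        pointwise false true  p _ = ≤-refl
        pointwise false false p _ = z≤n

      -- Summing `gap-U` over `U` and `gap-V` over `V` gives 4 `edges` + (`deg x` - `deg y`)² ≤
      -- `total`, and the square is dropped.
      four-edges : 4 * edges ≤ total
      four-edges = square-cancel (deg x) (deg y) (farkas
        (edges ∷ deg x ∷ deg y ∷ total ∷ sum (λ w → ⟦ U w ⟧ * h w) ∷ sum (λ w → ⟦ V w ⟧ * h w) ∷ sum (λ w → ⟦ V w ⟧ * codeg x w) ∷ [])
        (κ 4 :* x₀ :+ (x₁ :* x₁ :+ x₂ :* x₂) :≤ x₃ :+ κ 2 :* (x₁ :* x₂))
        ((κ 1 , κ 2 :* x₀ :+ x₁ :* x₁ :≤ x₂ :* x₁ :+ x₄) ∷ (κ 1 , κ 2 :* x₆ :+ x₂ :* x₂ :≤ x₁ :* x₂ :+ x₅) ∷ (κ 2 , x₀ :≤ x₆) ∷ (κ 1 , x₄ :+ x₅ :≤ x₃) ∷ []) refl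
        (weighted U (codeg y) h (deg x) (deg y) gap-U ∷ weighted V (codeg x) h (deg y) (deg x) gap-V ∷ ≤-reflexive (sym edges-flip) ∷ split-total ∷ []))
        where
        ordered : ∀ p d {s t} → s + (p * p + (p + d) * (p + d)) ≤ t + 2 * (p * (p + d)) → s ≤ t
        ordered p d {s} {t} le = farkas (s ∷ t ∷ p ∷ d ∷ []) (x₀ :≤ x₁)
          ((κ 1 , x₀ :+ (x₂ :* x₂ :+ (x₂ :+ x₃) :* (x₂ :+ x₃)) :≤ x₁ :+ κ 2 :* (x₂ :* (x₂ :+ x₃))) ∷ []) refl (le ∷ [])
        square-cancel : ∀ p q {s t} → s + (p * p + q * q) ≤ t + 2 * (p * q) → s ≤ t
        square-cancel p q {s} {t} le with ≤-total p q
        ... | inj₁ p≤q = ordered p (q ∸ p) (subst (λ q → s + (p * p + q * q) ≤ t + 2 * (p * q)) (sym (m+[n∸m]≡n p≤q)) le)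
        ... | inj₂ q≤p = ordered q (p ∸ q) (subst (λ p → s + (q * q + p * p) ≤ t + 2 * (q * p)) (sym (m+[n∸m]≡n q≤p))
                (subst₂ (λ l r → s + l ≤ t + 2 * r) (+-comm (p * p) (q * q)) (*-comm p q) le))

      total-square : total * total ≤ count S * Sampling.dist G W x y
      total-square = ≤-trans (Cauchy–Schwarz S h) (*-monoʳ-≤ (count S) (∑-mono (λ w → pointwise (W w) (adj x w) (adj y w) (h w * h w))))
        where
        pointwise : ∀ m p q r → ⟦ (m ∧ p) ∨ (m ∧ q) ⟧ * r ≤ ⟦ m ⟧ * r
        pointwise false p q r = z≤n
        pointwise true  p q r = *-monoˡ-≤ r (bit≤1 (p ∨ q))
          where
          bit≤1 : ∀ b → ⟦ b ⟧ ≤ 1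
          bit≤1 true  = ≤-refl
          bit≤1 false = z≤n

    opaque
      -- By Cauchy-Schwarz 16 `edges`² is at most |S| `dist x y`, and 2400 = 16 · 150.
      edges-small : 2400 * (edges * edges) ≤ (deg x + deg y) * (a * a * a)
      edges-small = combine-bounds edges total (count S) (deg x + deg y) (dist x y) (a * a * a) four-edges total-square size-S similar
        where
        combine-bounds : ∀ e t s m d c → 4 * e ≤ t → t * t ≤ s * d → s ≤ m → 150 * d ≤ c → 2400 * (e * e) ≤ m * c
        combine-bounds e t s m d c p q r f = begin
          2400 * (e * e)          ≤⟨ farkas (e ∷ []) (κ 2400 :* (x₀ :* x₀) :≤ κ 150 :* (κ 4 :* x₀ :* (κ 4 :* x₀))) [] refl [] ⟩
          150 * (4 * e * (4 * e)) ≤⟨ *-monoʳ-≤ 150 (≤-trans (*-mono-≤ p p) q) ⟩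
          150 * (s * d)           ≤⟨ farkas (s ∷ d ∷ []) (κ 150 :* (x₀ :* x₁) :≤ x₀ :* (κ 150 :* x₁)) [] refl [] ⟩
          s * (150 * d)           ≤⟨ *-mono-≤ r f ⟩
          m * c ∎
          where open ≤-Reasoning

    -- A threshold s turns the codegrees into a vertex cover of the edges between the two neighbourhoods,
    -- and averaging over s < q gives one of size at most 2 edges / q.
    module _ {u : ℕ} (misses : MissesAtMost u W) where

      private
        -- The neighbourhoods of `v` and `w` are disjoint, as are those of `x` and `v` and those of
        -- `y` and `w`. So an edge between `U` and `V` forces many neighbours of `v` in `V` or of
        -- `w` in `U`.
        degree-sum : ∀ v w → v ∈ U → w ∈ V → w ∈ adj v → a + (deg x + deg y) ≤ codeg y v + codeg x w + (u + u)
        degree-sum v w v∈ w∈ vw = farkas (a ∷ deg x ∷ deg y ∷ codeg y v ∷ codeg x w ∷ u ∷ count (W ∖ adj v) ∷ count (W ∖ adj w) ∷ [])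
          (x₀ :+ (x₁ :+ x₂) :≤ x₃ :+ x₄ :+ (x₅ :+ x₅))
          ((κ 1 , x₀ :+ (x₁ :+ x₂) :≤ x₃ :+ (x₄ :+ (x₆ :+ x₇))) ∷ (κ 1 , x₆ :≤ x₅) ∷ (κ 1 , x₇ :≤ x₅) ∷ []) refl
          (tally 5 (λ i → W i ∷ adj x i ∷ adj y i ∷ adj v i ∷ adj w i ∷ [])
            (λ m p q r s → not (m ∧ (p ∧ q)) ∧ not (m ∧ (r ∧ s)) ∧ not (m ∧ (p ∧ r)) ∧ not (m ∧ (q ∧ s)))
            ((λ m p q r s → m) ∷ (λ m p q r s → m ∧ p) ∷ (λ m p q r s → m ∧ q) ∷ [])
            ((λ m p q r s → (m ∧ q) ∧ r) ∷ (λ m p q r s → (m ∧ p) ∧ s) ∷ (λ m p q r s → m ∧ not r) ∷ (λ m p q r s → m ∧ not s) ∷ []) refl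
            (λ i → ∧-intro (apart x∈ y∈ xy i) (∧-intro (apart (∧-elimˡ v∈) (∧-elimˡ w∈) vw i)
              (∧-intro (apart x∈ (∧-elimˡ v∈) (∧-elimʳ {W v} v∈) i) (apart y∈ (∧-elimˡ w∈) (∧-elimʳ {W w} w∈) i))))
          ∷ misses v (∧-elimˡ v∈) ∷ misses w (∧-elimˡ w∈) ∷ [])
          where
          apart : ∀ {p q} → p ∈ W → q ∈ W → q ∈ adj p → ∀ i → not (W i ∧ (adj p i ∧ adj q i)) ≡ true
          apart {p} {q} p∈ q∈ pq i = not-intro (λ r → let m , s = ∧-elim {W i} r ; pi , qi = ∧-elim {adj p i} s in tf p q i p∈ q∈ m pq pi qi)

      private
        Jₛ : ℕ → ℕ → VSet n
        Jₛ q s v = (U v ∧ not (leq (suc s) (codeg y v))) ∨ (V v ∧ not (leq q (codeg x v + s)))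

        ∨-elim : ∀ {p q} → p ∨ q ≡ true → p ≡ true ⊎ q ≡ true
        ∨-elim {true}  _ = inj₁ refl
        ∨-elim {false} p = inj₂ p

        crossing : ∀ q s → q + (u + u) ≤ a + (deg x + deg y) → ∀ v w → U v ∧ not (leq (suc s) (codeg y v)) ≡ true →
          V w ∧ not (leq q (codeg x w + s)) ≡ true → w ∈ adj v → ⊥
        crossing q s room v w vU wV vw = impossible (a ∷ deg x ∷ deg y ∷ codeg y v ∷ codeg x w ∷ u ∷ q ∷ s ∷ [])
          ((κ 1 , x₀ :+ (x₁ :+ x₂) :≤ x₃ :+ x₄ :+ (x₅ :+ x₅)) ∷ (κ 1 , x₆ :+ (x₅ :+ x₅) :≤ x₀ :+ (x₁ :+ x₂)) ∷ (κ 1 , x₃ :≤ x₇) ∷ (κ 1 , κ 1 :+ (x₄ :+ x₇) :≤ x₆) ∷ []) refl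
          (degree-sum v w (∧-elimˡ vU) (∧-elimˡ wV) vw ∷ room
            ∷ s≤s⁻¹ (≰⇒> (λ le → not-elim (∧-elimʳ {U v} vU) (leq-complete le))) ∷ ≰⇒> (λ le → not-elim (∧-elimʳ {V w} wV) (leq-complete le)) ∷ [])

        -- Inside `U` or `V` an edge would close a triangle. Across, `degree-sum` makes the two
        -- codegrees sum to at least `q`, whereas the two thresholds leave at most q - 1.
        J-independent : ∀ q s → q + (u + u) ≤ a + (deg x + deg y) → s < q → Independent (Jₛ q s)
        J-independent q s room s<q v w p r vw with ∨-elim {U v ∧ _} p | ∨-elim {U w ∧ _} r
        ... | inj₁ vU | inj₁ wU = tf x v w x∈ (∧-elimˡ (∧-elimˡ vU)) (∧-elimˡ (∧-elimˡ wU)) (∧-elimʳ {W v} (∧-elimˡ vU)) (∧-elimʳ {W w} (∧-elimˡ wU)) vw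
        ... | inj₂ vV | inj₂ wV = tf y v w y∈ (∧-elimˡ (∧-elimˡ vV)) (∧-elimˡ (∧-elimˡ wV)) (∧-elimʳ {W v} (∧-elimˡ vV)) (∧-elimʳ {W w} (∧-elimˡ wV)) vw
        ... | inj₁ vU | inj₂ wV = crossing q s room v w vU wV vw
        ... | inj₂ vV | inj₁ wU = crossing q s room w v wU vV (adj-sym vw)

        below-threshold : ∀ q c → count {q} (λ s → leq (suc (toℕ s)) c) ≤ c
        below-threshold zero    c       = z≤n
        below-threshold (suc q) zero    = ≤-reflexive (count-empty {suc q} {λ s → leq (suc (toℕ s)) 0} (λ s p → case leq-sound p of λ ()))
        below-threshold (suc q) (suc c) = +-mono-≤ (bit≤1 (leq 1 (suc c))) (≤-trans (count-mono {q} {λ s → leq (suc (suc (toℕ s))) (suc c)} (λ s p → leq-complete (s≤s⁻¹ (leq-sound p)))) (below-threshold q c))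
          where
          bit≤1 : ∀ b → ⟦ b ⟧ ≤ 1
          bit≤1 true  = ≤-refl
          bit≤1 false = z≤n

        above-threshold : ∀ q c → count {q} (λ s → leq q (c + toℕ s)) ≤ c
        above-threshold zero    c = z≤n
        above-threshold (suc q) c with suc q ≤? c
        ... | yes le = ≤-trans (count≤n {suc q} (λ s → leq (suc q) (c + toℕ s))) le
        ... | no nle = ≤-trans (+-mono-≤ first (count-mono {q} {λ s → leq (suc q) (c + suc (toℕ s))} (λ s p → leq-complete (s≤s⁻¹ (subst (suc q ≤_) (+-suc c (toℕ s)) (leq-sound p)))))) (above-threshold q c)
          where
          first : ⟦ leq (suc q) (c + 0) ⟧ ≤ 0
          first with leq (suc q) (c + 0) in eq
          ... | false = z≤n
          ... | true  = ⊥-elim (nle (subst (suc q ≤_) (+-identityʳ c) (leq-sound eq)))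

        removed : ℕ → ℕ → ℕ
        removed q s = count (λ v → U v ∧ leq (suc s) (codeg y v)) + count (λ v → V v ∧ leq q (codeg x v + s))

        -- A vertex is removed for at most as many thresholds as its codegree, and on either side
        -- the codegrees sum to `edges`.
        removed-total : ∀ q → sum {q} (λ s → removed q (toℕ s)) ≤ 2 * edges
        removed-total q = begin
          sum {q} (λ s → removed q (toℕ s))
            ≡⟨ ∑-distrib-+ {q} (λ s → count (λ v → U v ∧ leq (suc (toℕ s)) (codeg y v))) (λ s → count (λ v → V v ∧ leq q (codeg x v + toℕ s))) ⟩
          sum {q} (λ s → sum (λ v → ⟦ U v ∧ leq (suc (toℕ s)) (codeg y v) ⟧)) + sum {q} (λ s → sum (λ v → ⟦ V v ∧ leq q (codeg x v + toℕ s) ⟧))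
            ≡⟨ cong₂ _+_ (∑-comm {q} (λ s v → ⟦ U v ∧ leq (suc (toℕ s)) (codeg y v) ⟧)) (∑-comm {q} (λ s v → ⟦ V v ∧ leq q (codeg x v + toℕ s) ⟧)) ⟩
          sum (λ v → sum {q} (λ s → ⟦ U v ∧ leq (suc (toℕ s)) (codeg y v) ⟧)) + sum (λ v → sum {q} (λ s → ⟦ V v ∧ leq q (codeg x v + toℕ s) ⟧))
            ≤⟨ +-mono-≤ (∑-mono (λ v → gate (U v) (λ s → leq (suc (toℕ s)) (codeg y v)) (below-threshold q (codeg y v))))
                        (∑-mono (λ v → gate (V v) (λ s → leq q (codeg x v + toℕ s)) (above-threshold q (codeg x v)))) ⟩
          edges + sum (λ v → ⟦ V v ⟧ * codeg x v)   ≡⟨ cong (_+_ edges) (trans edges-flip (sym (+-identityʳ edges))) ⟩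
          2 * edges ∎
          where
          open ≤-Reasoning
          gate : ∀ b (A : VSet q) {c} → count A ≤ c → count (λ s → b ∧ A s) ≤ ⟦ b ⟧ * c
          gate true  A {c} le = subst (count A ≤_) (sym (+-identityʳ c)) le
          gate false A le = ≤-reflexive (count-empty {q} {λ s → false} (λ s ()))

      opaque
        sparse-independent : ∀ q → 0 < q → q + (u + u) ≤ a + (deg x + deg y) →
          Σ[ J ∈ VSet n ] (J ⊆ W × Independent J × q * (deg x + deg y) ≤ q * count J + 2 * edges)
        sparse-independent q q>0 room with s , _ , le ← average {q} everything (λ s → removed q (toℕ s)) (subst (0 <_) (sym (count-everything q)) q>0) =
          Jₛ q (toℕ s) , inside , J-independent q (toℕ s) room (FinP.toℕ<n s) , large
          where
          inside : Jₛ q (toℕ s) ⊆ W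
          inside v p with ∨-elim {U v ∧ _} p
          ... | inj₁ r = ∧-elimˡ (∧-elimˡ r)
          ... | inj₂ r = ∧-elimˡ (∧-elimˡ r)

          split : deg x + deg y ≤ count (Jₛ q (toℕ s)) + (count (λ v → U v ∧ leq (suc (toℕ s)) (codeg y v)) + count (λ v → V v ∧ leq q (codeg x v + toℕ s)))
          split = tally 4 (λ v → U v ∷ V v ∷ leq (suc (toℕ s)) (codeg y v) ∷ leq q (codeg x v + toℕ s) ∷ []) (λ p r c d → not (p ∧ r))
            ((λ p r c d → p) ∷ (λ p r c d → r) ∷ []) ((λ p r c d → (p ∧ not c) ∨ (r ∧ not d)) ∷ (λ p r c d → p ∧ c) ∷ (λ p r c d → r ∧ d) ∷ []) refl disjoint

          le′ : q * removed q (toℕ s) ≤ 2 * edges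
          le′ = ≤-trans (subst (λ c → c * removed q (toℕ s) ≤ sum {q} (λ s → 1 * removed q (toℕ s))) (count-everything q) le)
            (≤-trans (∑-mono {q} (λ s → ≤-reflexive (*-identityˡ (removed q (toℕ s))))) (removed-total q))

          large : q * (deg x + deg y) ≤ q * count (Jₛ q (toℕ s)) + 2 * edges
          large = farkas (q ∷ deg x + deg y ∷ count (Jₛ q (toℕ s)) ∷ removed q (toℕ s) ∷ 2 * edges ∷ []) (x₀ :* x₁ :≤ x₀ :* x₂ :+ x₄)
            ((x₀ , x₁ :≤ x₂ :+ x₃) ∷ (κ 1 , x₀ :* x₃ :≤ x₄) ∷ []) refl (split ∷ le′ ∷ [])

  private
    -- Suppose 16 j < 27 t with t = 100 e + s. Then `E` exceeds q (5t + 16y) / 32, while E² is at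
    -- most M a³ / 2400. For e = y = 0 the comparison of squares reads 75 · 25 t⁴ against 32 · 54
    -- t⁴. Writing t as 100 e + s and `M` as 2t + y allows the general polynomial inequality to be
    -- checked coefficient by coefficient.
    threshold-arith : ∀ e s y q E a M j → 1 ≤ q → 99 * e + s + y ≤ q → M ≡ 2 * (100 * e + s) + y → a ≤ 3 * (100 * e + s) + e →
      q * M ≤ q * j + 2 * E → 2400 * (E * E) ≤ M * (a * a * a) → 27 * (100 * e + s) ≤ 16 * j
    threshold-arith e s y q E a M j q>0 q≥ M≡ a≤ cover edges = ≮⇒≥ (λ short → impossible (q ∷ q * X ∷ [])
        ((κ 1 , κ 75 :* ((x₁ :+ x₀) :* (x₁ :+ x₀)) :≤ κ 75 :* (x₁ :* x₁)) ∷ (κ 75 :* x₀ , κ 1 :≤ x₀) ∷ (κ 75 , κ 1 :≤ x₀) ∷ []) refl (main short ∷ q>0 ∷ q>0 ∷ []))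
      where
      t X : ℕ
      t = 100 * e + s
      X = 5 * t + 16 * y

      bound : ∀ q t y M j E → q * M ≤ q * j + 2 * E → 16 * j < 27 * t → 2 * t + y ≤ M → q * (5 * t + 16 * y) + q ≤ 32 * E
      bound q t y M j E cover short M≥ = farkas (q ∷ t ∷ y ∷ M ∷ j ∷ E ∷ []) (x₀ :* (κ 5 :* x₁ :+ κ 16 :* x₂) :+ x₀ :≤ κ 32 :* x₅)
        ((κ 16 , x₀ :* x₃ :≤ x₀ :* x₄ :+ κ 2 :* x₅) ∷ (x₀ , κ 1 :+ κ 16 :* x₄ :≤ κ 27 :* x₁) ∷ (κ 16 :* x₀ , κ 2 :* x₁ :+ x₂ :≤ x₃) ∷ []) refl
        (cover ∷ short ∷ M≥ ∷ [])

      square : ∀ p E c → p ≤ 32 * E → 2400 * (E * E) ≤ c → 75 * (p * p) ≤ 32 * c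
      square p E c le f = ≤-trans (*-monoʳ-≤ 75 (*-mono-≤ le le)) (farkas (E ∷ c ∷ []) (κ 75 :* (κ 32 :* x₀ :* (κ 32 :* x₀)) :≤ κ 32 :* x₁)
        ((κ 32 , κ 2400 :* (x₀ :* x₀) :≤ x₁) ∷ []) refl (f ∷ []))

      cube : ∀ M a b → a ≤ b → M * (a * a * a) ≤ M * (b * b * b)
      cube M a b le = *-monoʳ-≤ M (*-mono-≤ (*-mono-≤ le le) le)

      polynomial : ∀ e s y → 32 * ((2 * (100 * e + s) + y) * ((3 * (100 * e + s) + e) * (3 * (100 * e + s) + e) * (3 * (100 * e + s) + e)))
        ≤ 75 * ((99 * e + s + y) * (5 * (100 * e + s) + 16 * y) * ((99 * e + s + y) * (5 * (100 * e + s) + 16 * y)))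
      polynomial e s y = farkas (e ∷ s ∷ y ∷ [])
        (κ 32 :* ((κ 2 :* T :+ x₂) :* ((κ 3 :* T :+ x₀) :* (κ 3 :* T :+ x₀) :* (κ 3 :* T :+ x₀)))
          :≤ κ 75 :* (L :* (κ 5 :* T :+ κ 16 :* x₂) :* (L :* (κ 5 :* T :+ κ 16 :* x₂)))) [] refl []
        where
        T L : Expr
        T = κ 100 :* x₀ :+ x₁
        L = κ 99 :* x₀ :+ x₁ :+ x₂

      main : 16 * j < 27 * t → 75 * ((q * X + q) * (q * X + q)) ≤ 75 * (q * X * (q * X))
      main short = begin
        75 * ((q * X + q) * (q * X + q))
          ≤⟨ square (q * X + q) E (M * (a * a * a)) (bound q t y M j E cover short (≤-reflexive (sym M≡))) edges ⟩
        32 * (M * (a * a * a))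
          ≤⟨ *-monoʳ-≤ 32 (cube M a (3 * t + e) a≤) ⟩
        32 * (M * ((3 * t + e) * (3 * t + e) * (3 * t + e)))
          ≡⟨ cong (λ m → 32 * (m * ((3 * t + e) * (3 * t + e) * (3 * t + e)))) M≡ ⟩
        32 * ((2 * t + y) * ((3 * t + e) * (3 * t + e) * (3 * t + e)))
          ≤⟨ polynomial e s y ⟩
        75 * ((99 * e + s + y) * X * ((99 * e + s + y) * X))
          ≤⟨ *-monoʳ-≤ 75 (*-mono-≤ (*-monoˡ-≤ X q≥) (*-monoˡ-≤ X q≥)) ⟩
        75 * (q * X * (q * X)) ∎
        where open ≤-Reasoning

  -- A large independent set in the triangle-free remainder

  module DenseTriangleFree {n : ℕ} (G : Graph n) (W : VSet n) (tf : FiveWalks.TriangleFree G W) {u : ℕ} (misses : Cliques.MissesAtMost G u W)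
    (e : ℕ) (large : 3 * u ≤ 2 * count W + e) (small : 500 * e < u) where
    open Graph G
    open Cliques G
    open FiveWalks G

    private
      a t : ℕ
      a = count W
      t = a ∸ u

      u≤a : u ≤ a
      u≤a = farkas-refute (a ∷ u ∷ e ∷ []) x₁ x₀ (κ 2) ((κ 1 , κ 3 :* x₁ :≤ κ 2 :* x₀ :+ x₂) ∷ (κ 1 , κ 1 :+ κ 500 :* x₂ :≤ x₁) ∷ []) refl (large ∷ small ∷ [])

      a≡ : t + u ≡ a
      a≡ = m∸n+n≡m u≤a

      u≤ : u ≤ 2 * t + e
      u≤ = farkas (a ∷ u ∷ e ∷ t ∷ []) (x₁ :≤ κ 2 :* x₃ :+ x₂) ((κ 1 , κ 3 :* x₁ :≤ κ 2 :* x₀ :+ x₂) ∷ (κ 2 , x₀ :≤ x₃ :+ x₁) ∷ []) refl (large ∷ ≤-reflexive (sym a≡) ∷ [])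

      a≤ : a ≤ 3 * t + e
      a≤ = farkas (a ∷ u ∷ e ∷ t ∷ []) (x₀ :≤ κ 3 :* x₃ :+ x₂) ((κ 1 , x₁ :≤ κ 2 :* x₃ :+ x₂) ∷ (κ 1 , x₀ :≤ x₃ :+ x₁) ∷ []) refl (u≤ ∷ ≤-reflexive (sym a≡) ∷ [])

      t-large : 100 * e < t
      t-large = farkas-refute (u ∷ e ∷ t ∷ []) (κ 1 :+ κ 100 :* x₁) x₂ (κ 2) ((κ 1 , x₀ :≤ κ 2 :* x₂ :+ x₁) ∷ (κ 1 , κ 1 :+ κ 500 :* x₁ :≤ x₀) ∷ []) refl (u≤ ∷ small ∷ [])

      a>0 : 0 < a
      a>0 = farkas (a ∷ u ∷ e ∷ t ∷ []) (κ 1 :≤ x₀) ((κ 1 , x₃ :+ x₁ :≤ x₀) ∷ (κ 1 , κ 1 :+ κ 100 :* x₂ :≤ x₃) ∷ []) refl (≤-reflexive a≡ ∷ t-large ∷ [])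

      degree : ∀ x → x ∈ W → t ≤ count (W ∩ adj x)
      degree x x∈ = farkas (a ∷ u ∷ t ∷ count (W ∩ adj x) ∷ count (W ∖ adj x) ∷ []) (x₂ :≤ x₃)
        ((κ 1 , x₂ :+ x₁ :≤ x₀) ∷ (κ 1 , x₀ :≤ x₃ :+ x₄) ∷ (κ 1 , x₄ :≤ x₁) ∷ []) refl
        (≤-reflexive a≡ ∷ ≤-reflexive (count-∩∖ W (adj x)) ∷ misses x x∈ ∷ [])

      threshold : ∀ q E M j → 2 * t ≤ M → q + (u + u) ≡ a + M → q * M ≤ q * j + 2 * E → 2400 * (E * E) ≤ M * (a * a * a) → 27 * t ≤ 16 * j
      threshold q E M j 2t≤M q≡ cover edges = subst (λ t → 27 * t ≤ 16 * j) (sym t≡)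
        (threshold-arith e s y q E a M j
          (farkas (q ∷ u ∷ a ∷ M ∷ t ∷ e ∷ []) (κ 1 :≤ x₀) ((κ 1 , x₂ :+ x₃ :≤ x₀ :+ (x₁ :+ x₁)) ∷ (κ 1 , κ 2 :* x₄ :≤ x₃) ∷ (κ 1 , x₄ :+ x₁ :≤ x₂)
            ∷ (κ 1 , x₁ :≤ κ 2 :* x₄ :+ x₅) ∷ (κ 1 , κ 1 :+ κ 100 :* x₅ :≤ x₄) ∷ []) refl (≤-reflexive (sym q≡) ∷ 2t≤M ∷ ≤-reflexive a≡ ∷ u≤ ∷ t-large ∷ []))
          (farkas (q ∷ u ∷ a ∷ M ∷ t ∷ e ∷ s ∷ y ∷ []) (κ 99 :* x₅ :+ x₆ :+ x₇ :≤ x₀)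
            ((κ 1 , x₂ :+ x₃ :≤ x₀ :+ (x₁ :+ x₁)) ∷ (κ 1 , κ 2 :* x₄ :+ x₇ :≤ x₃) ∷ (κ 1 , x₄ :+ x₁ :≤ x₂) ∷ (κ 1 , x₁ :≤ κ 2 :* x₄ :+ x₅) ∷ (κ 1 , κ 100 :* x₅ :+ x₆ :≤ x₄) ∷ []) refl
            (≤-reflexive (sym q≡) ∷ ≤-reflexive y≡ ∷ ≤-reflexive a≡ ∷ u≤ ∷ ≤-reflexive (sym t≡) ∷ []))
          (trans (sym y≡) (cong (λ t → 2 * t + y) t≡)) (subst (λ t → a ≤ 3 * t + e) t≡ a≤) cover edges)
        where
        s = t ∸ 100 * e
        y = M ∸ 2 * t
        t≡ : t ≡ 100 * e + s
        t≡ = sym (m+[n∸m]≡n (<⇒≤ t-large))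
        y≡ : 2 * t + y ≡ M
        y≡ = m+[n∸m]≡n 2t≤M

    -- Eight colours, unless the largest independent set has almost u vertices

    module Cleaning (col : Fin n → ℕ) (proper : Families.Proper G W col 1)
      (best : ∀ col′ → Families.Proper G W col′ 1 → count (Families.below G W col′ 1) ≤ count (Families.below G W col 1))
      (long : 27 * t ≤ 16 * count (Families.cls G W col 0)) where
      open Families G W
      open OptimalFamily G W 1 col proper best using (hit)

      private
        J R : VSet n
        J = cls col 0
        R = outside col 1

        j : ℕ
        j = count J

        J-independent : Independent J
        J-independent = cls-independent proper (s≤s z≤n)

        covered : ∀ v → v ∈ W → v ∈ J ⊎ v ∈ R
        covered v v∈ with col v in c
        ... | zero  = inj₁ (∧-intro v∈ refl)
        ... | suc _ = inj₂ (∧-intro v∈ refl)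

        apart : ∀ v → not ((col v ≡ᵇ 0) ∧ not (col v <ᵇ 1)) ≡ true
        apart v with col v
        ... | zero  = refl
        ... | suc _ = refl

        total : ∀ v → (col v ≡ᵇ 0) ∨ not (col v <ᵇ 1) ≡ true
        total v with col v
        ... | zero  = refl
        ... | suc _ = refl

        a≡J+R : a ≡ j + count R
        a≡J+R = ≤-antisym
          (tally 3 (λ v → W v ∷ (col v ≡ᵇ 0) ∷ (col v <ᵇ 1) ∷ []) (λ w c b → c ∨ not b) ((λ w c b → w) ∷ []) ((λ w c b → w ∧ c) ∷ (λ w c b → w ∧ not b) ∷ []) refl total)
          (tally 3 (λ v → W v ∷ (col v ≡ᵇ 0) ∷ (col v <ᵇ 1) ∷ []) (λ w c b → not (c ∧ not b)) ((λ w c b → w ∧ c) ∷ (λ w c b → w ∧ not b) ∷ []) ((λ w c b → w) ∷ []) refl apart)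

        nJ nR : Fin n → ℕ
        nJ z = count (J ∩ adj z)
        nR z = count (R ∩ adj z)

        -- By `hit`, `z` has a neighbour `x` in `J`. The neighbours of `x` lie in `R` and are not
        -- adjacent to `z`, so they leave little room in `R` for the neighbours of `z`; the others
        -- are in `J`.
        J-neighbours : ∀ z → z ∈ R → 2 * t + j ≤ a + nJ z
        J-neighbours z z∈ with x , p ← hit z z∈ 0 (s≤s z≤n) = farkas
          (t ∷ j ∷ a ∷ count R ∷ nJ z ∷ count (W ∩ adj x) ∷ count (W ∩ adj z) ∷ []) (κ 2 :* x₀ :+ x₁ :≤ x₂ :+ x₄)
          ((κ 1 , x₀ :≤ x₅) ∷ (κ 1 , x₀ :≤ x₆) ∷ (κ 1 , x₅ :+ x₆ :≤ x₃ :+ x₄) ∷ (κ 1 , x₁ :+ x₃ :≤ x₂) ∷ []) refl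
          (degree x xW ∷ degree z zW
            ∷ tally 5 (λ v → W v ∷ (col v ≡ᵇ 0) ∷ (col v <ᵇ 1) ∷ adj x v ∷ adj z v ∷ [])
                (λ w c b p q → (c ∨ not b) ∧ not (w ∧ (p ∧ q)) ∧ not ((w ∧ c) ∧ p))
                ((λ w c b p q → w ∧ p) ∷ (λ w c b p q → w ∧ q) ∷ []) ((λ w c b p q → w ∧ not b) ∷ (λ w c b p q → (w ∧ c) ∧ q) ∷ []) refl
                (λ v → ∧-intro (total v) (∧-intro
                  (not-intro (λ r → let w , s = ∧-elim {W v} r ; xv , zv = ∧-elim {adj x v} s in tf z x v zW xW w zx zv xv))
                  (not-intro (λ r → let vJ , xv = ∧-elim {J v} r in J-independent x v xJ vJ xv))))
            ∷ ≤-reflexive (sym a≡J+R) ∷ [])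
          where
          zx = ∧-elimˡ {adj z x} p
          xJ = ∧-elimʳ {adj z x} p
          xW : x ∈ W
          xW = ∧-elimˡ xJ
          zW : z ∈ W
          zW = ∧-elimˡ z∈

        disjoint-J : ∀ v w → v ∈ W → w ∈ W → w ∈ adj v → nJ v + nJ w ≤ j
        disjoint-J v w v∈ w∈ vw = tally 4 (λ y → W y ∷ (col y ≡ᵇ 0) ∷ adj v y ∷ adj w y ∷ []) (λ m c p q → not (m ∧ (p ∧ q)))
          ((λ m c p q → (m ∧ c) ∧ p) ∷ (λ m c p q → (m ∧ c) ∧ q) ∷ []) ((λ m c p q → m ∧ c) ∷ []) refl
          (λ y → not-intro (λ r → let m , pq = ∧-elim {W y} r ; p , q = ∧-elim {adj v y} pq in tf v w y v∈ w∈ m vw p q))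

        degree-split : ∀ z → z ∈ W → t ≤ nJ z + nR z
        degree-split z z∈ = ≤-trans (degree z z∈) (tally 4 (λ v → W v ∷ (col v ≡ᵇ 0) ∷ (col v <ᵇ 1) ∷ adj z v ∷ []) (λ w c b p → c ∨ not b)
          ((λ w c b p → w ∧ p) ∷ []) ((λ w c b p → (w ∧ c) ∧ p) ∷ (λ w c b p → (w ∧ not b) ∧ p) ∷ []) refl total)

        Touching : Fin n → Fin n → Set
        Touching z z′ = Σ[ y ∈ Fin n ] y ∈ R ∩ (adj z ∩ adj z′)

        -- z, c and z′, c with common neighbours outside J: a closed walk of length five if z and z′ are adjacent.
        touching-apart : ∀ z z′ c → z ∈ R → z′ ∈ R → c ∈ R → z′ ∈ adj z → Touching c z → Touching c z′ → ⊥
        touching-apart z z′ c z∈ z′∈ c∈ zz′ (y , p) (y′ , p′) = impossible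
          (t ∷ j ∷ a ∷ e ∷ nJ z ∷ nJ y ∷ nJ c ∷ nJ y′ ∷ nJ z′ ∷ [])
          ((κ 16 , x₄ :+ (x₅ :+ (x₆ :+ (x₇ :+ x₈))) :≤ x₁ :+ x₁) ∷ (κ 16 , κ 2 :* x₀ :+ x₁ :≤ x₂ :+ x₄) ∷ (κ 16 , κ 2 :* x₀ :+ x₁ :≤ x₂ :+ x₅)
            ∷ (κ 16 , κ 2 :* x₀ :+ x₁ :≤ x₂ :+ x₆) ∷ (κ 16 , κ 2 :* x₀ :+ x₁ :≤ x₂ :+ x₇) ∷ (κ 16 , κ 2 :* x₀ :+ x₁ :≤ x₂ :+ x₈)
            ∷ (κ 80 , x₂ :≤ κ 3 :* x₀ :+ x₃) ∷ (κ 3 , κ 27 :* x₀ :≤ κ 16 :* x₁) ∷ (κ 1 , κ 1 :+ κ 100 :* x₃ :≤ x₀) ∷ []) refl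
          (walk-neighbours tf (cls⊆W col 0) (record
            { c₁ = z ; c₂ = y ; c₃ = c ; c₄ = y′ ; c₅ = z′ ; in₁ = ∧-elimˡ z∈ ; in₂ = ∧-elimˡ yR ; in₃ = ∧-elimˡ c∈ ; in₄ = ∧-elimˡ y′R ; in₅ = ∧-elimˡ z′∈
            ; e₁₂ = zy ; e₂₃ = adj-sym cy ; e₃₄ = cy′ ; e₄₅ = adj-sym z′y′ ; e₅₁ = adj-sym zz′ })
            ∷ J-neighbours z z∈ ∷ J-neighbours y yR ∷ J-neighbours c c∈ ∷ J-neighbours y′ y′R ∷ J-neighbours z′ z′∈ ∷ a≤ ∷ long ∷ t-large ∷ [])
          where
          yR : y ∈ R
          yR = ∧-elimˡ {R y} p
          y′R : y′ ∈ R
          y′R = ∧-elimˡ {R y′} p′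
          cy : y ∈ adj c
          cy = ∧-elimˡ (∧-elimʳ {R y} p)
          zy : y ∈ adj z
          zy = ∧-elimʳ {adj c y} (∧-elimʳ {R y} p)
          cy′ : y′ ∈ adj c
          cy′ = ∧-elimˡ (∧-elimʳ {R y′} p′)
          z′y′ : y′ ∈ adj z′
          z′y′ = ∧-elimʳ {adj c y′} (∧-elimʳ {R y′} p′)

        Packing : Set
        Packing = Σ[ k ∈ ℕ ] (Fin k → Fin n)

        Separated : Packing → Set
        Separated (k , zs) = (∀ i → zs i ∈ R × 2 * nJ (zs i) ≤ j) × (∀ i i′ → i ≢ i′ → ¬ Touching (zs i) (zs i′))

        -- The vertices of `R` with few neighbours in `J`. Neighbours in `R` of a member of a
        -- separated family are of this kind.
        R′ : VSet n
        R′ y = R y ∧ leq (nJ y + 2 * t) a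

        -- Separated vertices share no neighbour in `R`. A neighbour in `R` of such a vertex `z` has
        -- at most j - `nJ z` neighbours in `J`, so it lies in `R′` by `J-neighbours`.
        private-neighbours : ∀ k zs → Separated (k , zs) → sum (λ i → nR (zs i)) ≤ count R′
        private-neighbours k zs (inS , separate) = begin
          sum (λ i → sum (λ v → ⟦ (R ∩ adj (zs i)) v ⟧))   ≡⟨ ∑-comm (λ i v → ⟦ (R ∩ adj (zs i)) v ⟧) ⟩
          sum (λ v → count (λ i → (R ∩ adj (zs i)) v))     ≤⟨ ∑-mono pointwise ⟩
          count R′ ∎
          where
          open ≤-Reasoning
          once : ∀ v → count (λ i → (R ∩ adj (zs i)) v) ≤ 1
          once v = distinct-traces 0 (λ i → (R ∩ adj (zs i)) v) (λ _ → []) same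
            where
            same : ∀ i i′ → (R ∩ adj (zs i)) v ≡ true → (R ∩ adj (zs i′)) v ≡ true → [] ≡ [] → i ≡ i′
            same i i′ p q _ with i FinP.≟ i′
            ... | yes eq = eq
            ... | no ne  = ⊥-elim (separate i i′ ne (v , ∧-intro {R v} (∧-elimˡ {R v} p) (∧-intro (∧-elimʳ {R v} p) (∧-elimʳ {R v} q))))
          pointwise : ∀ v → count (λ i → (R ∩ adj (zs i)) v) ≤ ⟦ R′ v ⟧
          pointwise v with search (λ i → (R ∩ adj (zs i)) v)
          ... | inj₂ none    = subst (_≤ ⟦ R′ v ⟧) (sym (count-empty {A = λ i → (R ∩ adj (zs i)) v} none)) z≤n
          ... | inj₁ (i , p) = subst (λ b → count (λ i → (R ∩ adj (zs i)) v) ≤ ⟦ b ⟧) (sym member) (once v)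
            where
            vR : v ∈ R
            vR = ∧-elimˡ {R v} p
            member : R′ v ≡ true
            member = ∧-intro vR (leq-complete (farkas (nJ v ∷ nJ (zs i) ∷ j ∷ t ∷ a ∷ []) (x₀ :+ κ 2 :* x₃ :≤ x₄)
              ((κ 1 , x₁ :+ x₀ :≤ x₂) ∷ (κ 1 , κ 2 :* x₃ :+ x₂ :≤ x₄ :+ x₁) ∷ []) refl
              (disjoint-J (zs i) v (∧-elimˡ (proj₁ (inS i))) (∧-elimˡ vR) (∧-elimʳ {R v} p) ∷ J-neighbours (zs i) (proj₁ (inS i)) ∷ [])))

        -- Counting the edges between `J` and `R`: a vertex of `J` has all its neighbours, at least
        -- `t`, in `R`, and a vertex of `R′` falls short of `j` neighbours in `J` by at least 2t + j
        -- - a. This keeps `R′` small.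
        incidences : j * t + count R′ * (2 * t + j) ≤ count R * j + count R′ * a
        incidences = begin
          j * t + count R′ * (2 * t + j)
            ≤⟨ +-mono-≤ from-J ≤-refl ⟩
          sum (λ y → ⟦ R y ⟧ * nJ y) + count R′ * (2 * t + j)
            ≡⟨ cong (_+_ (sum (λ y → ⟦ R y ⟧ * nJ y))) (*-distribʳ-sum (2 * t + j) (λ y → ⟦ R′ y ⟧)) ⟩
          sum (λ y → ⟦ R y ⟧ * nJ y) + sum (λ y → ⟦ R′ y ⟧ * (2 * t + j))
            ≡⟨ ∑-distrib-+ (λ y → ⟦ R y ⟧ * nJ y) (λ y → ⟦ R′ y ⟧ * (2 * t + j)) ⟨
          sum (λ y → ⟦ R y ⟧ * nJ y + ⟦ R′ y ⟧ * (2 * t + j))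
            ≤⟨ ∑-mono (λ y → pointwise (R y) (leq (nJ y + 2 * t) a) (nJ y) leq-sound (count-mono (λ v p → ∧-elimˡ {J v} p))) ⟩
          sum (λ y → ⟦ R y ⟧ * j + ⟦ R′ y ⟧ * a)
            ≡⟨ ∑-distrib-+ (λ y → ⟦ R y ⟧ * j) (λ y → ⟦ R′ y ⟧ * a) ⟩
          sum (λ y → ⟦ R y ⟧ * j) + sum (λ y → ⟦ R′ y ⟧ * a)
            ≡⟨ cong₂ _+_ (*-distribʳ-sum j (λ y → ⟦ R y ⟧)) (*-distribʳ-sum a (λ y → ⟦ R′ y ⟧)) ⟨
          count R * j + count R′ * a ∎
          where
          open ≤-Reasoning
          pointwise : ∀ r l m → (l ≡ true → m + 2 * t ≤ a) → m ≤ j → ⟦ r ⟧ * m + ⟦ r ∧ l ⟧ * (2 * t + j) ≤ ⟦ r ⟧ * j + ⟦ r ∧ l ⟧ * a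
          pointwise false l     m f le = z≤n
          pointwise true  true  m f le = farkas (m ∷ t ∷ j ∷ a ∷ []) (κ 1 :* x₀ :+ κ 1 :* (κ 2 :* x₁ :+ x₂) :≤ κ 1 :* x₂ :+ κ 1 :* x₃)
            ((κ 1 , x₀ :+ κ 2 :* x₁ :≤ x₃) ∷ []) refl (f refl ∷ [])
          pointwise true  false m f le = +-monoˡ-≤ 0 (+-monoˡ-≤ 0 le)

          from-J : j * t ≤ sum (λ y → ⟦ R y ⟧ * nJ y)
          from-J = begin
            j * t                                                        ≡⟨ *-distribʳ-sum t (λ x → ⟦ J x ⟧) ⟩
            sum (λ x → ⟦ J x ⟧ * t)                                      ≤⟨ ∑-mono (λ x → outgoing x (J x) refl) ⟩
            sum (λ x → ⟦ J x ⟧ * nR x)                                   ≡⟨ sum-cong-≗ (λ x → *-distribˡ-sum ⟦ J x ⟧ (λ y → ⟦ (R ∩ adj x) y ⟧)) ⟩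
            sum (λ x → sum (λ y → ⟦ J x ⟧ * ⟦ (R ∩ adj x) y ⟧))          ≡⟨ ∑-comm (λ x y → ⟦ J x ⟧ * ⟦ (R ∩ adj x) y ⟧) ⟩
            sum (λ y → sum (λ x → ⟦ J x ⟧ * ⟦ (R ∩ adj x) y ⟧))          ≤⟨ ∑-mono (λ y → ∑-mono (λ x → flip (J x) (R y) (adj x y) (adj y x) adj-sym)) ⟩
            sum (λ y → sum (λ x → ⟦ R y ⟧ * ⟦ (J ∩ adj y) x ⟧))          ≡⟨ sum-cong-≗ (λ y → *-distribˡ-sum ⟦ R y ⟧ (λ x → ⟦ (J ∩ adj y) x ⟧)) ⟨
            sum (λ y → ⟦ R y ⟧ * nJ y) ∎
            where
            flip : ∀ u v c d → (c ≡ true → d ≡ true) → ⟦ u ⟧ * ⟦ v ∧ c ⟧ ≤ ⟦ v ⟧ * ⟦ u ∧ d ⟧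
            flip true  true  true  d f rewrite f refl = ≤-refl
            flip true  true  false d f = z≤n
            flip true  false c     d f = z≤n
            flip false v     c     d f = z≤n
            outgoing : ∀ x b → J x ≡ b → ⟦ b ⟧ * t ≤ ⟦ b ⟧ * nR x
            outgoing x false _ = z≤n
            outgoing x true  p = +-monoˡ-≤ 0 (farkas (t ∷ nJ x ∷ nR x ∷ []) (x₀ :≤ x₂) ((κ 1 , x₀ :≤ x₁ :+ x₂) ∷ (κ 1 , x₁ :≤ κ 0) ∷ []) refl
              (degree-split x (∧-elimˡ p) ∷ ≤-reflexive (count-empty {A = J ∩ adj x} (λ v q → J-independent x v p (∧-elimˡ {J v} q) (∧-elimʳ {J v} q))) ∷ []))

        -- A separated vertex has at most j / 2 neighbours in `J`, hence at least t - j / 2 in `R`,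
        -- and these sets are disjoint parts of `R′`.
        packing-total : ∀ k zs → Separated (k , zs) → k * (2 * t) ≤ k * j + 2 * count R′
        packing-total k zs sep = begin
          k * (2 * t)                                       ≡⟨ constant k (2 * t) ⟨
          sum {k} (λ i → 2 * t)                             ≤⟨ ∑-mono (λ i → each i) ⟩
          sum {k} (λ i → j + 2 * nR (zs i))                 ≡⟨ ∑-distrib-+ {k} (λ i → j) (λ i → 2 * nR (zs i)) ⟩
          sum {k} (λ i → j) + sum (λ i → 2 * nR (zs i))     ≡⟨ cong₂ _+_ (constant k j) (sym (*-distribˡ-sum 2 (λ i → nR (zs i)))) ⟩
          k * j + 2 * sum (λ i → nR (zs i))                 ≤⟨ +-monoʳ-≤ (k * j) (*-monoʳ-≤ 2 (private-neighbours k zs sep)) ⟩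
          k * j + 2 * count R′ ∎
          where
          open ≤-Reasoning
          constant : ∀ k c → sum {k} (λ _ → c) ≡ k * c
          constant zero    c = refl
          constant (suc k) c = cong (_+_ c) (constant k c)
          each : ∀ i → 2 * t ≤ j + 2 * nR (zs i)
          each i = farkas (t ∷ j ∷ nJ (zs i) ∷ nR (zs i) ∷ []) (κ 2 :* x₀ :≤ x₁ :+ κ 2 :* x₃)
            ((κ 2 , x₀ :≤ x₂ :+ x₃) ∷ (κ 1 , κ 2 :* x₂ :≤ x₁) ∷ []) refl (degree-split (zs i) (∧-elimˡ (proj₁ (proj₁ sep i))) ∷ proj₂ (proj₁ sep i) ∷ [])

        -- Here j = 2 e + 2 d + g and t = e + d + g, so g = 2 t - j measures how far J is from its largest possible size.
        packing-arith : ∀ e d g k P a r → let t = e + d + g ; j = 2 * e + 2 * d + g in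
          4 * e + 1 ≤ g → 27 * t ≤ 16 * j → 100 * e ≤ t → a ≤ 3 * t + e → r + j ≤ a →
          j * t + P * (2 * t + j) ≤ r * j + P * a → k * (2 * t) ≤ k * j + 2 * P → 7 ≤ k → ⊥
        packing-arith e d g k P a r far long t-large a≤ r≤ inc pack seven = impossible (e ∷ d ∷ g ∷ k ∷ P ∷ a ∷ r ∷ [])
          ((κ 132 :* x₂ :* x₁ , κ 7 :≤ x₃) ∷ (κ 132 :* x₁ , x₃ :* (κ 2 :* T) :≤ x₃ :* Jx :+ κ 2 :* x₄)
            ∷ (κ 264 , Jx :* T :+ x₄ :* (κ 2 :* T :+ Jx) :≤ x₆ :* Jx :+ x₄ :* x₅) ∷ (κ 264 :* Jx , x₆ :+ Jx :≤ x₅)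
            ∷ (κ 264 :* (x₄ :+ Jx) , x₅ :≤ κ 3 :* T :+ x₀) ∷ (κ 25 :* x₂ :+ κ 26 , κ 27 :* T :≤ κ 16 :* Jx)
            ∷ (κ 132 :* (x₁ :+ x₀) :+ κ 286 , κ 4 :* x₀ :+ κ 1 :≤ x₂) ∷ (κ 11 :* x₂ , κ 100 :* x₀ :≤ T) ∷ []) refl
          (seven ∷ pack ∷ inc ∷ r≤ ∷ a≤ ∷ long ∷ far ∷ t-large ∷ [])
          where
          T Jx : Expr
          T = x₀ :+ x₁ :+ x₂
          Jx = κ 2 :* x₀ :+ κ 2 :* x₁ :+ x₂

        separated≤6 : 4 * e + 1 + j ≤ 2 * t → ∀ p → Separated p → proj₁ p ≤ 6
        separated≤6 gap (k , zs) sep with k ≤? 6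
        ... | yes le = le
        ... | no nle = ⊥-elim (packing-arith e d g k (count R′) a (count R)
          (farkas (e ∷ j ∷ t ∷ g ∷ []) (κ 4 :* x₀ :+ κ 1 :≤ x₃) ((κ 1 , κ 4 :* x₀ :+ κ 1 :+ x₁ :≤ κ 2 :* x₂) ∷ (κ 1 , κ 2 :* x₂ :≤ x₁ :+ x₃) ∷ []) refl (gap ∷ ≤-reflexive (sym g≡) ∷ []))
          (subst₂ (λ t j → 27 * t ≤ 16 * j) t≡ j≡ long) (subst (100 * e ≤_) t≡ (<⇒≤ t-large)) (subst (λ t → a ≤ 3 * t + e) t≡ a≤)
          (subst (λ j → count R + j ≤ a) j≡ (≤-reflexive (trans (+-comm (count R) j) (sym a≡J+R))))
          (subst₂ (λ t j → j * t + count R′ * (2 * t + j) ≤ count R * j + count R′ * a) t≡ j≡ incidences)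
          (subst₂ (λ t j → k * (2 * t) ≤ k * j + 2 * count R′) t≡ j≡ (packing-total k zs sep)) (≰⇒> nle))
          where
          g d : ℕ
          g = 2 * t ∸ j
          d = j ∸ (t + e)
          g≡ : j + g ≡ 2 * t
          g≡ = m+[n∸m]≡n (≤-trans (m≤n+m j (4 * e + 1)) gap)
          d≡ : t + e + d ≡ j
          d≡ = m+[n∸m]≡n (farkas-refute (t ∷ e ∷ j ∷ []) (x₀ :+ x₁) x₂ (κ 16) ((κ 1 , κ 27 :* x₀ :≤ κ 16 :* x₂) ∷ (κ 11 , κ 1 :+ κ 100 :* x₁ :≤ x₀) ∷ []) refl (long ∷ t-large ∷ []))
          t≡ : t ≡ e + d + g
          t≡ = ≤-antisym
            (farkas (t ∷ e ∷ d ∷ g ∷ j ∷ []) (x₀ :≤ x₁ :+ x₂ :+ x₃) ((κ 1 , κ 2 :* x₀ :≤ x₄ :+ x₃) ∷ (κ 1 , x₄ :≤ x₀ :+ x₁ :+ x₂) ∷ []) refl (≤-reflexive (sym g≡) ∷ ≤-reflexive (sym d≡) ∷ []))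
            (farkas (t ∷ e ∷ d ∷ g ∷ j ∷ []) (x₁ :+ x₂ :+ x₃ :≤ x₀) ((κ 1 , x₄ :+ x₃ :≤ κ 2 :* x₀) ∷ (κ 1 , x₀ :+ x₁ :+ x₂ :≤ x₄) ∷ []) refl (≤-reflexive g≡ ∷ ≤-reflexive d≡ ∷ []))
          j≡ : j ≡ 2 * e + 2 * d + g
          j≡ = ≤-antisym
            (farkas (t ∷ e ∷ d ∷ g ∷ j ∷ []) (x₄ :≤ κ 2 :* x₁ :+ κ 2 :* x₂ :+ x₃) ((κ 1 , x₀ :≤ x₁ :+ x₂ :+ x₃) ∷ (κ 1 , x₄ :≤ x₀ :+ x₁ :+ x₂) ∷ []) refl (≤-reflexive t≡ ∷ ≤-reflexive (sym d≡) ∷ []))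
            (farkas (t ∷ e ∷ d ∷ g ∷ j ∷ []) (κ 2 :* x₁ :+ κ 2 :* x₂ :+ x₃ :≤ x₄) ((κ 1 , x₁ :+ x₂ :+ x₃ :≤ x₀) ∷ (κ 1 , x₀ :+ x₁ :+ x₂ :≤ x₄) ∷ []) refl (≤-reflexive (sym t≡) ∷ ≤-reflexive d≡ ∷ []))

        module Classes {k : ℕ} (zs : Fin k → Fin n) (sep : Separated (k , zs)) (largest : ∀ p → Separated p → proj₁ p ≤ k) where

          data View (v : Fin n) : ℕ → Set where
            inJ   : v ∈ J → View v 0
            heavy : v ∈ R → j < 2 * nJ v → View v 1
            light : ∀ i → v ∈ R → Touching (zs i) v → View v (2 + toℕ i)

          _◂_ : Fin n → (Fin k → Fin n) → Fin (suc k) → Fin n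
          (v ◂ zs) zero    = v
          (v ◂ zs) (suc i) = zs i

          extend : ∀ v → v ∈ R → 2 * nJ v ≤ j → (∀ i → ¬ Touching (zs i) v) → Separated (suc k , v ◂ zs)
          extend v v∈ l none = inS , separate
            where
            inS : ∀ i → (v ◂ zs) i ∈ R × 2 * nJ ((v ◂ zs) i) ≤ j
            inS zero    = v∈ , l
            inS (suc i) = proj₁ sep i
            flip : ∀ {z z′} → Touching z z′ → Touching z′ z
            flip {z} {z′} (y , p) = y , ∧-intro {R y} (∧-elimˡ {R y} p) (∧-intro (∧-elimʳ {adj z y} (∧-elimʳ {R y} p)) (∧-elimˡ {adj z y} (∧-elimʳ {R y} p)))
            separate : ∀ i i′ → i ≢ i′ → ¬ Touching ((v ◂ zs) i) ((v ◂ zs) i′)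
            separate zero    zero     ne = ⊥-elim (ne refl)
            separate zero    (suc i′) ne = none i′ ∘ flip
            separate (suc i) zero     ne = none i
            separate (suc i) (suc i′) ne = proj₂ sep i i′ (ne ∘ cong suc)

          touches : Fin n → VSet k
          touches v i = exists (R ∩ (adj (zs i) ∩ adj v))

          view : ∀ v → v ∈ W → Σ[ c ∈ ℕ ] View v c
          view v v∈ = decide (covered v v∈) (2 * nJ v ≤? j) (search (touches v))
            where
            decide : v ∈ J ⊎ v ∈ R → Dec (2 * nJ v ≤ j) → (Σ[ i ∈ Fin k ] i ∈ touches v) ⊎ (∀ i → ¬ i ∈ touches v) → Σ[ c ∈ ℕ ] View v c
            decide (inj₁ vJ) _ _ = 0 , inJ vJ
            decide (inj₂ vR) (no h) _ = 1 , heavy vR (≰⇒> h)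
            decide (inj₂ vR) (yes l) (inj₁ (i , p)) = 2 + toℕ i , light i vR (exists-witness (R ∩ (adj (zs i) ∩ adj v)) p)
            decide (inj₂ vR) (yes l) (inj₂ none) = ⊥-elim (<-irrefl refl (largest (suc k , v ◂ zs)
              (extend v vR l (λ i touch → exists-none (R ∩ (adj (zs i) ∩ adj v)) (none i) (proj₁ touch) (proj₂ touch)))))

          class : Fin n → ℕ
          class v with bool-em (W v)
          ... | inj₁ v∈ = proj₁ (view v v∈)
          ... | inj₂ _  = 0

          class-view : ∀ v → v ∈ W → View v (class v)
          class-view v v∈ with bool-em (W v)
          ... | inj₁ v∈′ = proj₂ (view v v∈′)
          ... | inj₂ v∉  = ⊥-elim (not-elim v∉ v∈)

          -- `J` is independent, two adjacent vertices cannot both see more than half of `J`, and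
          -- adjacent light vertices touch different elements of the family by `touching-apart`.
          -- Maximality gives every light vertex an element that it touches.
          colouring : Colouring W (2 + k)
          colouring = class , (λ v v∈ → bound (class-view v v∈)) , λ v w v∈ w∈ vw → differ v w v∈ w∈ vw (class-view v v∈) (class-view w w∈)
            where
            bound : ∀ {v c} → View v c → c < 2 + k
            bound (inJ _)       = s≤s z≤n
            bound (heavy _ _)   = s≤s (s≤s z≤n)
            bound (light i _ _) = s≤s (s≤s (FinP.toℕ<n i))
            differ : ∀ v w → v ∈ W → w ∈ W → w ∈ adj v → ∀ {c d} → View v c → View w d → c ≢ d
            differ v w v∈ w∈ vw (inJ p)       (inJ q)       = λ _ → J-independent v w p q vw
            differ v w v∈ w∈ vw (heavy _ p)   (heavy _ q)   = λ _ → impossible (nJ v ∷ nJ w ∷ j ∷ [])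
              ((κ 2 , x₀ :+ x₁ :≤ x₂) ∷ (κ 1 , κ 1 :+ x₂ :≤ κ 2 :* x₀) ∷ (κ 1 , κ 1 :+ x₂ :≤ κ 2 :* x₁) ∷ []) refl (disjoint-J v w v∈ w∈ vw ∷ p ∷ q ∷ [])
            differ v w v∈ w∈ vw (light i p c) (light i′ q d) = λ eq → touching-apart v w (zs i) p q (proj₁ (proj₁ sep i)) vw c
              (subst (λ i → Touching (zs i) w) (sym (FinP.toℕ-injective (suc-injective (suc-injective eq)))) d)
            differ v w v∈ w∈ vw (inJ _)       (heavy _ _)   = λ ()
            differ v w v∈ w∈ vw (inJ _)       (light _ _ _) = λ ()
            differ v w v∈ w∈ vw (heavy _ _)   (inJ _)       = λ ()
            differ v w v∈ w∈ vw (heavy _ _)   (light _ _ _) = λ ()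
            differ v w v∈ w∈ vw (light _ _ _) (inJ _)       = λ ()
            differ v w v∈ w∈ vw (light _ _ _) (heavy _ _)   = λ ()

      few-colours : 4 * e + 1 + j ≤ 2 * t → ∀ c → 8 ≤ c → ¬ Colouring W c → ⊥
      few-colours gap c enough no-colouring = maximise Separated proj₁ 6 (separated≤6 gap) (0 , λ ()) ((λ ()) , λ ())
        (λ { (k , zs) sep largest → let col , bound , differ = Classes.colouring zs sep largest in
          no-colouring (col , (λ v v∈ → <-≤-trans (bound v v∈) (≤-trans (s≤s (s≤s (separated≤6 gap (k , zs) sep))) enough)) , differ) })

    dense-triangle-free : ∀ c → 16 * 2 ^ 1280 < c → 8 ≤ c → ¬ Colouring W c →
      (∀ J → J ⊆ W → Independent J → u ≤ count J + 5 * e → 2 * a ≤ 3 * u + 4 * e → ⊥) → ⊥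
    dense-triangle-free c enough enough′ no-colouring found =
      SimilarPairs.similar-edge G W tf a>0 c enough no-colouring (λ x y x∈ y∈ xy similar →
        maximise (λ col → Proper col 1) (λ col → count (below col 1)) n (λ col _ → count≤n (below col 1)) (λ _ → 1) (λ v w _ _ _ _ lt → <-irrefl refl lt)
          (λ col proper best → few-or-found x y x∈ y∈ xy similar col proper best))
      where
      open Families G W

      below-one : ∀ col → count (below col 1) ≡ count (cls col 0)
      below-one col = trans (below-suc col 0) (cong (_+ count (cls col 0)) (count-empty (λ v p → case ∧-elimʳ {W v} p of λ ())))

      module _ (x y : Fin n) (x∈ : x ∈ W) (y∈ : y ∈ W) (xy : y ∈ adj x) (similar : 150 * Sampling.dist G W x y ≤ a * a * a)
        (col : Fin n → ℕ) (proper : Proper col 1) (best : ∀ col′ → Proper col′ 1 → count (below col′ 1) ≤ count (below col 1)) where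

        j M q : ℕ
        j = count (cls col 0)
        M = count (W ∩ adj x) + count (W ∩ adj y)
        q = a + M ∸ (u + u)

        largest : ∀ J → J ⊆ W → Independent J → count J ≤ j
        largest J J⊆W indep = ≤-trans (count-mono {A = J} {below col′ 1} inside) (subst (count (below col′ 1) ≤_) (below-one col) (best col′ proper′))
          where
          col′ : Fin n → ℕ
          col′ v = if J v then 0 else 1
          inside : J ⊆ below col′ 1
          inside v p rewrite p = ∧-intro (J⊆W v p) refl
          proper′ : Proper col′ 1
          proper′ v w v∈ w∈ vw same lt with J v in p | J w in r
          ... | true  | true  = indep v w p r vw
          ... | false | _     = <-irrefl refl lt
          ... | true  | false = case same of λ ()

        2t≤M : 2 * t ≤ M
        2t≤M = farkas (t ∷ count (W ∩ adj x) ∷ count (W ∩ adj y) ∷ []) (κ 2 :* x₀ :≤ x₁ :+ x₂) ((κ 1 , x₀ :≤ x₁) ∷ (κ 1 , x₀ :≤ x₂) ∷ []) refl (degree x x∈ ∷ degree y y∈ ∷ [])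

        q≡ : q + (u + u) ≡ a + M
        q≡ = m∸n+n≡m (farkas (a ∷ M ∷ u ∷ t ∷ e ∷ []) (x₂ :+ x₂ :≤ x₀ :+ x₁)
          ((κ 1 , x₃ :+ x₂ :≤ x₀) ∷ (κ 1 , κ 2 :* x₃ :≤ x₁) ∷ (κ 1 , x₂ :≤ κ 2 :* x₃ :+ x₄) ∷ (κ 1 , κ 1 :+ κ 100 :* x₄ :≤ x₃) ∷ []) refl (≤-reflexive a≡ ∷ 2t≤M ∷ u≤ ∷ t-large ∷ []))

        q>0 : 0 < q
        q>0 = farkas (q ∷ u ∷ a ∷ M ∷ t ∷ e ∷ []) (κ 1 :≤ x₀) ((κ 1 , x₂ :+ x₃ :≤ x₀ :+ (x₁ :+ x₁)) ∷ (κ 1 , κ 2 :* x₄ :≤ x₃) ∷ (κ 1 , x₄ :+ x₁ :≤ x₂)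
          ∷ (κ 1 , x₁ :≤ κ 2 :* x₄ :+ x₅) ∷ (κ 1 , κ 1 :+ κ 100 :* x₅ :≤ x₄) ∷ []) refl (≤-reflexive (sym q≡) ∷ 2t≤M ∷ ≤-reflexive a≡ ∷ u≤ ∷ t-large ∷ [])

        long : 27 * t ≤ 16 * j
        long = let J , J⊆W , indep , cover = SimilarEdge.sparse-independent G W tf x y x∈ y∈ xy similar misses q q>0 (≤-reflexive q≡) in
          threshold q (SimilarEdge.edges G W tf x y x∈ y∈ xy similar) M j 2t≤M q≡
            (≤-trans cover (+-monoˡ-≤ (2 * SimilarEdge.edges G W tf x y x∈ y∈ xy similar) (*-monoʳ-≤ q (largest J J⊆W indep))))
            (SimilarEdge.edges-small G W tf x y x∈ y∈ xy similar)

        few-or-found : ⊥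
        -- If 2t - j exceeds 4e, eight colours suffice. Otherwise j ≥ 2t - 4e, and with u ≤ 2t + e
        -- this is at least u - 5e.
        few-or-found with 4 * e + 1 + j ≤? 2 * t
        ... | yes gap = Cleaning.few-colours col proper best long gap c enough′ no-colouring
        ... | no near = found (cls col 0) (cls⊆W col 0) (cls-independent proper (s≤s z≤n))
          (farkas (a ∷ u ∷ t ∷ e ∷ j ∷ []) (x₁ :≤ x₄ :+ κ 5 :* x₃)
            ((κ 1 , κ 1 :+ κ 2 :* x₂ :≤ κ 4 :* x₃ :+ κ 1 :+ x₄) ∷ (κ 1 , x₁ :≤ κ 2 :* x₂ :+ x₃) ∷ []) refl (≰⇒> near ∷ u≤ ∷ []))
          (farkas (a ∷ u ∷ t ∷ e ∷ j ∷ []) (κ 2 :* x₀ :≤ κ 3 :* x₁ :+ κ 4 :* x₃)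
            ((κ 1 , κ 1 :+ κ 2 :* x₂ :≤ κ 4 :* x₃ :+ κ 1 :+ x₄) ∷ (κ 1 , x₄ :≤ x₁) ∷ (κ 2 , x₀ :≤ x₂ :+ x₁) ∷ []) refl
            (≰⇒> near ∷ cls-size misses proper (s≤s z≤n) ∷ ≤-reflexive (sym a≡) ∷ []))

  -- k + 1 classes covering almost (k + 1) u vertices

  module NearStructure {n : ℕ} (G : Graph n) {u : ℕ} (misses : Cliques.MissesAtMost G u everything) (e k : ℕ)
    (free : ¬ Cliques.Clique G everything (3 + k)) (large : (2 * k + 3) * u ≤ 2 * count {n} everything + e)
    (small : 1000 * (suc k * e) < u) where
    open Graph G
    open Cliques G
    open FiveWalks G
    open Wheels G
    open WheelExistence G
    open Families G everything

    Nearly : (Fin n → ℕ) → Set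
    Nearly col = Proper col (suc k) × suc k * u ≤ count (below col (suc k)) + 8 * (suc k * e)

    add-class : ∀ col J → Proper col k → J ⊆ outside col k → Independent J →
      suc k * u ≤ count (below col k) + count J + 8 * (suc k * e) → Σ[ col′ ∈ (Fin n → ℕ) ] Nearly col′
    add-class col J proper J⊆ indep room = col′ , proper′ , ≤-trans room (+-monoˡ-≤ (8 * (suc k * e)) grown)
      where
      col′ : Fin n → ℕ
      -- `J` becomes class `k`; the other vertices outside the family move to colour k + 1, because
      -- some of them may have had colour `k`.
      col′ v = if J v then k else if col v <ᵇ k then col v else suc k

      proper′ : Proper col′ (suc k)
      proper′ v w v∈ w∈ vw same lt with J v in p | J w in q
      ... | true  | true  = indep v w p q vw
      ... | true  | false with col w <ᵇ k in cw
      ...   | true  = <-irrefl (sym same) (<ᵇ-true (col w) k cw)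
      ...   | false = <-irrefl same lt
      proper′ v w v∈ w∈ vw same lt | false | true with col v <ᵇ k in cv
      ...   | true  = <-irrefl same (<ᵇ-true (col v) k cv)
      ...   | false = <-irrefl refl lt
      proper′ v w v∈ w∈ vw same lt | false | false with col v <ᵇ k in cv | col w <ᵇ k in cw
      ...   | true  | true  = proper v w v∈ w∈ vw same (<ᵇ-true (col v) k cv)
      ...   | true  | false = <-irrefl same lt
      ...   | false | _     = <-irrefl refl lt

      grown : count (below col k) + count J ≤ count (below col′ (suc k))
      grown = tally 3 (λ v → J v ∷ (col v <ᵇ k) ∷ (col′ v <ᵇ suc k) ∷ []) (λ m b b′ → not (m ∧ b) ∧ (m ⇒ b′) ∧ (b ⇒ b′))
        ((λ m b b′ → b) ∷ (λ m b b′ → m) ∷ []) ((λ m b b′ → b′) ∷ []) refl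
        (λ v → ∧-intro (not-intro (λ p → outside-colour col k v (J⊆ v (∧-elimˡ p)) (<ᵇ-true (col v) k (∧-elimʳ {J v} p))))
          (∧-intro (⇒-intro (new v)) (⇒-intro (old v))))
        where
        new : ∀ v → J v ≡ true → (col′ v <ᵇ suc k) ≡ true
        new v p rewrite p = true-<ᵇ (n<1+n k)
        old : ∀ v → (col v <ᵇ k) ≡ true → (col′ v <ᵇ suc k) ≡ true
        old v p with J v
        ... | true  = true-<ᵇ (n<1+n k)
        ... | false rewrite p = true-<ᵇ (m≤n⇒m≤1+n (<ᵇ-true (col v) k p))

    private
      weaken : ∀ {c d} → c ≤ d → Colouring everything c → Colouring everything d
      weaken le (col , bound , proper) = col , (λ v p → <-≤-trans (bound v p) le) , proper

      e<u : ∀ m → m ≤ 1000 → m * e < u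
      e<u m le = ≤-<-trans (*-mono-≤ le (m≤m+n e (k * e))) small

    -- A wheel gives a dense family, which is enlarged to one of maximum size. Either two adjacent
    -- outside vertices have no common neighbour in some class, and `pair-structure` supplies one
    -- more class, or the remainder is triangle-free and `dense-triangle-free` supplies it.
    near-structure : ∀ c → 16 * 2 ^ 1280 < c → 8 ≤ c → ¬ Colouring everything (c + k) → (∀ col → Nearly col → ⊥) → ⊥
    near-structure c enough enough′ no-colouring found =
      wheel-exists k everything misses free large (≤-<-trans (*-monoˡ-≤ (suc k * e) {30} {1000} (≤ᵇ-true 30 1000 refl)) small)
        no-few (λ w → optimal-family everything k (WheelFamily.col G everything misses e k free large w₂₁ w) (WheelFamily.wheel-proper G everything misses e k free large w₂₁ w)
          (λ best proper optimal → extend best proper optimal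
            (<-≤-trans (WheelFamily.wheel-dense G everything misses e k free large w₂₁ w)
              (+-monoˡ-≤ u (*-monoʳ-≤ 2 (optimal _ (WheelFamily.wheel-proper G everything misses e k free large w₂₁ w)))))))
      where
      w₂₁ : 21 * e < u
      w₂₁ = e<u 21 (≤ᵇ-true 21 1000 refl)

      no-few : ¬ Colouring everything (2 + k)
      no-few = no-colouring ∘ weaken (+-monoˡ-≤ k (≤-trans (s≤s (s≤s z≤n)) enough′))

      extend : ∀ col → Proper col k → (∀ col′ → Proper col′ k → count (below col′ k) ≤ count (below col k)) →
        2 * (k * u) + e < 2 * count (below col k) + u → ⊥
      extend col proper best dense = DenseTriangleFree.dense-triangle-free G Z tf (misses-mono Z⊆W misses) e outside-large (e<u 500 (≤ᵇ-true 500 1000 refl)) c enough enough′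
        (no-colouring ∘ extend-colouring c)
        -- From 2 |Z| ≤ 3u + 4e the k classes lose at most 5e / 2 against k u, and `J` loses at most
        -- 5e against u, together less than the 8e allowed.
        (λ J J⊆Z indep J-large Z-small → let col′ , near = add-class col J proper J⊆Z indep
                                                (farkas-refute (k ∷ u ∷ e ∷ count {n} everything ∷ count B ∷ count Z ∷ count J ∷ [])
                                                  ((κ 1 :+ x₀) :* x₁) (x₄ :+ x₆ :+ κ 8 :* ((κ 1 :+ x₀) :* x₂)) (κ 2)
                                                  ((κ 2 , x₁ :≤ x₆ :+ κ 5 :* x₂) ∷ (κ 1 , κ 2 :* x₅ :≤ κ 3 :* x₁ :+ κ 4 :* x₂) ∷ (κ 2 , x₃ :≤ x₄ :+ x₅)
                                                    ∷ (κ 1 , (κ 2 :* x₀ :+ κ 3) :* x₁ :≤ κ 2 :* x₃ :+ x₂) ∷ []) refl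
                                                  (J-large ∷ Z-small ∷ ≤-reflexive (below+outside col k) ∷ large ∷ [])) in
          found col′ near)
        where
        sm : 2 * k * e + 7 * e < u
        sm = farkas (k ∷ e ∷ u ∷ []) (κ 1 :+ (κ 2 :* x₀ :* x₁ :+ κ 7 :* x₁) :≤ x₂) ((κ 1 , κ 1 :+ κ 1000 :* ((κ 1 :+ x₀) :* x₁) :≤ x₂) ∷ []) refl (small ∷ [])
        open OptimalFamily G everything k col proper best using (hit; exchange)
        open MaximalFamily G everything misses e k free large col proper dense hit exchange
        open FamilyWheel G everything misses e k free large sm col proper dense best using (outside-large; extend-colouring; classes-total)

        some : ∀ z z′ j → z ∈ Z → z′ ∈ Z → z′ ∈ adj z → j < k → ¬ NoCommon z z′ j
        some z z′ j z∈ z′∈ zz′ j<k none = let big , J , J⊆Z , indep , J-large = pair-structure z z′ j z∈ z′∈ j<k none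
                                              col′ , near = add-class col J proper J⊆Z indep (farkas (k ∷ u ∷ e ∷ count B ∷ count J ∷ [])
                                                ((κ 1 :+ x₀) :* x₁ :≤ x₃ :+ x₄ :+ κ 8 :* ((κ 1 :+ x₀) :* x₂))
                                                ((κ 1 , x₁ :≤ x₄ :+ x₂) ∷ (κ 1 , x₀ :* x₁ :≤ x₃ :+ x₀ :* x₂) ∷ []) refl (J-large ∷ classes-total k big ∷ [])) in
          found col′ near

        tf : TriangleFree Z
        tf = triangle-free some

  any-vec? : ∀ {m} n (P : Vec (Fin m) n → Set) → (∀ c → Dec (P c)) → Dec (Σ[ c ∈ Vec (Fin m) n ] P c)
  any-vec? zero    P P? with P? []
  ... | yes p = yes ([] , p)
  ... | no np = no λ { ([] , p) → np p }
  any-vec? (suc n) P P? with FinP.any? (λ x → any-vec? n (λ c → P (x ∷ c)) (λ c → P? (x ∷ c)))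
  ... | yes (x , c , p) = yes (x ∷ c , p)
  ... | no none         = no λ { (x ∷ c , p) → none (x , c , p) }

  -- The final family and the types of the remaining vertices

  module FinalStructure {n : ℕ} (G : Graph n) {u : ℕ} (misses : Cliques.MissesAtMost G u everything) (e k : ℕ)
    (free : ¬ Cliques.Clique G everything (3 + k)) (large : (2 * k + 3) * u ≤ 2 * count {n} everything + e)
    (small : 1000 * (suc k * e) < u) where
    open Graph G
    open Cliques G
    open FiveWalks G
    open Families G everything

    K D : ℕ
    K = suc k
    D = 8 * (K * e)

    -- Of the maximality of the family only its consequence `hit` is kept, which can be decided
    -- directly for a given colouring.
    record Tight (col : Fin n → ℕ) : Set where
      field
        proper  : Proper col K
        covers  : K * u ≤ count (below col K) + D
        hit     : ∀ z → z ∈ outside col K → ∀ j → j < K → Σ[ v ∈ Fin n ] v ∈ adj z ∩ cls col j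
    open Tight

    private
      proper? : ∀ col → Dec (Proper col K)
      proper? col = FinP.all? λ v → FinP.all? λ w →
        everything v ≟ᵇ true →-dec everything w ≟ᵇ true →-dec (adj v w ≟ᵇ true →-dec (col v ≟ col w →-dec (col v <? K →-dec no id)))

      tight? : ∀ col → Dec (Tight col)
      tight? col with proper? col | K * u ≤? count (below col K) + D
        | FinP.all? (λ z → outside col K z ≟ᵇ true →-dec allUpTo? (λ j → FinP.any? (λ v → (adj z ∩ cls col j) v ≟ᵇ true)) K)
      ... | yes p | yes c | yes h = yes (record { proper = p ; covers = c ; hit = λ z z∈ j j<K → h z z∈ j<K })
      ... | no np | _     | _     = no (np ∘ proper)
      ... | _     | no nc | _     = no (nc ∘ covers)
      ... | _     | _     | no nh = no (λ t → nh (λ z z∈ {j} j<K → hit t z z∈ j j<K))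

      -- Replacing all colours of left-out vertices by K leaves a colouring that finite search can find.
      module Truncation (col : Fin n → ℕ) where
        code : Fin n → Fin (suc K)
        code v = fromℕ< (s≤s (m⊓n≤n (col v) K))

        short : Fin n → ℕ
        short v = toℕ (Vec.lookup (Vec.tabulate code) v)

        short≡ : ∀ v → short v ≡ col v ⊓ K
        short≡ v = trans (cong toℕ (VecP.lookup∘tabulate code v)) (FinP.toℕ-fromℕ< _)

        short< : ∀ {v} → short v < K → short v ≡ col v
        short< {v} lt with ≤-total (col v) K
        ... | inj₁ le = trans (short≡ v) (m≤n⇒m⊓n≡m le)
        ... | inj₂ ge = ⊥-elim (<-irrefl (trans (short≡ v) (m≥n⇒m⊓n≡n ge)) lt)

        col< : ∀ {v} → col v < K → short v < K
        col< {v} lt = subst (_< K) (sym (trans (short≡ v) (m≤n⇒m⊓n≡m (<⇒≤ lt)))) lt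

        short-proper : Proper col K → Proper short K
        short-proper proper v w v∈ w∈ vw same lt = proper v w v∈ w∈ vw
          (trans (sym (short< lt)) (trans same (short< (subst (_< K) same lt)))) (subst (_< K) (short< lt) lt)

        short-below : count (below col K) ≤ count (below short K)
        short-below = count-mono (λ v p → in-below short K v refl (col< (below-colour col K v p)))

      vector : Vec (Fin (suc K)) n → Fin n → ℕ
      vector c v = toℕ (Vec.lookup c v)

    -- There are finitely many colour vectors and the property is decidable, so the double negation
    -- left by the extremal arguments can be removed here.
    tight-family : ∀ c → 16 * 2 ^ 1280 < c → 8 ≤ c → ¬ Colouring everything (c + k) → Σ[ col ∈ (Fin n → ℕ) ] Tight col
    tight-family c enough enough′ no-colouring =
      let code , tight = decidable-stable (any-vec? n (Tight ∘ vector) (tight? ∘ vector)) found in vector code , tight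
      where
      found : ¬ ¬ (Σ[ code ∈ Vec (Fin (suc K)) n ] Tight (vector code))
      found none = NearStructure.near-structure G misses e k free large small c enough enough′ no-colouring (λ col near →
        WheelExistence.optimal-family G everything K col (proj₁ near) (λ best proper optimal →
          let open Truncation best in
          none (Vec.tabulate code , record
            { proper = short-proper proper
            ; covers = ≤-trans (proj₂ near) (+-monoˡ-≤ D (≤-trans (optimal col (proj₁ near)) short-below))
            ; hit    = OptimalFamily.hit G everything K short (short-proper proper) (λ col′ p → ≤-trans (optimal col′ p) short-below)
            })))

    module Parts (e>0 : 0 < e) (no-colouring : ¬ Colouring everything (2 + k)) (col : Fin n → ℕ) (tight : Tight col) where
      open TransversalCliques (proper tight)

      B R : VSet n
      B = below col K
      R = outside col K

      miss : Fin n → ℕ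
      miss z = count (B ∖ adj z)

      private
        bound : ∀ z → count (everything ∖ adj z) ≤ u
        bound z = misses z refl

      opaque
        miss≤u : ∀ z → miss z ≤ u
        miss≤u z = ≤-trans (count-mono (λ v p → ∧-elimʳ {B v} p)) (bound z)

        room : ∀ m → m ≤ u + e + 2 * D → 2 * (K * u) + m < 2 * count B + 2 * u
        room m le = farkas (k ∷ u ∷ e ∷ count B ∷ m ∷ []) (κ 1 :+ (κ 2 :* ((κ 1 :+ x₀) :* x₁) :+ x₄) :≤ κ 2 :* x₃ :+ κ 2 :* x₁)
          ((κ 2 , (κ 1 :+ x₀) :* x₁ :≤ x₃ :+ κ 8 :* ((κ 1 :+ x₀) :* x₂)) ∷ (κ 1 , x₄ :≤ x₁ :+ x₂ :+ κ 2 :* (κ 8 :* ((κ 1 :+ x₀) :* x₂)))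
            ∷ (κ 1 , κ 1 :+ κ 1000 :* ((κ 1 :+ x₀) :* x₂) :≤ x₁) ∷ []) refl (covers tight ∷ le ∷ small ∷ [])

        inner-clique : ∀ z → z ∈ R → Clique (adj z ∩ B) K
        inner-clique z z∈ = clique-in-classes misses K (adj z) (proper tight) (hit tight z z∈)
          (room (miss z) (≤-trans (miss≤u z) (≤-trans (m≤m+n u e) (m≤m+n (u + e) (2 * D)))))

        -- A neighbour of `z` in `R` adjacent to all of `C` would complete `C` and `z` to a clique
        -- of k + 3 vertices, and `kills` bounds the vertices of `R` that miss some element of `C`.
        R-degree : ∀ z → z ∈ R → count (R ∩ adj z) ≤ D
        R-degree z z∈ = farkas (count (R ∩ adj z) ∷ count (R ∖ common C) ∷ count B ∷ K * u ∷ D ∷ []) (x₀ :≤ x₄)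
          ((κ 1 , x₀ :≤ x₁) ∷ (κ 1 , x₁ :+ x₂ :≤ x₃) ∷ (κ 1 , x₃ :≤ x₂ :+ x₄) ∷ []) refl
          (count-mono (λ v p → ∧-intro (∧-elimˡ {R v} p) (not-intro (uncommon v p))) ∷ kills misses (adj z) C ∷ covers tight ∷ [])
          where
          C : Clique (adj z ∩ B) K
          C = inner-clique z z∈
          uncommon : ∀ v → v ∈ R ∩ adj z → v ∈ common C → ⊥
          uncommon v p c = free (subst (Clique everything) (+-comm K 2) (append (λ _ _ → refl) C
            (cons z (member-common C (λ w q → ∧-elimˡ {adj z w} q)) (cons v (∧-intro c (∧-elimʳ {R v} p)) nil))))

        -- Almost all of `R` is missed by `z`, which leaves about u - |R| misses for `B`.
        outside-degree : ∀ z → z ∈ R → count R + miss z ≤ D + u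
        outside-degree z z∈ = ≤-trans
          (tally 2 (λ v → (col v <ᵇ K) ∷ adj z v ∷ []) (λ _ _ → true)
            ((λ b x → not b) ∷ (λ b x → b ∧ not x) ∷ []) ((λ b x → not b ∧ x) ∷ (λ b x → not x) ∷ []) refl (λ _ → refl))
          (+-mono-≤ (R-degree z z∈) (bound z))

        R-large : u ≤ 2 * count R + e
        R-large = farkas (k ∷ u ∷ e ∷ count {n} everything ∷ count B ∷ count R ∷ []) (x₁ :≤ κ 2 :* x₅ :+ x₂)
          ((κ 2 , x₃ :≤ x₄ :+ x₅) ∷ (κ 2 , x₄ :≤ (κ 1 :+ x₀) :* x₁) ∷ (κ 1 , (κ 2 :* x₀ :+ κ 3) :* x₁ :≤ κ 2 :* x₃ :+ x₂) ∷ []) refl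
          (≤-reflexive (below+outside col K) ∷ below-size misses K (proper tight) ∷ large ∷ [])

        miss-half : ∀ z → z ∈ R → 2 * miss z ≤ u + e + 2 * D
        miss-half z z∈ = farkas (u ∷ e ∷ D ∷ count R ∷ miss z ∷ []) (κ 2 :* x₄ :≤ x₀ :+ x₁ :+ κ 2 :* x₂)
          ((κ 2 , x₃ :+ x₄ :≤ x₂ :+ x₀) ∷ (κ 1 , x₀ :≤ κ 2 :* x₃ :+ x₁) ∷ []) refl (outside-degree z z∈ ∷ R-large ∷ [])

        class-large : ∀ j → j < K → u ≤ count (cls col j) + D
        class-large j j<K = farkas (k ∷ u ∷ count B ∷ D ∷ count (cls col j) ∷ count (B ∖ cls col j) ∷ []) (x₁ :≤ x₄ :+ x₃)
          ((κ 1 , (κ 1 :+ x₀) :* x₁ :≤ x₂ :+ x₃) ∷ (κ 1 , x₂ :≤ x₄ :+ x₅) ∷ (κ 1 , x₅ :+ x₁ :≤ (κ 1 :+ x₀) :* x₁) ∷ []) refl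
          (covers tight ∷ ≤-reflexive (trans (count-∩∖ B (cls col j)) (cong (_+ count (B ∖ cls col j)) (sym (within j<K)))) ∷ other-classes misses K (proper tight) j<K ∷ [])
          where
          within : j < K → count (cls col j) ≡ count (B ∩ cls col j)
          within j<K = ≤-antisym (count-mono (λ v p → ∧-intro (cls-below col j<K v p) p)) (count-mono (λ v p → ∧-elimʳ {B v} p))

      NoCommon : Fin n → Fin n → ℕ → Set
      NoCommon z z′ j = ∀ v → ¬ v ∈ (adj z ∩ adj z′) ∩ cls col j

      -- By `miss-half` there would otherwise be a clique of `K` vertices in the common
      -- neighbourhood of `z` and `z′`, and the edge would extend it to k + 3 vertices.
      some-no-common : ∀ z z′ → z ∈ R → z′ ∈ R → z′ ∈ adj z → Σ[ j ∈ ℕ ] j < K × NoCommon z z′ j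
      some-no-common z z′ z∈ z′∈ zz′ with anyUpTo? (λ j → FinP.all? λ v → ¬? (((adj z ∩ adj z′) ∩ cls col j) v ≟ᵇ true)) K
      ... | yes found = found
      ... | no none   = ⊥-elim (free (subst (Clique everything) (+-comm K 2) (append (λ _ _ → refl) C
          (cons z (member-common C (λ w q → ∧-elimˡ (∧-elimˡ {adj z w ∧ adj z′ w} q)))
            (cons z′ (∧-intro (member-common C (λ w q → ∧-elimʳ {adj z w} (∧-elimˡ {adj z w ∧ adj z′ w} q))) zz′) nil)))))
        where
        meets : ∀ j → j < K → Σ[ v ∈ Fin n ] v ∈ (adj z ∩ adj z′) ∩ cls col j
        meets j j<K with search ((adj z ∩ adj z′) ∩ cls col j)
        ... | inj₁ found = found
        ... | inj₂ empty = ⊥-elim (none (j , j<K , empty))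

        union : count (B ∖ (adj z ∩ adj z′)) ≤ miss z + miss z′
        union = tally 3 (λ v → B v ∷ adj z v ∷ adj z′ v ∷ []) (λ _ _ _ → true)
          ((λ b x y → b ∧ not (x ∧ y)) ∷ []) ((λ b x y → b ∧ not x) ∷ (λ b x y → b ∧ not y) ∷ []) refl (λ _ → refl)

        C : Clique ((adj z ∩ adj z′) ∩ B) K
        C = clique-in-classes misses K (adj z ∩ adj z′) (proper tight) meets (room (count (B ∖ (adj z ∩ adj z′)))
          (farkas-refute (u ∷ e ∷ D ∷ miss z ∷ miss z′ ∷ count (B ∖ (adj z ∩ adj z′)) ∷ []) x₅ (x₀ :+ x₁ :+ κ 2 :* x₂) (κ 2)
            ((κ 1 , κ 2 :* x₃ :≤ x₀ :+ x₁ :+ κ 2 :* x₂) ∷ (κ 1 , κ 2 :* x₄ :≤ x₀ :+ x₁ :+ κ 2 :* x₂) ∷ (κ 2 , x₅ :≤ x₃ :+ x₄) ∷ []) refl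
            (miss-half z z∈ ∷ miss-half z′ z′∈ ∷ union ∷ [])))

      class-miss : Fin n → ℕ → ℕ
      class-miss z j = count (cls col j ∖ adj z)

      opaque
        class-miss≤ : ∀ z j → j < K → class-miss z j ≤ miss z
        class-miss≤ z j j<K = count-mono (∩-monoˡ (λ v → not (adj z v)) (cls-below col j<K))

        no-common-misses : ∀ z z′ j → NoCommon z z′ j → count (cls col j) ≤ class-miss z j + class-miss z′ j
        no-common-misses z z′ j none = tally 3 (λ v → cls col j v ∷ adj z v ∷ adj z′ v ∷ []) (λ c x y → not ((x ∧ y) ∧ c))
          ((λ c x y → c) ∷ []) ((λ c x y → c ∧ not x) ∷ (λ c x y → c ∧ not y) ∷ []) refl (λ v → not-intro (none v))

      -- The fraction one third makes types exist and be unique: an end of an edge of `R` misses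
      -- almost half of some class or more, while no vertex of `R` misses much more than u / 2
      -- vertices of `B`, too few for a third of `u` in two classes.
      HasType : Fin n → ℕ → Set
      HasType z j = j < K × u ≤ 3 * class-miss z j

      opaque
        no-common-type : ∀ z z′ j → z′ ∈ R → j < K → NoCommon z z′ j → HasType z j
        no-common-type z z′ j z′∈ j<K none = j<K , farkas-refute
          (k ∷ u ∷ e ∷ count (cls col j) ∷ class-miss z j ∷ class-miss z′ j ∷ miss z′ ∷ []) x₁ (κ 3 :* x₄) (κ 2)
          ((κ 6 , x₃ :≤ x₄ :+ x₅) ∷ (κ 6 , x₅ :≤ x₆) ∷ (κ 6 , x₁ :≤ x₃ :+ κ 8 :* ((κ 1 :+ x₀) :* x₂))
            ∷ (κ 3 , κ 2 :* x₆ :≤ x₁ :+ x₂ :+ κ 2 :* (κ 8 :* ((κ 1 :+ x₀) :* x₂))) ∷ (κ 1 , κ 1 :+ κ 1000 :* ((κ 1 :+ x₀) :* x₂) :≤ x₁) ∷ []) refl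
          (no-common-misses z z′ j none ∷ class-miss≤ z′ j j<K ∷ class-large j j<K ∷ miss-half z′ z′∈ ∷ small ∷ [])

        type-unique : ∀ z i j → z ∈ R → HasType z i → HasType z j → i ≡ j
        type-unique z i j z∈ (i<K , ui) (j<K , uj) with i ≟ j
        ... | yes eq = eq
        ... | no i≢j = ⊥-elim (impossible (k ∷ u ∷ e ∷ class-miss z i ∷ class-miss z j ∷ miss z ∷ [])
            ((κ 2 , x₁ :≤ κ 3 :* x₃) ∷ (κ 2 , x₁ :≤ κ 3 :* x₄) ∷ (κ 6 , x₃ :+ x₄ :≤ x₅)
              ∷ (κ 3 , κ 2 :* x₅ :≤ x₁ :+ x₂ :+ κ 2 :* (κ 8 :* ((κ 1 :+ x₀) :* x₂))) ∷ (κ 1 , κ 1 :+ κ 1000 :* ((κ 1 :+ x₀) :* x₂) :≤ x₁) ∷ []) refl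
            (ui ∷ uj ∷ both ∷ miss-half z z∈ ∷ small ∷ []))
          where
          both : class-miss z i + class-miss z j ≤ miss z
          both = tally 4 (λ v → B v ∷ cls col i v ∷ cls col j v ∷ adj z v ∷ [])
            (λ b c d x → not (c ∧ d) ∧ (c ⇒ b) ∧ (d ⇒ b))
            ((λ b c d x → c ∧ not x) ∷ (λ b c d x → d ∧ not x) ∷ []) ((λ b c d x → b ∧ not x) ∷ []) refl
            (λ v → ∧-intro (not-intro (λ p → i≢j (trans (sym (cls-colour col i v (∧-elimˡ p))) (cls-colour col j v (∧-elimʳ {cls col i v} p)))))
              (∧-intro (⇒-intro (cls-below col i<K v)) (⇒-intro (cls-below col j<K v))))

      type : Fin n → ℕ
      type z with anyUpTo? (λ j → u ≤? 3 * class-miss z j) K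
      ... | yes (j , _) = j
      ... | no _        = 0

      type-sound : ∀ z j → HasType z j → HasType z (type z)
      type-sound z j (j<K , uj) with anyUpTo? (λ j → u ≤? 3 * class-miss z j) K
      ... | yes (i , i<K , ui) = i<K , ui
      ... | no none            = ⊥-elim (none (j , j<K , uj))

      A I₀ : VSet n
      A z  = R z ∧ exists (R ∩ adj z)
      I₀   = R ∖ A

      A-neighbour : ∀ z → z ∈ A → Σ[ z′ ∈ Fin n ] z′ ∈ R × z′ ∈ adj z
      A-neighbour z p with z′ , q ← exists-witness (R ∩ adj z) (∧-elimʳ {R z} p) = z′ , ∧-elim {R z′} q

      A-typed : ∀ z → z ∈ A → HasType z (type z)
      A-typed z p with z′ , z′∈ , zz′ ← A-neighbour z p with j , j<K , none ← some-no-common z z′ (∧-elimˡ p) z′∈ zz′ =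
        type-sound z j (no-common-type z z′ j z′∈ j<K none)

      -- The class in which the two ends have no common neighbour is a type of both, so
      -- `type-unique` applies.
      edge-types : ∀ z z′ → z ∈ A → z′ ∈ A → z′ ∈ adj z → type z ≡ type z′ × NoCommon z z′ (type z)
      edge-types z z′ z∈ z′∈ zz′ with j , j<K , none ← some-no-common z z′ (∧-elimˡ z∈) (∧-elimˡ z′∈) zz′ =
        trans tz (sym tz′) , subst (NoCommon z z′) (sym tz) none
        where
        tz : type z ≡ j
        tz = type-unique z (type z) j (∧-elimˡ z∈) (A-typed z z∈) (no-common-type z z′ j (∧-elimˡ z′∈) j<K none)
        tz′ : type z′ ≡ j
        tz′ = type-unique z′ (type z′) j (∧-elimˡ z′∈) (A-typed z′ z′∈)
          (no-common-type z′ z j (∧-elimˡ z∈) j<K (λ v p → none v (∧-intro (∧-intro (∧-elimʳ {adj z′ v} (∧-elimˡ p)) (∧-elimˡ (∧-elimˡ p))) (∧-elimʳ {adj z′ v ∧ adj z v} p))))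

      I₀-independent : Independent I₀
      I₀-independent v w p q vw = exists-none (R ∩ adj v)
        (λ t → not-elim (∧-elimʳ {R v} p) (∧-intro (∧-elimˡ p) t)) w (∧-intro (∧-elimˡ q) vw)

      -- A vertex of B already misses almost u vertices in its own class, and A is counted by
      -- the non-adjacent pairs in A × B.
      opaque
        family-misses : ∀ x → x ∈ B → count (R ∖ adj x) ≤ D
        family-misses x x∈ = farkas (count (R ∖ adj x) ∷ count (cls col (col x)) ∷ u ∷ D ∷ []) (x₀ :≤ x₃)
          ((κ 1 , x₀ :+ x₁ :≤ x₂) ∷ (κ 1 , x₂ :≤ x₁ :+ x₃) ∷ []) refl
          (≤-trans disjoint (bound x) ∷ class-large (col x) (below-colour col K x x∈) ∷ [])
          where
          disjoint : count (R ∖ adj x) + count (cls col (col x)) ≤ count (everything ∖ adj x)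
          disjoint = tally 3 (λ v → (col v <ᵇ K) ∷ (col v ≡ᵇ col x) ∷ adj x v ∷ []) (λ b c a → (c ⇒ b) ∧ (c ⇒ not a))
            ((λ b c a → not b ∧ not a) ∷ (λ b c a → c) ∷ []) ((λ b c a → not a) ∷ []) refl
            (λ v → ∧-intro (⇒-intro (λ p → cls-below col (below-colour col K x x∈) v p))
              (⇒-intro (λ p → not-intro (cls-independent (proper tight) (below-colour col K x x∈) x v (in-cls col (col x) x refl refl) p))))

        A-small : count A ≤ 3 * (K * D)
        A-small = *-cancelʳ-≤ (count A) (3 * (K * D)) u {{>-nonZero u>0}} (begin
          count A * u                                          ≡⟨ *-distribʳ-sum u (λ z → ⟦ A z ⟧) ⟩
          sum (λ z → ⟦ A z ⟧ * u)                              ≤⟨ ∑-mono row ⟩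
          sum (λ z → 3 * sum (λ x → ⟦ pair z x ⟧))             ≡⟨ *-distribˡ-sum 3 (λ z → sum (λ x → ⟦ pair z x ⟧)) ⟨
          3 * sum (λ z → sum (λ x → ⟦ pair z x ⟧))             ≡⟨ cong (3 *_) (∑-comm (λ z x → ⟦ pair z x ⟧)) ⟩
          3 * sum (λ x → sum (λ z → ⟦ pair z x ⟧))             ≤⟨ *-monoʳ-≤ 3 (∑-mono column) ⟩
          3 * sum (λ x → ⟦ B x ⟧ * D)                          ≡⟨ cong (3 *_) (*-distribʳ-sum D (λ x → ⟦ B x ⟧)) ⟨
          3 * (count B * D)                                    ≤⟨ *-monoʳ-≤ 3 (*-monoˡ-≤ D (below-size misses K (proper tight))) ⟩
          3 * (K * u * D)                                      ≤⟨ farkas (K ∷ u ∷ D ∷ []) (κ 3 :* (x₀ :* x₁ :* x₂) :≤ κ 3 :* (x₀ :* x₂) :* x₁) [] refl [] ⟩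
          3 * (K * D) * u                                      ∎)
          where
          open ≤-Reasoning

          u>0 : 0 < u
          u>0 = ≤-trans (s≤s z≤n) small

          pair : Fin n → Fin n → Bool
          pair z x = A z ∧ (B x ∧ not (adj z x))

          row : ∀ z → ⟦ A z ⟧ * u ≤ 3 * sum (λ x → ⟦ pair z x ⟧)
          row z with A z in a
          ... | false = z≤n
          ... | true with t<K , typed ← A-typed z a = ≤-trans (≤-reflexive (+-identityʳ u))
            (≤-trans typed (*-monoʳ-≤ 3 (class-miss≤ z (type z) t<K)))

          column : ∀ x → sum (λ z → ⟦ pair z x ⟧) ≤ ⟦ B x ⟧ * D
          column x with B x in b
          ... | false = ≤-reflexive (count-empty (λ z p → case ∧-elimʳ {A z} p of λ ()))
          ... | true  = ≤-trans (count-mono within) (≤-trans (family-misses x b) (≤-reflexive (sym (+-identityʳ D))))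
            where
            within : (λ z → A z ∧ not (adj z x)) ⊆ R ∖ adj x
            within z p with a , m ← ∧-elim {A z} p = ∧-intro (∧-elimˡ a) (not-intro (not-elim m ∘ adj-sym))

        -- If `A` is empty, `R` is independent and k + 2 colours suffice. So `R` contains an edge;
        -- its ends together miss a whole class, while each misses at most about u - |R| vertices of
        -- `B`.
        R-small : 2 * count R ≤ u + 3 * D
        R-small with search A
        ... | inj₂ none = ⊥-elim (no-colouring ((λ v → col v ⊓ K) , (λ v _ → s≤s (m⊓n≤n (col v) K)) , distinct))
          where
          short : ∀ v → col v < K → col v ⊓ K ≡ col v
          short v lt = m≤n⇒m⊓n≡m (<⇒≤ lt)
          long : ∀ v → ¬ col v < K → col v ⊓ K ≡ K
          long v nlt = m≥n⇒m⊓n≡n (≮⇒≥ nlt)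

          distinct : ∀ v w → v ∈ everything → w ∈ everything → w ∈ adj v → col v ⊓ K ≢ col w ⊓ K
          distinct v w _ _ vw same with col v <? K | col w <? K
          ... | yes p | yes q = proper tight v w refl refl vw (trans (sym (short v p)) (trans same (short w q))) p
          ... | yes p | no q  = <-irrefl (trans (sym (short v p)) (trans same (long w q))) p
          ... | no p  | yes q = <-irrefl (trans (sym (short w q)) (trans (sym same) (long v p))) q
          ... | no p  | no q  = exists-none (R ∩ adj v)
            (λ t → none v (∧-intro (in-outside col K v refl p) t)) w (∧-intro (in-outside col K w refl q) vw)
        ... | inj₁ (z , z∈) with z′ , z′∈ , zz′ ← A-neighbour z z∈ with j , j<K , none ← some-no-common z z′ (∧-elimˡ z∈) z′∈ zz′ =
          farkas (u ∷ D ∷ count R ∷ count (cls col j) ∷ class-miss z j ∷ class-miss z′ j ∷ miss z ∷ miss z′ ∷ []) (κ 2 :* x₂ :≤ x₀ :+ κ 3 :* x₁)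
            ((κ 1 , x₀ :≤ x₃ :+ x₁) ∷ (κ 1 , x₃ :≤ x₄ :+ x₅) ∷ (κ 1 , x₄ :≤ x₆) ∷ (κ 1 , x₅ :≤ x₇)
              ∷ (κ 1 , x₂ :+ x₆ :≤ x₁ :+ x₀) ∷ (κ 1 , x₂ :+ x₇ :≤ x₁ :+ x₀) ∷ []) refl
            (class-large j j<K ∷ no-common-misses z z′ j none ∷ class-miss≤ z j j<K ∷ class-miss≤ z′ j j<K
              ∷ outside-degree z (∧-elimˡ z∈) ∷ outside-degree z′ z′∈ ∷ [])

      opaque
        p q : ℕ
        -- A vertex of `A` misses at most u + D - |R| vertices of a class that has at least u - D,
        -- so at least |R| - 2D neighbours remain; the extra 1 gives 2p < u and with it a positive
        -- `q`.
        p = count R ∸ (2 * D + 1)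
        q = u ∸ 2 * p

        p+ : p + (2 * D + 1) ≡ count R
        p+ = m∸n+n≡m (farkas-refute (k ∷ e ∷ u ∷ count R ∷ []) (κ 2 :* (κ 8 :* ((κ 1 :+ x₀) :* x₁)) :+ κ 1) x₃ (κ 2)
          ((κ 1 , x₂ :≤ κ 2 :* x₃ :+ x₁) ∷ (κ 1 , κ 1 :+ κ 1000 :* ((κ 1 :+ x₀) :* x₁) :≤ x₂) ∷ (κ 10 , κ 1 :≤ x₁) ∷ []) refl
          (R-large ∷ small ∷ e>0 ∷ []))

        p>0 : 0 < p
        p>0 = farkas-refute (k ∷ e ∷ u ∷ count R ∷ p ∷ []) (κ 1) x₄ (κ 2)
          ((κ 2 , x₃ :≤ x₄ :+ (κ 2 :* (κ 8 :* ((κ 1 :+ x₀) :* x₁)) :+ κ 1)) ∷ (κ 1 , x₂ :≤ κ 2 :* x₃ :+ x₁)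
            ∷ (κ 1 , κ 1 :+ κ 1000 :* ((κ 1 :+ x₀) :* x₁) :≤ x₂) ∷ (κ 10 , κ 1 :≤ x₁) ∷ []) refl
          (≤-reflexive (sym p+) ∷ R-large ∷ small ∷ e>0 ∷ [])

        2p<u : 2 * p < u
        2p<u = farkas-refute (u ∷ D ∷ count R ∷ p ∷ []) (κ 1 :+ κ 2 :* x₃) x₀ (κ 1)
          ((κ 2 , x₃ :+ (κ 2 :* x₁ :+ κ 1) :≤ x₂) ∷ (κ 1 , κ 2 :* x₂ :≤ x₀ :+ κ 3 :* x₁) ∷ []) refl
          (≤-reflexive p+ ∷ R-small ∷ [])

        2p+q : 2 * p + q ≡ u
        2p+q = m+[n∸m]≡n (<⇒≤ 2p<u)

        q>0 : 0 < q
        q>0 = m<n⇒0<n∸m 2p<u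

        neighbours-in-class : ∀ z → z ∈ A → p ≤ count (cls col (type z) ∩ adj z)
        neighbours-in-class z z∈ with t<K , _ ← A-typed z z∈ =
          farkas (p ∷ D ∷ u ∷ count R ∷ miss z ∷ class-miss z (type z) ∷ count (cls col (type z)) ∷ count (cls col (type z) ∩ adj z) ∷ [])
            (x₀ :≤ x₇)
            ((κ 1 , x₀ :+ (κ 2 :* x₁ :+ κ 1) :≤ x₃) ∷ (κ 1 , x₃ :+ x₄ :≤ x₁ :+ x₂) ∷ (κ 1 , x₅ :≤ x₄) ∷ (κ 1 , x₂ :≤ x₆ :+ x₁) ∷ (κ 1 , x₆ :≤ x₇ :+ x₅) ∷ []) refl
            (≤-reflexive p+ ∷ outside-degree z (∧-elimˡ z∈) ∷ class-miss≤ z (type z) t<K ∷ class-large (type z) t<K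
              ∷ ≤-reflexive (count-∩∖ (cls col (type z)) (adj z)) ∷ [])

        class-bounded : ∀ z → z ∈ A → count (cls col (type z)) ≤ 2 * p + q
        class-bounded z z∈ = subst (count (cls col (type z)) ≤_) (sym 2p+q) (cls-size misses (proper tight) (proj₁ (A-typed z z∈)))

        n-bound : 2 * n ≤ (2 * k + 3) * u + 3 * D
        n-bound = farkas (k ∷ u ∷ D ∷ n ∷ count B ∷ count R ∷ []) (κ 2 :* x₃ :≤ (κ 2 :* x₀ :+ κ 3) :* x₁ :+ κ 3 :* x₂)
          ((κ 2 , x₃ :≤ x₄ :+ x₅) ∷ (κ 2 , x₄ :≤ (κ 1 :+ x₀) :* x₁) ∷ (κ 1 , κ 2 :* x₅ :≤ x₁ :+ κ 3 :* x₂) ∷ []) refl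
          (≤-reflexive (trans (sym (count-everything n)) (below+outside col K)) ∷ below-size misses K (proper tight) ∷ R-small ∷ [])

        n-bound′ : (2 * k + 3) * u ≤ 2 * n + e
        n-bound′ = subst (λ m → (2 * k + 3) * u ≤ 2 * m + e) (count-everything n) large

  private
    K′ N′ e′ D′ T′ : Expr
    K′ = κ 1 :+ x₀
    N′ = κ 2 :* x₀ :+ κ 3
    e′ = N′ :* x₁
    D′ = κ 8 :* (K′ :* e′)
    T′ = κ 40 :* (K′ :* K′ :* N′) :* x₁

  -- Sizes in terms of n

  module Sizes {n : ℕ} (G : Graph n) {u : ℕ} (misses : Cliques.MissesAtMost G u everything) (f k : ℕ) (f>0 : 0 < f)
    (free : ¬ Cliques.Clique G everything (3 + k)) (large : (2 * k + 3) * u ≤ 2 * count {n} everything + (2 * k + 3) * f)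
    (small : 1000 * (suc k * ((2 * k + 3) * f)) < u) (no-colouring : ¬ FiveWalks.Colouring G everything (2 + k))
    (col : Fin n → ℕ) (tight : FinalStructure.Tight G misses ((2 * k + 3) * f) k free large small col) where
    open FinalStructure G misses ((2 * k + 3) * f) k free large small
    open Tight tight

    private
      N T : ℕ
      N = 2 * k + 3
      -- Here `D` is 8 (k + 1) N f. The main losses are the vertices of `A` missing from `I₀`, at
      -- most 3 (k + 1) `D`, and 4 `D` in `q`; the factor 40 also covers the smaller terms.
      T = 40 * (suc k * suc k * N) * f

    N*f>0 : 0 < N * f
    N*f>0 = farkas (k ∷ f ∷ []) (κ 1 :≤ e′) ((κ 1 , κ 1 :≤ x₁) ∷ []) refl (f>0 ∷ [])

    open Parts N*f>0 no-colouring col tight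
    open Families G everything using (cls; cls-size)

    opaque
      class-upper : ∀ j → j < K → N * count (cls col j) ≤ 2 * n + N * T
      class-upper j j<K = farkas (k ∷ f ∷ u ∷ n ∷ count (cls col j) ∷ []) (N′ :* x₄ :≤ κ 2 :* x₃ :+ N′ :* T′)
        ((N′ , x₄ :≤ x₂) ∷ (κ 1 , N′ :* x₂ :≤ κ 2 :* x₃ :+ e′) ∷ []) refl (cls-size misses proper j<K ∷ n-bound′ ∷ [])

      class-lower : ∀ j → j < K → 2 * n ≤ N * count (cls col j) + N * T
      class-lower j j<K = farkas (k ∷ f ∷ u ∷ n ∷ count (cls col j) ∷ []) (κ 2 :* x₃ :≤ N′ :* x₄ :+ N′ :* T′)
        ((N′ , x₂ :≤ x₄ :+ D′) ∷ (κ 1 , κ 2 :* x₃ :≤ N′ :* x₂ :+ κ 3 :* D′) ∷ []) refl (class-large j j<K ∷ n-bound ∷ [])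

      I₀-upper : N * count I₀ ≤ n + N * T
      I₀-upper = farkas-refute (k ∷ f ∷ u ∷ n ∷ count R ∷ count I₀ ∷ []) (N′ :* x₅) (x₃ :+ N′ :* T′) (κ 2)
        ((κ 2 :* N′ , x₅ :≤ x₄) ∷ (N′ , κ 2 :* x₄ :≤ x₂ :+ κ 3 :* D′) ∷ (κ 1 , N′ :* x₂ :≤ κ 2 :* x₃ :+ e′) ∷ []) refl
        (count-mono (λ v → ∧-elimˡ {R v}) ∷ R-small ∷ n-bound′ ∷ [])

      I₀-lower : n ≤ N * count I₀ + N * T
      I₀-lower = farkas-refute (k ∷ f ∷ u ∷ n ∷ count R ∷ count I₀ ∷ count A ∷ []) x₃ (N′ :* x₅ :+ N′ :* T′) (κ 2)
        ((κ 2 :* N′ , x₄ :≤ x₆ :+ x₅) ∷ (κ 2 :* N′ , x₆ :≤ κ 3 :* (K′ :* D′)) ∷ (N′ , x₂ :≤ κ 2 :* x₄ :+ e′)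
          ∷ (κ 1 , κ 2 :* x₃ :≤ N′ :* x₂ :+ κ 3 :* D′) ∷ []) refl
        (≤-trans (≤-reflexive (count-∩∖ R A)) (+-monoˡ-≤ (count I₀) (count-mono (λ v → ∧-elimʳ {R v}))) ∷ A-small ∷ R-large ∷ n-bound ∷ [])

      p-lower : n ≤ N * p + N * T
      p-lower = farkas-refute (k ∷ f ∷ u ∷ n ∷ count R ∷ p ∷ []) x₃ (N′ :* x₅ :+ N′ :* T′) (κ 2)
        ((κ 2 :* N′ , x₄ :≤ x₅ :+ (κ 2 :* D′ :+ κ 1)) ∷ (N′ , x₂ :≤ κ 2 :* x₄ :+ e′)
          ∷ (κ 1 , κ 2 :* x₃ :≤ N′ :* x₂ :+ κ 3 :* D′) ∷ (κ 2 :* N′ , κ 1 :≤ x₁) ∷ []) refl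
        (≤-reflexive (sym p+) ∷ R-large ∷ n-bound ∷ f>0 ∷ [])

      q-upper : q ≤ T
      q-upper = farkas (k ∷ f ∷ u ∷ count R ∷ p ∷ q ∷ []) (x₅ :≤ T′)
        ((κ 2 , x₃ :≤ x₄ :+ (κ 2 :* D′ :+ κ 1)) ∷ (κ 1 , x₂ :≤ κ 2 :* x₃ :+ e′) ∷ (κ 1 , κ 2 :* x₄ :+ x₅ :≤ x₂) ∷ (κ 2 , κ 1 :≤ x₁) ∷ []) refl
        (≤-reflexive (sym p+) ∷ R-large ∷ ≤-reflexive 2p+q ∷ f>0 ∷ [])

  -- Finite subsets and the embedding of a class into 2p + q points

  squeeze : ∀ {n} m → VSet n → VSet n → Subset m
  squeeze         zero    I A = []
  squeeze {zero}  (suc m) I A = false ∷ squeeze m I A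
  squeeze {suc n} (suc m) I A =
    if I zero then A zero ∷ squeeze m (I ∘ suc) (A ∘ suc) else squeeze (suc m) (I ∘ suc) (A ∘ suc)

  size-∷ : ∀ {m} b (S : Subset m) → Subset.∣ b ∷ S ∣ ≡ ⟦ b ⟧ + Subset.∣ S ∣
  size-∷ true  S = refl
  size-∷ false S = refl

  squeeze-size : ∀ {n} m (I A : VSet n) → count I ≤ m → count (I ∩ A) ≤ Subset.∣ squeeze m I A ∣
  squeeze-size         zero    I A fits = ≤-trans (count-mono {B = I} (λ v → ∧-elimˡ {I v})) fits
  squeeze-size {zero}  (suc m) I A fits = z≤n
  squeeze-size {suc n} (suc m) I A fits with I zero
  ... | true  = ≤-trans (+-monoʳ-≤ ⟦ A zero ⟧ (squeeze-size m (I ∘ suc) (A ∘ suc) (s≤s⁻¹ fits)))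
                  (≤-reflexive (sym (size-∷ (A zero) (squeeze m (I ∘ suc) (A ∘ suc)))))
  ... | false = squeeze-size (suc m) (I ∘ suc) (A ∘ suc) fits

  -- The position given to a vertex of `I` depends on `I` alone and not on the recorded set, so a
  -- common position comes from a common vertex.
  squeeze-common : ∀ {n} m (I A A′ : VSet n) i → Vec.lookup (squeeze m I A) i ≡ true → Vec.lookup (squeeze m I A′) i ≡ true →
    Σ[ v ∈ Fin n ] v ∈ (A ∩ A′) ∩ I
  squeeze-common {zero}  (suc m) I A A′ (suc i) p q = squeeze-common m I A A′ i p q
  squeeze-common {suc n} (suc m) I A A′ i p q with I zero in eq
  squeeze-common {suc n} (suc m) I A A′ zero    p q | true = zero , ∧-intro (∧-intro p q) eq
  squeeze-common {suc n} (suc m) I A A′ (suc i) p q | true with v , r ← squeeze-common m (I ∘ suc) (A ∘ suc) (A′ ∘ suc) i p q = suc v , r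
  squeeze-common {suc n} (suc m) I A A′ i       p q | false with v , r ← squeeze-common (suc m) (I ∘ suc) (A ∘ suc) (A′ ∘ suc) i p q = suc v , r

  -- A vertex of the Kneser graph has exactly `p` elements, and any `p` of the neighbours will do,
  -- because disjointness passes to subsets.
  trim : ∀ {m} → ℕ → Subset m → Subset m
  trim p       []          = []
  trim p       (false ∷ S) = false ∷ trim p S
  trim zero    (true ∷ S)  = false ∷ trim zero S
  trim (suc p) (true ∷ S)  = true ∷ trim p S

  trim-size : ∀ {m} p (S : Subset m) → p ≤ Subset.∣ S ∣ → Subset.∣ trim p S ∣ ≡ p
  trim-size p       []          le = sym (n≤0⇒n≡0 le)
  trim-size p       (false ∷ S) le = trim-size p S le
  trim-size zero    (true ∷ S)  le = trim-size zero S z≤n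
  trim-size (suc p) (true ∷ S)  le = cong suc (trim-size p S (s≤s⁻¹ le))

  trim-⊆ : ∀ {m} p (S : Subset m) i → Vec.lookup (trim p S) i ≡ true → Vec.lookup S i ≡ true
  trim-⊆ p       (false ∷ S) (suc i) q = trim-⊆ p S i q
  trim-⊆ zero    (true ∷ S)  (suc i) q = trim-⊆ zero S i q
  trim-⊆ (suc p) (true ∷ S)  zero    q = refl
  trim-⊆ (suc p) (true ∷ S)  (suc i) q = trim-⊆ p S i q

  embed : ∀ {n} m → ℕ → VSet n → VSet n → Subset m
  embed m p I A = trim p (squeeze m I A)

  embed-disjoint : ∀ {n} m p (I A A′ : VSet n) → (∀ v → ¬ v ∈ (A ∩ A′) ∩ I) → Subset.Empty (embed m p I A Subset.∩ embed m p I A′)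
  embed-disjoint m p I A A′ none (i , i∈) with l , r ← SubsetP.x∈p∩q⁻ (embed m p I A) (embed m p I A′) i∈ =
    let v , common = squeeze-common m I A A′ i (trim-⊆ p (squeeze m I A) i (VecP.[]=⇒lookup l)) (trim-⊆ p (squeeze m I A′) i (VecP.[]=⇒lookup r))
    in none v common

  subset : ∀ {n} → VSet n → Subset n
  subset = Vec.tabulate

  ∈-subset⁻ : ∀ {n} (A : VSet n) {v} → v Subset.∈ subset A → v ∈ A
  ∈-subset⁻ A {v} p = trans (sym (VecP.lookup∘tabulate A v)) (VecP.[]=⇒lookup p)

  ∈-subset⁺ : ∀ {n} (A : VSet n) {v} → v ∈ A → v Subset.∈ subset A
  ∈-subset⁺ A {v} p = VecP.lookup⇒[]= v (subset A) (trans (VecP.lookup∘tabulate A v) p)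

  size-subset : ∀ {n} (A : VSet n) → Subset.∣ subset A ∣ ≡ count A
  size-subset {zero}  A = refl
  size-subset {suc n} A = trans (size-∷ (A zero) (subset (A ∘ suc))) (cong (_+_ ⟦ A zero ⟧) (size-subset (A ∘ suc)))

  module Partition {n : ℕ} (K : ℕ) (col : Fin n → ℕ) (A I₀ : VSet n) (I : ℕ → VSet n)
    (A⁻ : ∀ v → v ∈ A → ¬ col v < K) (I₀⁻ : ∀ v → v ∈ I₀ → ¬ col v < K × not (A v) ≡ true) (I⁻ : ∀ j v → v ∈ I j → col v ≡ j)
    (I₀⁺ : ∀ v → ¬ col v < K → not (A v) ≡ true → v ∈ I₀) (I⁺ : ∀ v → v ∈ I (col v)) where

    part : Fin (2 + K) → Subset n
    part = subset A Vector.∷ (subset I₀ Vector.∷ (λ i → subset (I (toℕ i))))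

    private
      rest : Bool → Fin (2 + K)
      rest b = if b then suc zero else zero

      label : Fin n → Fin (2 + K)
      label v with col v <? K
      ... | yes lt = suc (suc (fromℕ< lt))
      ... | no _   = rest (not (A v))

      label-∈ : ∀ v → v Subset.∈ part (label v)
      label-∈ v with col v <? K
      ... | yes lt = ∈-subset⁺ (I (toℕ (fromℕ< lt))) (subst (λ j → v ∈ I j) (sym (FinP.toℕ-fromℕ< lt)) (I⁺ v))
      ... | no nlt with A v in a
      ...   | true  = ∈-subset⁺ A a
      ...   | false = ∈-subset⁺ I₀ (I₀⁺ v nlt (cong not a))

      ∈-label : ∀ i v → v Subset.∈ part i → label v ≡ i
      ∈-label zero v p with col v <? K
      ... | yes lt = ⊥-elim (A⁻ v (∈-subset⁻ A p) lt)
      ... | no _   = cong (rest ∘ not) (∈-subset⁻ A p)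
      ∈-label (suc zero) v p with col v <? K
      ... | yes lt = ⊥-elim (proj₁ (I₀⁻ v (∈-subset⁻ I₀ p)) lt)
      ... | no _   = cong rest (proj₂ (I₀⁻ v (∈-subset⁻ I₀ p)))
      ∈-label (suc (suc i)) v p with col v <? K | I⁻ (toℕ i) v (∈-subset⁻ (I (toℕ i)) p)
      ... | yes lt | eq = cong (λ i → suc (suc i)) (FinP.toℕ-injective (trans (FinP.toℕ-fromℕ< lt) eq))
      ... | no nlt | eq = ⊥-elim (nlt (subst (_< K) (sym eq) (FinP.toℕ<n i)))

    partition : IsPartition part
    partition = (λ v → label v , label-∈ v) , λ i j i≢j (v , v∈) →
      let v∈i , v∈j = SubsetP.x∈p∩q⁻ (part i) (part j) v∈ in i≢j (trans (sym (∈-label i v v∈i)) (∈-label j v v∈j))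

  argmin : ∀ {n} (f : Fin (suc n) → ℕ) → Σ[ v ∈ Fin (suc n) ] (∀ w → f v ≤ f w)
  argmin {zero}  f = zero , λ { zero → ≤-refl }
  argmin {suc n} f with v , least ← argmin (f ∘ suc) with ≤-total (f zero) (f (suc v))
  ... | inj₁ le = zero , λ { zero → ≤-refl ; (suc w) → ≤-trans le (least w) }
  ... | inj₂ ge = suc v , λ { zero → ge ; (suc w) → least w }

  -- Passage from `SimpleGraph`

  module FromSimple {n : ℕ} (S : SimpleGraph (Fin n)) where

    graph : Graph n
    graph = record
      { adj        = λ v w → does (adj? S v w)
      ; adj-sym    = λ {v} {w} p → true-dec (adj? S w v) (SimpleGraph.sym S (dec-true (adj? S v w) p))
      ; adj-irrefl = λ {v} p → SimpleGraph.irrefl S (dec-true (adj? S v v) p)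
      }

    open Graph graph
    open Cliques graph
    open FiveWalks graph using (Colouring)

    adjacent : ∀ {v w} → Adj S v w → w ∈ adj v
    adjacent {v} {w} = true-dec (adj? S v w)

    vertices : ∀ {A m} → Clique A m → Fin m → Fin n
    vertices (cons x _ K) zero    = x
    vertices (cons x _ K) (suc i) = vertices K i

    vertices-∈ : ∀ {A m} (K : Clique A m) i → vertices K i ∈ A
    vertices-∈ (cons x a K) zero        = a
    vertices-∈ {A} (cons x a K) (suc i) = ∧-elimˡ {A (vertices K i)} (vertices-∈ K i)

    vertices-adjacent : ∀ {A m} (K : Clique A m) i j → i ≢ j → vertices K j ∈ adj (vertices K i)
    vertices-adjacent (cons x a K) zero    zero    i≢j = ⊥-elim (i≢j refl)
    vertices-adjacent {A} (cons x a K) zero    (suc j) i≢j = ∧-elimʳ {A (vertices K j)} (vertices-∈ K j)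
    vertices-adjacent {A} (cons x a K) (suc i) zero    i≢j = adj-sym (∧-elimʳ {A (vertices K i)} (vertices-∈ K i))
    vertices-adjacent (cons x a K) (suc i) (suc j) i≢j = vertices-adjacent K i j (i≢j ∘ cong suc)

    contains-complete : ∀ {A r} → Clique A r → Contains S (complete r)
    contains-complete K = record { map = vertices K ; map-edge = λ {i} {j} i≢j → dec-true (adj? S _ _) (vertices-adjacent K i j i≢j) } , injective
      where
      injective : ∀ {i j} → vertices K i ≡ vertices K j → i ≡ j
      injective {i} {j} same with i FinP.≟ j
      ... | yes eq = eq
      ... | no i≢j = ⊥-elim (adj-irrefl (subst (_∈ adj (vertices K i)) (sym same) (vertices-adjacent K i j i≢j)))

    colourable : ∀ {c} → Colouring everything c → Colourable S c
    colourable (col , bound , proper) = (λ v → fromℕ< (bound v refl)) , λ {v} {w} vw same →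
      proper v w refl refl (adjacent vw) (trans (sym (FinP.toℕ-fromℕ< (bound v refl))) (trans (cong toℕ same) (FinP.toℕ-fromℕ< (bound w refl))))

    -- Colourability need not be decided: if c < b colours sufficed, then c would be the chromatic
    -- number unless fewer colours suffice, and that case is refuted by descent on `bound`.
    not-colourable : ∀ {b} → (∀ χ → IsChromaticNumber S χ → b ≤ χ) → ∀ {c} → c < b → ¬ Colourable S c
    not-colourable {b} chromatic {c} = refute c ≤-refl
      where
      refute : ∀ bound {c} → c ≤ bound → c < b → ¬ Colourable S c
      minimal : ∀ bound {c} → c ≤ bound → c < b → ∀ d → Colourable S d → c ≤ d
      refute bound {c} le lt colouring = <⇒≱ lt (chromatic c (colouring , minimal bound le lt))
      minimal zero        z≤n lt d colouring = z≤n
      minimal (suc bound) {c} le lt d colouring with c ≤? d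
      ... | yes p = p
      ... | no np = ⊥-elim (refute bound (s≤s⁻¹ (≤-trans (≰⇒> np) le)) (<-trans (≰⇒> np) lt) colouring)

    degree-count : ∀ v → Defs.degree S v ≡ count (adj v)
    degree-count v = size-subset (adj v)

    misses-at-most : ∀ {u δ} → u + δ ≡ n → (∀ v → δ ≤ Defs.degree S v) → MissesAtMost u everything
    misses-at-most {u} {δ} u+δ least v _ = farkas (u ∷ δ ∷ n ∷ count (adj v) ∷ count (everything ∖ adj v) ∷ []) (x₄ :≤ x₀)
      ((κ 1 , x₃ :+ x₄ :≤ x₂) ∷ (κ 1 , x₁ :≤ x₃) ∷ (κ 1 , x₂ :≤ x₀ :+ x₁) ∷ []) refl
      (≤-reflexive (trans (sym (count-∩∖ everything (adj v))) (count-everything n)) ∷ subst (δ ≤_) (degree-count v) (least v) ∷ ≤-reflexive (sym u+δ) ∷ [])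

    independent : ∀ A → Independent A → Defs.Independent S (subset A)
    independent A indep {v} {w} v∈ w∈ vw = indep v w (∈-subset⁻ A v∈) (∈-subset⁻ A w∈) (adjacent vw)

  -- The size bounds are cleared of the denominator 2k + 3 and stay in the natural numbers.
  record Structure {n : ℕ} (S : SimpleGraph (Fin n)) (k T : ℕ) : Set where
    field
      I₀ A  : Subset n
      I     : Fin (suc k) → Subset n
      parts : IsPartition (A Vector.∷ (I₀ Vector.∷ I))
      I₀-independent : Defs.Independent S I₀
      I-independent  : ∀ i → Defs.Independent S (I i)
      I₀-upper : (2 * k + 3) * Subset.∣ I₀ ∣ ≤ n + (2 * k + 3) * T
      I₀-lower : n ≤ (2 * k + 3) * Subset.∣ I₀ ∣ + (2 * k + 3) * T
      I-upper  : ∀ i → (2 * k + 3) * Subset.∣ I i ∣ ≤ 2 * n + (2 * k + 3) * T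
      I-lower  : ∀ i → 2 * n ≤ (2 * k + 3) * Subset.∣ I i ∣ + (2 * k + 3) * T
      p q : ℕ
      {{p≢0}} : NonZero p
      {{q≢0}} : NonZero q
      kneser  : Hom (induced S A) (KG p q)
      p-lower : n ≤ (2 * k + 3) * p + (2 * k + 3) * T
      q-upper : q ≤ T

  between : ∀ a b d → (d ≤ᵇ a) ≡ true → (2 + a ≤ᵇ b) ≡ true → Σ[ c ∈ ℕ ] a < c × d ≤ c × c < b
  between a b d low high = suc a , ≤-refl , m≤n⇒m≤1+n (≤ᵇ-true d a low) , ≤ᵇ-true (2 + a) b high

  -- The colouring obtained from the samples uses at most 16 * 2 ^ 1280 colours.
  opaque
    few-colours : Σ[ c ∈ ℕ ] 16 * 2 ^ 1280 < c × 8 ≤ c × c < 10 ^ 391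
    few-colours = between (16 * 2 ^ 1280) (10 ^ 391) 8 refl refl

  module _ {n : ℕ} (S : SimpleGraph (Fin n)) (k f : ℕ) (f>0 : 0 < f) (free : ¬ Contains S (complete (3 + k)))
    {u δ : ℕ} (u+δ : u + δ ≡ n) (least : ∀ v → δ ≤ Defs.degree S v)
    (dense : (2 * k + 1) * n ≤ (2 * k + 3) * (δ + f))
    (sparse : 1000 * ((2 + k) * (suc k * ((2 * k + 3) * f))) < n)
    {b : ℕ} (enough : proj₁ few-colours < b) (chromatic : ∀ χ → IsChromaticNumber S χ → b + k ≤ χ) where
    open FromSimple S
    open Graph graph
    open Cliques graph
    open FiveWalks graph using (Colouring)

    private
      misses : MissesAtMost u everything
      misses = misses-at-most u+δ least

      clique-free : ¬ Clique everything (3 + k)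
      clique-free = free ∘ contains-complete

      large : (2 * k + 3) * u ≤ 2 * count {n} everything + (2 * k + 3) * f
      large = subst (λ m → (2 * k + 3) * u ≤ 2 * m + (2 * k + 3) * f) (sym (count-everything n))
        (farkas (k ∷ u ∷ δ ∷ f ∷ n ∷ []) ((κ 2 :* x₀ :+ κ 3) :* x₁ :≤ κ 2 :* x₄ :+ (κ 2 :* x₀ :+ κ 3) :* x₃)
          ((κ 1 , (κ 2 :* x₀ :+ κ 1) :* x₄ :≤ (κ 2 :* x₀ :+ κ 3) :* (x₂ :+ x₃)) ∷ (κ 2 :* x₀ :+ κ 3 , x₁ :+ x₂ :≤ x₄) ∷ []) refl
          (dense ∷ ≤-reflexive u+δ ∷ []))

      -- Otherwise a clique of k + 3 vertices could be chosen greedily. This turns smallness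
      -- relative to `n` into smallness relative to `u`.
      many-misses : n ≤ (2 + k) * u
      many-misses = ≮⇒≥ (λ lt → clique-free (greedy misses (3 + k) (λ _ → id)
        (farkas (k ∷ u ∷ n ∷ count {n} everything ∷ []) (κ 1 :+ (κ 3 :+ x₀) :* x₁ :≤ x₃ :+ x₁)
          ((κ 1 , κ 1 :+ (κ 2 :+ x₀) :* x₁ :≤ x₂) ∷ (κ 1 , x₂ :≤ x₃) ∷ []) refl (lt ∷ ≤-reflexive (sym (count-everything n)) ∷ []))))

      small : 1000 * (suc k * ((2 * k + 3) * f)) < u
      small = ≰⇒> (λ le → impossible (k ∷ suc k * ((2 * k + 3) * f) ∷ u ∷ n ∷ [])
        ((κ 1 , κ 1 :+ κ 1000 :* ((κ 2 :+ x₀) :* x₁) :≤ x₃) ∷ (κ 1 , x₃ :≤ (κ 2 :+ x₀) :* x₂) ∷ (κ 2 :+ x₀ , x₂ :≤ κ 1000 :* x₁) ∷ []) refl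
        (sparse ∷ many-misses ∷ le ∷ []))

      c : ℕ
      c = proj₁ few-colours

      no-colouring : ∀ {d} → d ≤ c → ¬ Colouring everything (d + k)
      no-colouring le = not-colourable chromatic (+-monoˡ-< k (≤-<-trans le enough)) ∘ colourable

      two-colours : ¬ Colouring everything (2 + k)
      two-colours = no-colouring {2} (≤-trans (≤ᵇ-true 2 8 refl) (proj₁ (proj₂ (proj₂ few-colours))))

      open FinalStructure graph misses ((2 * k + 3) * f) k clique-free large small

      family : Σ[ col ∈ (Fin n → ℕ) ] Tight col
      family = tight-family c (proj₁ (proj₂ few-colours)) (proj₁ (proj₂ (proj₂ few-colours))) (no-colouring ≤-refl)

      module _ (col : Fin n → ℕ) (tight : Tight col) where
        open Sizes graph misses f k f>0 clique-free large small two-colours col tight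
        open Parts N*f>0 two-colours col tight
        open Families graph everything

        instance
          p≢0 : NonZero p
          p≢0 = >-nonZero p>0

        kneser-vertex : ∀ z → z ∈ A → KneserVertex p q
        kneser-vertex z z∈ = embed (2 * p + q) p (cls col (type z)) (adj z) , trim-size p (squeeze (2 * p + q) (cls col (type z)) (adj z))
          (≤-trans (neighbours-in-class z z∈) (squeeze-size (2 * p + q) (cls col (type z)) (adj z) (class-bounded z z∈)))

        kneser-adjacent : ∀ z z′ → z ∈ A → z′ ∈ A → z′ ∈ adj z →
          Subset.Empty (embed (2 * p + q) p (cls col (type z)) (adj z) Subset.∩ embed (2 * p + q) p (cls col (type z′)) (adj z′))
        kneser-adjacent z z′ z∈ z′∈ zz′ = subst
          (λ j → Subset.Empty (embed (2 * p + q) p (cls col (type z)) (adj z) Subset.∩ embed (2 * p + q) p (cls col j) (adj z′)))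
          (proj₁ types) (embed-disjoint (2 * p + q) p (cls col (type z)) (adj z) (adj z′) (proj₂ types))
          where
          types : type z ≡ type z′ × NoCommon z z′ (type z)
          types = edge-types z z′ z∈ z′∈ zz′

        structure′ : Structure S k (40 * (suc k * suc k * (2 * k + 3)) * f)
        structure′ = record
          { I₀ = subset I₀
          ; A = subset A
          ; I = λ i → subset (cls col (toℕ i))
          ; parts = Partition.partition K col A I₀ (cls col)
              (λ v p → outside-colour col K v (∧-elimˡ p))
              (λ v p → outside-colour col K v (∧-elimˡ p) , ∧-elimʳ {R v} p)
              (λ j v → cls-colour col j v)
              (λ v nlt p → ∧-intro (in-outside col K v refl nlt) p)
              (λ v → in-cls col (col v) v refl refl)
          ; I₀-independent = independent I₀ I₀-independent
          ; I-independent = λ i → independent (cls col (toℕ i)) (cls-independent (FinalStructure.Tight.proper tight) (FinP.toℕ<n i))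
          ; I₀-upper = subst (λ s → N * s ≤ n + N * T) (sym (size-subset I₀)) I₀-upper
          ; I₀-lower = subst (λ s → n ≤ N * s + N * T) (sym (size-subset I₀)) I₀-lower
          ; I-upper = λ i → subst (λ s → N * s ≤ 2 * n + N * T) (sym (size-subset (cls col (toℕ i)))) (class-upper (toℕ i) (FinP.toℕ<n i))
          ; I-lower = λ i → subst (λ s → 2 * n ≤ N * s + N * T) (sym (size-subset (cls col (toℕ i)))) (class-lower (toℕ i) (FinP.toℕ<n i))
          ; p = p
          ; q = q
          ; q≢0 = >-nonZero q>0
          ; kneser = record
              { map = λ (z , z∈) → kneser-vertex z (∈-subset⁻ A z∈)
              ; map-edge = λ { {z , z∈} {z′ , z′∈} zz′ → kneser-adjacent z z′ (∈-subset⁻ A z∈) (∈-subset⁻ A z′∈) (adjacent zz′) }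
              }
          ; p-lower = p-lower
          ; q-upper = q-upper
          }
          where
          N = 2 * k + 3
          T = 40 * (suc k * suc k * N) * f

    structure : Structure S k (40 * (suc k * suc k * (2 * k + 3)) * f)
    structure = structure′ (proj₁ family) (proj₂ family)

  -- Rational inequalities

  private
    toℚᵘ-/ : ∀ a d → ℚ.toℚᵘ (+ a ℚ./ suc d) ℚᵘ.≃ mkℚᵘ (+ a) d
    toℚᵘ-/ a d = ℚP.toℚᵘ-fromℚᵘ (mkℚᵘ (+ a) d)

  fromℕ-*-/ : ∀ a b .{{_ : NonZero b}} → fromℕ b ℚ.* (+ a ℚ./ b) ≡ fromℕ a
  fromℕ-*-/ a (suc d) = ℚP.toℚᵘ-injective (begin
    ℚ.toℚᵘ (fromℕ (suc d) ℚ.* (+ a ℚ./ suc d))          ≈⟨ ℚP.toℚᵘ-homo-* (fromℕ (suc d)) (+ a ℚ./ suc d) ⟩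
    ℚ.toℚᵘ (fromℕ (suc d)) ℚᵘ.* ℚ.toℚᵘ (+ a ℚ./ suc d)  ≈⟨ ℚᵘP.*-cong (toℚᵘ-/ (suc d) 0) (toℚᵘ-/ a d) ⟩
    mkℚᵘ (+ suc d) 0 ℚᵘ.* mkℚᵘ (+ a) d                  ≈⟨ *≡* (trans (ℤP.*-identityʳ _) (trans (ℤP.*-comm (+ suc d) (+ a)) (cong (λ m → + a ℤ.* + m) (sym (+-identityʳ (suc d)))))) ⟩
    mkℚᵘ (+ a) 0                                        ≈⟨ toℚᵘ-/ a 0 ⟨
    ℚ.toℚᵘ (fromℕ a)                                    ∎)
    where open import Relation.Binary.Reasoning.Setoid ℚᵘP.≃-setoid

  fromℕ-+ : ∀ a b → fromℕ (a + b) ≡ fromℕ a ℚ.+ fromℕ b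
  fromℕ-+ a b = ℚP.toℚᵘ-injective (begin
    ℚ.toℚᵘ (fromℕ (a + b))                    ≈⟨ toℚᵘ-/ (a + b) 0 ⟩
    mkℚᵘ (+ (a + b)) 0                        ≈⟨ *≡* (cong (ℤ._* + 1) (sym (cong₂ ℤ._+_ (ℤP.*-identityʳ (+ a)) (ℤP.*-identityʳ (+ b))))) ⟩
    mkℚᵘ (+ a) 0 ℚᵘ.+ mkℚᵘ (+ b) 0            ≈⟨ ℚᵘP.+-cong (toℚᵘ-/ a 0) (toℚᵘ-/ b 0) ⟨
    ℚ.toℚᵘ (fromℕ a) ℚᵘ.+ ℚ.toℚᵘ (fromℕ b)    ≈⟨ ℚP.toℚᵘ-homo-+ (fromℕ a) (fromℕ b) ⟨
    ℚ.toℚᵘ (fromℕ a ℚ.+ fromℕ b)              ∎)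
    where open import Relation.Binary.Reasoning.Setoid ℚᵘP.≃-setoid

  fromℕ-* : ∀ a b → fromℕ (a * b) ≡ fromℕ a ℚ.* fromℕ b
  fromℕ-* a b = ℚP.toℚᵘ-injective (begin
    ℚ.toℚᵘ (fromℕ (a * b))                    ≈⟨ toℚᵘ-/ (a * b) 0 ⟩
    mkℚᵘ (+ (a * b)) 0                        ≈⟨ *≡* (cong (ℤ._* + 1) (ℤP.pos-* a b)) ⟩
    mkℚᵘ (+ a) 0 ℚᵘ.* mkℚᵘ (+ b) 0            ≈⟨ ℚᵘP.*-cong (toℚᵘ-/ a 0) (toℚᵘ-/ b 0) ⟨
    ℚ.toℚᵘ (fromℕ a) ℚᵘ.* ℚ.toℚᵘ (fromℕ b)    ≈⟨ ℚP.toℚᵘ-homo-* (fromℕ a) (fromℕ b) ⟨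
    ℚ.toℚᵘ (fromℕ a ℚ.* fromℕ b)              ∎)
    where open import Relation.Binary.Reasoning.Setoid ℚᵘP.≃-setoid

  fromℕ-mono-≤ : ∀ {a b} → a ≤ b → fromℕ a ℚ.≤ fromℕ b
  fromℕ-mono-≤ {a} {b} le = ℚP.toℚᵘ-cancel-≤ (begin
    ℚ.toℚᵘ (fromℕ a)    ≃⟨ toℚᵘ-/ a 0 ⟩
    mkℚᵘ (+ a) 0        ≤⟨ *≤* (ℤP.*-monoʳ-≤-nonNeg (+ 1) (ℤ.+≤+ le)) ⟩
    mkℚᵘ (+ b) 0        ≃⟨ toℚᵘ-/ b 0 ⟨
    ℚ.toℚᵘ (fromℕ b)    ∎)
    where open ℚᵘP.≤-Reasoning

  fromℕ-cancel-≤ : ∀ {a b} → fromℕ a ℚ.≤ fromℕ b → a ≤ b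
  fromℕ-cancel-≤ {a} {b} le = ℤP.drop‿+≤+ (ℤP.*-cancelʳ-≤-pos (+ a) (+ b) (+ 1) (ℚᵘP.drop-*≤* (begin
    mkℚᵘ (+ a) 0        ≃⟨ toℚᵘ-/ a 0 ⟨
    ℚ.toℚᵘ (fromℕ a)    ≤⟨ ℚP.toℚᵘ-mono-≤ le ⟩
    ℚ.toℚᵘ (fromℕ b)    ≃⟨ toℚᵘ-/ b 0 ⟩
    mkℚᵘ (+ b) 0        ∎)))
    where open ℚᵘP.≤-Reasoning

  fromℕ-positive : ∀ a .{{_ : NonZero a}} → ℚ.Positive (fromℕ a)
  fromℕ-positive a = ℚP.normalize-pos a 1

  private
    module ℚGroup = GroupProperties ℚP.+-0-group
    module ℚAbelianGroup = AbelianGroupProperties ℚP.+-0-abelianGroup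

  ≤+⇒-≤ : ∀ {x y z} → x ℚ.≤ y ℚ.+ z → x ℚ.- y ℚ.≤ z
  ≤+⇒-≤ {x} {y} {z} le = subst (x ℚ.- y ℚ.≤_) (ℚAbelianGroup.xyx⁻¹≈y y z) (ℚP.+-monoˡ-≤ (ℚ.- y) le)

  -≤⇒≤+ : ∀ {x y z} → x ℚ.- y ℚ.≤ z → x ℚ.≤ z ℚ.+ y
  -≤⇒≤+ {x} {y} {z} le = subst (ℚ._≤ z ℚ.+ y) (ℚGroup.//-rightDividesˡ y x) (ℚP.+-monoˡ-≤ y le)

  ∣-∣-≤ : ∀ {x y z} → x ℚ.≤ y ℚ.+ z → y ℚ.≤ x ℚ.+ z → ℚ.∣ x ℚ.- y ∣ ℚ.≤ z
  ∣-∣-≤ {x} {y} {z} le ge with ℚP.∣p∣≡p∨∣p∣≡-p (x ℚ.- y)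
  ... | inj₁ eq = subst (ℚ._≤ z) (sym eq) (≤+⇒-≤ le)
  ... | inj₂ eq = subst (ℚ._≤ z) (sym (trans eq (ℚGroup.⁻¹-anti-homo-// x y))) (≤+⇒-≤ ge)

  module _ {m N s t : ℕ} .{{_ : NonZero N}} where
    private
      instance
        positive : ℚ.Positive (fromℕ N)
        positive = fromℕ-positive N

      scaled : fromℕ (m + N * t) ≡ fromℕ N ℚ.* (+ m ℚ./ N ℚ.+ fromℕ t)
      scaled = begin
        fromℕ (m + N * t)                                 ≡⟨ fromℕ-+ m (N * t) ⟩
        fromℕ m ℚ.+ fromℕ (N * t)                         ≡⟨ cong₂ ℚ._+_ (sym (fromℕ-*-/ m N)) (fromℕ-* N t) ⟩
        fromℕ N ℚ.* (+ m ℚ./ N) ℚ.+ fromℕ N ℚ.* fromℕ t   ≡⟨ ℚP.*-distribˡ-+ (fromℕ N) (+ m ℚ./ N) (fromℕ t) ⟨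
        fromℕ N ℚ.* (+ m ℚ./ N ℚ.+ fromℕ t)               ∎
        where open ≡-Reasoning

    ≤-/+ : N * s ≤ m + N * t → fromℕ s ℚ.≤ + m ℚ./ N ℚ.+ fromℕ t
    ≤-/+ le = ℚP.*-cancelˡ-≤-pos (fromℕ N) (subst₂ ℚ._≤_ (fromℕ-* N s) scaled (fromℕ-mono-≤ le))

    /-≤+ : m ≤ N * s + N * t → + m ℚ./ N ℚ.≤ fromℕ s ℚ.+ fromℕ t
    /-≤+ le = ℚP.*-cancelˡ-≤-pos (fromℕ N) (subst₂ ℚ._≤_ (sym (fromℕ-*-/ m N))
      (trans (cong fromℕ (sym (*-distribˡ-+ N s t))) (trans (fromℕ-* N (s + t)) (cong (fromℕ N ℚ.*_) (fromℕ-+ s t)))) (fromℕ-mono-≤ le))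

    ∣-/∣-≤ : N * s ≤ m + N * t → m ≤ N * s + N * t → ℚ.∣ fromℕ s ℚ.- + m ℚ./ N ∣ ℚ.≤ fromℕ t
    ∣-/∣-≤ le ge = ∣-∣-≤ (≤-/+ le) (/-≤+ ge)

    /-≤ : m ≤ N * s + N * t → + m ℚ./ N ℚ.- fromℕ t ℚ.≤ fromℕ s
    /-≤ ge = ≤+⇒-≤ (subst (+ m ℚ./ N ℚ.≤_) (ℚP.+-comm (fromℕ s) (fromℕ t)) (/-≤+ ge))

  /*-≤⇒*-≤ : ∀ {a b m t} .{{_ : NonZero b}} → (+ a ℚ./ b) ℚ.* fromℕ m ℚ.≤ fromℕ t → a * m ≤ b * t
  /*-≤⇒*-≤ {a} {b} {m} {t} le = fromℕ-cancel-≤ (subst₂ ℚ._≤_ left (sym (fromℕ-* b t))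
    (ℚP.*-monoˡ-≤-nonNeg (fromℕ b) {{ℚP.normalize-nonNeg b 1}} le))
    where
    left : fromℕ b ℚ.* ((+ a ℚ./ b) ℚ.* fromℕ m) ≡ fromℕ (a * m)
    left = trans (sym (ℚP.*-assoc (fromℕ b) (+ a ℚ./ b) (fromℕ m))) (trans (cong (ℚ._* fromℕ m) (fromℕ-*-/ a b)) (sym (fromℕ-* a m)))

  ≤-/*⇒*-≤ : ∀ {b m t} .{{_ : NonZero b}} → fromℕ t ℚ.≤ (+ 1 ℚ./ b) ℚ.* fromℕ m → b * t ≤ m
  ≤-/*⇒*-≤ {b} {m} {t} le = fromℕ-cancel-≤ (subst₂ ℚ._≤_ (sym (fromℕ-* b t)) right
    (ℚP.*-monoˡ-≤-nonNeg (fromℕ b) {{ℚP.normalize-nonNeg b 1}} le))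
    where
    right : fromℕ b ℚ.* ((+ 1 ℚ./ b) ℚ.* fromℕ m) ≡ fromℕ m
    right = trans (sym (ℚP.*-assoc (fromℕ b) (+ 1 ℚ./ b) (fromℕ m))) (trans (cong (ℚ._* fromℕ m) (fromℕ-*-/ 1 b)) (ℚP.*-identityˡ (fromℕ m)))

  2r∸3 : ∀ k → 2 * (3 + k) ∸ 3 ≡ 2 * k + 3
  2r∸3 k = trans (cong (_∸ 3) (≤-antisym (farkas (k ∷ []) (κ 2 :* (κ 3 :+ x₀) :≤ κ 3 :+ (κ 2 :* x₀ :+ κ 3)) [] refl [])
    (farkas (k ∷ []) (κ 3 :+ (κ 2 :* x₀ :+ κ 3) :≤ κ 2 :* (κ 3 :+ x₀)) [] refl []))) (m+n∸m≡n 3 (2 * k + 3))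

  2r∸5 : ∀ k → 2 * (3 + k) ∸ 5 ≡ 2 * k + 1
  2r∸5 k = trans (cong (_∸ 5) (≤-antisym (farkas (k ∷ []) (κ 2 :* (κ 3 :+ x₀) :≤ κ 5 :+ (κ 2 :* x₀ :+ κ 1)) [] refl [])
    (farkas (k ∷ []) (κ 5 :+ (κ 2 :* x₀ :+ κ 1) :≤ κ 2 :* (κ 3 :+ x₀)) [] refl []))) (m+n∸m≡n 5 (2 * k + 1))

  -- From f = o(n) to a threshold for n

  module Asymptotics (k : ℕ) (f : ℕ → ℕ) (f>0 : ∀ n → n ≥ 1 → f n ≥ 1) (f=o : f =o id) where
    private
      L : ℕ
      -- The successor turns L f ≤ n into a strict inequality for the factor below it, because f ≥
      -- 1.
      L = suc (1000 * ((2 + k) * (suc k * (2 * k + 3))))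

      eventually : Σ[ N ∈ ℕ ] (∀ n → N ≤ n → fromℕ (f n) ℚ.≤ (+ 1 ℚ./ L) ℚ.* fromℕ n)
      eventually = f=o (+ 1 ℚ./ L) (ℚP.positive⁻¹ (+ 1 ℚ./ L) {{ℚP.normalize-pos 1 L}})

    threshold : ℕ
    -- At least 1, so that the graph has a vertex of minimum degree.
    threshold = suc (proj₁ eventually)

    chromatic-structure : ∀ n → n ≥ threshold → (S : SimpleGraph (Fin n)) → ¬ Contains S (complete (3 + k)) →
      .{{_ : NonZero (2 * (3 + k) ∸ 3)}} →
      (∀ δ → IsMinimumDegree S δ → (+ (2 * (3 + k) ∸ 5) ℚ./ (2 * (3 + k) ∸ 3)) ℚ.* fromℕ n ℚ.- fromℕ (f n) ℚ.≤ fromℕ δ) →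
      ∀ {b m} → proj₁ few-colours < b → m ≡ k → (∀ χ → IsChromaticNumber S χ → b + m ≤ χ) →
      Structure S k (40 * (suc k * suc k * (2 * k + 3)) * f n)
    chromatic-structure (suc n) n≥ S free dense {b} enough refl chromatic =
      structure S k (f (suc n)) positive free (m∸n+n≡m δ≤n) least
        (subst₂ (λ a c → a * suc n ≤ c * (δ + f (suc n))) (2r∸5 k) (2r∸3 k)
          (/*-≤⇒*-≤ {2 * (3 + k) ∸ 5} {2 * (3 + k) ∸ 3} {suc n} (subst ((+ (2 * (3 + k) ∸ 5) ℚ./ (2 * (3 + k) ∸ 3)) ℚ.* fromℕ (suc n) ℚ.≤_) (sym (fromℕ-+ δ (f (suc n)))) (-≤⇒≤+ (dense δ ((v , refl) , least))))))
        (farkas (k ∷ f (suc n) ∷ suc n ∷ []) (κ 1 :+ κ 1000 :* ((κ 2 :+ x₀) :* ((κ 1 :+ x₀) :* ((κ 2 :* x₀ :+ κ 3) :* x₁))) :≤ x₂)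
          ((κ 1 , (κ 1 :+ κ 1000 :* ((κ 2 :+ x₀) :* ((κ 1 :+ x₀) :* (κ 2 :* x₀ :+ κ 3)))) :* x₁ :≤ x₂) ∷ (κ 1 , κ 1 :≤ x₁) ∷ []) refl
          (≤-/*⇒*-≤ {L} {suc n} (proj₂ eventually (suc n) (≤-trans (n≤1+n _) n≥)) ∷ positive ∷ []))
        enough chromatic
      where
      positive : 0 < f (suc n)
      positive = f>0 (suc n) (s≤s z≤n)

      minimum : Σ[ v ∈ Fin (suc n) ] (∀ w → Defs.degree S v ≤ Defs.degree S w)
      minimum = argmin (Defs.degree S)

      v : Fin (suc n)
      v = proj₁ minimum

      δ : ℕ
      δ = Defs.degree S v

      least : ∀ w → δ ≤ Defs.degree S w
      least = proj₂ minimum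

      δ≤n : δ ≤ suc n
      δ≤n = SubsetP.∣p∣≤n (Defs.neighbours S v)

  -- Rational form of the size bounds

  module Bounds (k f : ℕ) .{{2r-3≢0 : NonZero (2 * (3 + k) ∸ 3)}} where
    C : ℕ
    C = 40 * (suc k * suc k * (2 * k + 3))

    private
      N M : ℕ
      N = 2 * (3 + k) ∸ 3
      M = 2 * k + 3

    C-positive : ℚ.0ℚ ℚ.< fromℕ C
    C-positive = ℚP.positive⁻¹ (fromℕ C) {{fromℕ-positive C {{>-nonZero
      (farkas (k ∷ []) (κ 1 :≤ κ 40 :* ((κ 1 :+ x₀) :* (κ 1 :+ x₀) :* (κ 2 :* x₀ :+ κ 3))) [] refl [])}}}}

    within : ∀ {m s} → M * s ≤ m + M * (C * f) → m ≤ M * s + M * (C * f) →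
      ℚ.∣ fromℕ s ℚ.- + m ℚ./ N ∣ ℚ.≤ fromℕ C ℚ.* fromℕ f
    within {m} {s} le ge = subst (ℚ.∣ fromℕ s ℚ.- + m ℚ./ N ∣ ℚ.≤_) (fromℕ-* C f)
      (∣-/∣-≤ {m} {N} {s} (subst (λ d → d * s ≤ m + d * (C * f)) (sym (2r∸3 k)) le) (subst (λ d → m ≤ d * s + d * (C * f)) (sym (2r∸3 k)) ge))

    at-least : ∀ {m s} → m ≤ M * s + M * (C * f) → + m ℚ./ N ℚ.- fromℕ C ℚ.* fromℕ f ℚ.≤ fromℕ s
    at-least {m} {s} ge = subst (λ t → + m ℚ./ N ℚ.- t ℚ.≤ fromℕ s) (fromℕ-* C f)
      (/-≤ {m} {N} {s} (subst (λ d → m ≤ d * s + d * (C * f)) (sym (2r∸3 k)) ge))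

    at-most : ∀ {s} → s ≤ C * f → fromℕ s ℚ.≤ fromℕ C ℚ.* fromℕ f
    at-most {s} le = subst (fromℕ s ℚ.≤_) (fromℕ-* C f) (fromℕ-mono-≤ le)

open import Defs
open import Data.Fin.Base using (Fin)
open import Data.Fin.Subset using (Subset) renaming (∣_∣ to size)
open import Data.Integer.Base using (+_)
open import Data.Nat.Base as ℕ using (ℕ; NonZero; zero; suc; s≤s)
open import Data.Product.Base using (Σ-syntax; _×_; _,_; proj₁; proj₂)
open import Data.Rational.Base using (ℚ; 0ℚ; _/_; _*_; _-_; _≤_; _<_; _≥_; ∣_∣)
open import Data.Vec.Functional using (Vector; _∷_)
open import Function.Base using (id)
open import Relation.Binary.PropositionalEquality using (refl)
open Development using (module Structure; module Bounds; module Asymptotics; few-colours)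

theorem5p3 :
  ∀ (r : ℕ) (r≥3 : r ℕ.≥ 3) →
  let instance
        2r-3≢0 : NonZero (2 ℕ.* r ℕ.∸ 3)
        2r-3≢0 = 2r∸3-nonZero r≥3
  in
  Σ[ C ∈ ℚ ] 0ℚ < C ×
  (∀ (f : ℕ → ℕ) → (∀ n → n ℕ.≥ 1 → f n ℕ.≥ 1) → f =o id →
   Σ[ N ∈ ℕ ]
   (∀ (n : ℕ) → n ℕ.≥ N →
    ∀ (G : SimpleGraph (Fin n)) →
    (complete r -free) G →
    (∀ δ → IsMinimumDegree G δ → fromℕ δ ≥ (+ (2 ℕ.* r ℕ.∸ 5) / (2 ℕ.* r ℕ.∸ 3)) * fromℕ n - fromℕ (f n)) →
    (∀ χ → IsChromaticNumber G χ → χ ℕ.≥ 10 ℕ.^ 391 ℕ.+ (r ℕ.∸ 3)) →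
    Σ[ I₀ ∈ Subset n ] Σ[ I ∈ Vector (Subset n) (r ℕ.∸ 2) ] Σ[ A ∈ Subset n ]
      IsPartition (A ∷ I₀ ∷ I)
      × Independent G I₀
      × (∀ i → Independent G (I i))
      × ∣ fromℕ (size I₀) - + n / (2 ℕ.* r ℕ.∸ 3) ∣ ≤ C * fromℕ (f n)
      × (∀ i → ∣ fromℕ (size (I i)) - + (2 ℕ.* n) / (2 ℕ.* r ℕ.∸ 3) ∣ ≤ C * fromℕ (f n))
      × (Σ[ p ∈ ℕ ] Σ[ q ∈ ℕ ] Σ[ p≥1 ∈ NonZero p ] NonZero q
           × Hom (induced G A) (KG p q {{p≥1}})
           × fromℕ p ≥ + n / (2 ℕ.* r ℕ.∸ 3) - C * fromℕ (f n)
           × fromℕ q ≤ C * fromℕ (f n))))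
theorem5p3 zero ()
theorem5p3 (suc zero) (s≤s ())
theorem5p3 (suc (suc zero)) (s≤s (s≤s ()))
theorem5p3 (suc (suc (suc k))) r≥3 =
  fromℕ C , C-positive , λ f f≥1 f=o → Asymptotics.threshold k f f≥1 f=o , λ n n≥N G free dense chromatic →
    let open Structure (Asymptotics.chromatic-structure k f f≥1 f=o n n≥N G free {{2r∸3-nonZero r≥3}} dense
                          {10 ℕ.^ 391} {suc (suc (suc k)) ℕ.∸ 3} (proj₂ (proj₂ (proj₂ few-colours))) refl chromatic)
        open Bounds k (f n) {{2r∸3-nonZero r≥3}} using (within; at-least; at-most)
    in I₀ , I , A , parts , I₀-independent , I-independent , within I₀-upper I₀-lower , (λ i → within (I-upper i) (I-lower i))
      , p , q , p≢0 , q≢0 , kneser , at-least p-lower , at-most q-upper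
  where open Bounds k 0 {{2r∸3-nonZero r≥3}} using (C; C-positive)
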